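{- Let $\mathsf{M}$ be a loopless matroid. Then the polynomials $\underline{\mathrm{H}}_{\mathsf{M}}(x)$ and $\mathrm{H}_{\mathsf{M}}(x)$ are $\gamma$-positive.
   Context: A polynomial $f(x)\in\mathbb{Z}[x]$ with $x^df(x^{ -1})=f(x)$ can be written uniquely as $f(x)=\sum_{i=0}^{\lfloor d/2\rfloor}\gamma_ix^i(1+x)^{d-2i}$ with $\gamma_i\in\mathbb{Z}$; it is $\gamma$-positive if all $\gamma_i\ge0$. For a loopless matroid $\mathsf{M}$ on $E$ with lattice of flats $\mathcal{L}(\mathsf{M})$: the Chow ring $\underline{\mathrm{CH}}(\mathsf{M})=\mathbb{Q}[x_F:F\in\mathcal{L}(\mathsf{M})\smallsetminus\{\varnothing,E\}]/(I+J)$ ($I$ generated by $x_{F_1}x_{F_2}$ for incomparable $F_1,F_2$; $J$ by $\sum_{F\ni i}x_F-\sum_{F\ni j}x_F$, $i,j\in E$) and the augmented Chow ring $\mathrm{CH}(\mathsf{M})=\mathbb{Q}[x_F,y_i:F\in\mathcal{L}(\mathsf{M})\smallsetminus\{E\},i\in E]/(I'+J')$ ($I'$ generated by $y_i-\sum_{F\not\ni i}x_F$; $J'$ by $x_{F_1}x_{F_2}$, $F_1,F_2$ incomparable, and $y_ix_F$, $i\notin F$), generators of degree 1. $\underline{\mathrm{H}}_{\mathsf{M}}(x)$ and $\mathrm{H}_{\mathsf{M}}(x)$ are their Hilbert series; they satisfy $x^{\operatorname{rk}(\mathsf{M})-1}\underline{\mathrm{H}}_{\mathsf{M}}(x^{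 -1})=\underline{\mathrm{H}}_{\mathsf{M}}(x)$ (for $\operatorname{rk}\ge1$) and $x^{\operatorname{rk}(\mathsf{M})}\mathrm{H}_{\mathsf{M}}(x^{ -1})=\mathrm{H}_{\mathsf{M}}(x)$. -}

module Defs where

open import Data.Nat using (ℕ; zero; suc; _+_; _*_; _∸_; _≤_; _<_; _≤?_; _<?_; ⌊_/2⌋)
import Data.Nat as ℕ
open import Data.Nat.Combinatorics using (_C_)
open import Data.Bool using (Bool)
import Data.Bool as Bool
open import Data.Fin using (Fin; _↑ˡ_; _↑ʳ_)
import Data.Fin.Properties as FinP
open import Data.Fin.Subset using (Subset; ⊤; ⊥; _∪_; _∩_; _⊆_; _∈_; _∉_; ⁅_⁆; ∣_∣; inside; outside)
open import Data.Fin.Subset.Properties using (_∈?_; _⊆?_)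
open import Data.Vec using (Vec; []; _∷_; replicate; _[_]≔_; zipWith; toList)
import Data.Vec as Vec
open import Data.Vec.Properties using (≡-dec)
open import Data.Vec.Relation.Unary.All using (All)
open import Data.List using (List; []; _∷_; _++_; map; concat; concatMap; filter; length; lookup; allFin; cartesianProduct)
open import Data.Rational using (ℚ; 0ℚ; 1ℚ)
import Data.Rational as Q
import Data.Rational.Properties as QP
open import Data.Product using (Σ; _×_; _,_; proj₁; proj₂)
open import Relation.Nullary using (¬_; Dec; yes; no; does)
open import Relation.Nullary.Decidable using (_×-dec_; _→-dec_; ¬?)
open import Relation.Binary.PropositionalEquality using (_≡_; _≢_)

record Matroid (n : ℕ) : Set where
  field
    rank        : Subset n → ℕ
    rank-≤card  : ∀ A → rank A ≤ ∣ A ∣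
    rank-mono   : ∀ {A B} → A ⊆ B → rank A ≤ rank B
    rank-submod : ∀ A B → rank (A ∪ B) + rank (A ∩ B) ≤ rank A + rank B
open Matroid public

rk : ∀ {n} → Matroid n → ℕ
rk M = rank M ⊤

Loopless : ∀ {n} → Matroid n → Set
Loopless {n} M = (e : Fin n) → rank M ⁅ e ⁆ ≡ 1

IsFlat : ∀ {n} → Matroid n → Subset n → Set
IsFlat {n} M F = (e : Fin n) → e ∉ F → rank M F < rank M (F ∪ ⁅ e ⁆)

isFlat? : ∀ {n} (M : Matroid n) (F : Subset n) → Dec (IsFlat M F)
isFlat? M F = FinP.all? (λ e → ¬? (e ∈? F) →-dec (rank M F <? rank M (F ∪ ⁅ e ⁆)))

allSubsets : (n : ℕ) → List (Subset n)
allSubsets zero = [] ∷ []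
allSubsets (suc n) = map (outside ∷_) (allSubsets n) ++ map (inside ∷_) (allSubsets n)

_≟S_ : ∀ {n} (A B : Subset n) → Dec (A ≡ B)
_≟S_ = ≡-dec Bool._≟_

Incomparable : ∀ {n} → Subset n → Subset n → Set
Incomparable F G = ¬ (F ⊆ G) × ¬ (G ⊆ F)

incomparable? : ∀ {n} (F G : Subset n) → Dec (Incomparable F G)
incomparable? F G = ¬? (F ⊆? G) ×-dec ¬? (G ⊆? F)

-- Polynomials over ℚ in m variables (all of degree 1).
-- A monomial is an exponent vector; a polynomial is a finite formal sum of
-- terms, and two polynomials are equal iff all their coefficients agree.

Mon : ℕ → Set
Mon m = Vec ℕ m

Poly : ℕ → Set
Poly m = List (ℚ × Mon m)

coeff : ∀ {m} → Poly m → Mon m → ℚ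
coeff [] μ = 0ℚ
coeff ((c , ν) ∷ p) μ with ≡-dec ℕ._≟_ ν μ
... | yes _ = c Q.+ coeff p μ
... | no  _ = coeff p μ

infix 4 _≈P_
_≈P_ : ∀ {m} → Poly m → Poly m → Set
p ≈P q = ∀ μ → coeff p μ ≡ coeff q μ

_+P_ : ∀ {m} → Poly m → Poly m → Poly m
p +P q = p ++ q

scaleP : ∀ {m} → ℚ → Poly m → Poly m
scaleP c p = map (λ t → (c Q.* proj₁ t , proj₂ t)) p

_-P_ : ∀ {m} → Poly m → Poly m → Poly m
p -P q = p ++ scaleP (Q.- 1ℚ) q

_*P_ : ∀ {m} → Poly m → Poly m → Poly m
p *P q = concatMap (λ s → map (λ t → (proj₁ s Q.* proj₁ t , zipWith _+_ (proj₂ s) (proj₂ t))) q) p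

sumP : ∀ {m} → List (Poly m) → Poly m
sumP = concat

varP : ∀ {m} → Fin m → Poly m
varP {m} i = (1ℚ , replicate m 0 [ i ]≔ 1) ∷ []

deg : ∀ {m} → Mon m → ℕ
deg = Vec.sum

Homogeneous : ∀ {m} → ℕ → Poly m → Set
Homogeneous k p = ∀ μ → coeff p μ ≢ 0ℚ → deg μ ≡ k

InIdeal : ∀ {m} → (gs : List (Poly m)) → Poly m → Set
InIdeal {m} gs p =
  Σ (List (Poly m × Fin (length gs))) λ qs →
    p ≈P sumP (map (λ t → proj₁ t *P lookup gs (proj₂ t)) qs)

linComb : ∀ {m h} → Vec ℚ h → Vec (Poly m) h → Poly m
linComb c B = sumP (toList (zipWith scaleP c B))

-- A graded ℚ-algebra presented as  ℚ[z_1..z_m] / (gens), all z_i of degree 1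
-- (the generators of the ideal are homogeneous).
record Presentation : Set where
  field
    nvars : ℕ
    gens  : List (Poly nvars)
open Presentation public

-- dim_ℚ of the degree-k part of the quotient ring is h:
-- there are h homogeneous degree-k elements whose classes form a ℚ-basis
-- of the degree-k graded piece of the quotient.
GradedDim : (P : Presentation) → ℕ → ℕ → Set
GradedDim P k h =
  Σ (Vec (Poly (nvars P)) h) λ B →
    All (Homogeneous k) B
    × (∀ (c : Vec ℚ h) → InIdeal (gens P) (linComb c B) → ∀ j → Vec.lookup c j ≡ 0ℚ)
    × (∀ (p : Poly (nvars P)) → Homogeneous k p →
         Σ (Vec ℚ h) λ c → InIdeal (gens P) (p -P linComb c B))

IsHilbertFunction : Presentation → (ℕ → ℕ) → Set
IsHilbertFunction P h = ∀ k → GradedDim P k (h k)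

chowFlats : ∀ {n} → Matroid n → List (Subset n)
chowFlats M = filter (λ F → isFlat? M F ×-dec ¬? (F ≟S ⊥) ×-dec ¬? (F ≟S ⊤)) (allSubsets _)

chowPresentation : ∀ {n} → Matroid n → Presentation
chowPresentation {n} M = record { nvars = m ; gens = I ++ J }
  where
    L = chowFlats M
    m = length L
    flat : Fin m → Subset n
    flat = lookup L
    I : List (Poly m)
    I = map (λ ij → varP (proj₁ ij) *P varP (proj₂ ij))
            (filter (λ ij → incomparable? (flat (proj₁ ij)) (flat (proj₂ ij)))
                    (cartesianProduct (allFin m) (allFin m)))
    lin : Fin n → Poly m
    lin a = sumP (map varP (filter (λ i → a ∈? flat i) (allFin m)))
    J : List (Poly m)
    J = map (λ ab → lin (proj₁ ab) -P lin (proj₂ ab)) (cartesianProduct (allFin n) (allFin n))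

augFlats : ∀ {n} → Matroid n → List (Subset n)
augFlats M = filter (λ F → isFlat? M F ×-dec ¬? (F ≟S ⊤)) (allSubsets _)

augChowPresentation : ∀ {n} → Matroid n → Presentation
augChowPresentation {n} M = record { nvars = m₁ + n ; gens = I′ ++ J₁ ++ J₂ }
  where
    L = augFlats M
    m₁ = length L
    flat : Fin m₁ → Subset n
    flat = lookup L
    x : Fin m₁ → Poly (m₁ + n)
    x i = varP (i ↑ˡ n)
    y : Fin n → Poly (m₁ + n)
    y e = varP (m₁ ↑ʳ e)
    I′ : List (Poly (m₁ + n))
    I′ = map (λ e → y e -P sumP (map x (filter (λ i → ¬? (e ∈? flat i)) (allFin m₁)))) (allFin n)
    J₁ : List (Poly (m₁ + n))
    J₁ = map (λ ij → x (proj₁ ij) *P x (proj₂ ij))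
             (filter (λ ij → incomparable? (flat (proj₁ ij)) (flat (proj₂ ij)))
                     (cartesianProduct (allFin m₁) (allFin m₁)))
    J₂ : List (Poly (m₁ + n))
    J₂ = map (λ ei → y (proj₁ ei) *P x (proj₂ ei))
             (filter (λ ei → ¬? (proj₁ ei ∈? flat (proj₂ ei)))
                     (cartesianProduct (allFin n) (allFin m₁)))

-- γ-positivity of the polynomial f(x) = Σ_k f k x^k with respect to the
-- centre of symmetry d/2: f = Σ_{i=0}^{⌊d/2⌋} γ_i x^i (1+x)^{d-2i} with all γ_i ≥ 0.

sumTo : ℕ → (ℕ → ℕ) → ℕ
sumTo zero g = g 0
sumTo (suc N) g = sumTo N g + g (suc N)

-- coefficient of x^k in x^i (1+x)^{d-2i}
gammaBasisCoeff : ℕ → ℕ → ℕ → ℕ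
gammaBasisCoeff d i k with i ≤? k
... | yes _ = (d ∸ 2 * i) C (k ∸ i)
... | no  _ = 0

GammaPositive : ℕ → (ℕ → ℕ) → Set
GammaPositive d f =
  Σ (ℕ → ℕ) λ γ → ∀ k → f k ≡ sumTo ⌊ d /2⌋ (λ i → γ i * gammaBasisCoeff d i k)

{-# OPTIONS --safe #-}

-- Put h_A = Σ_{F ⊇ b} x_F − Σ_{F ⊇ A} x_F, over proper flats F, where b is an atom for the Chow ring
-- and b = ∅ for the augmented one (there y_e = h_{cl e}). Write ρ for the rank, plus one in the augmented case.
-- In both rings h_A = 0 if ρ A = 1, (h_A − h_{A∨B})(h_B − h_{A∨B}) = 0, and h_F h_G = h_G² if G covers F.
-- Rewriting with these relations raises the total rank of a monomial in the h_A, so the nested monomials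
-- h_{G₁}^{a₁} h_{G₂}^{a₂} ⋯ with G₁ ⊂ G₂ ⊂ ⋯ and 0 < aᵢ < ρ Gᵢ − ρ Gᵢ₋₁ span. They are independent: each of them
-- has a functional annihilating the ideal (a product of dragon Hall–Rado conditions over the minors [Gᵢ₋₁, Gᵢ]),
-- and the matrix of these functionals on nested monomials is unitriangular for the total rank.
-- So the Hilbert series is N_⊥, where N_F = 1 + Σ_{G ⊃ F} (x + ⋯ + x^{ρ G − ρ F − 1}) N_G and the
-- bottom is given ρ = 0. Label a cover F ⋖ G by min (G ∖ F). Every interval of flats has exactly one maximal chain with increasing labels, and refining chains
-- accordingly turns this recursion into one over covers whose coefficients are 1, x and 1 + x.

module Submission where

open import Defs
import Data.Nat.Properties as ℕP
open import Data.Bool using (if_then_else_)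
open import Data.Fin using (Fin)
open import Data.Fin.Subset using (Subset; ⊥; _∪_; _⊆_; _∉_; ⁅_⁆)
open import Data.Fin.Subset.Properties using (⊆-refl; ⊆⊤; _⊆?_; _∈?_; ⊆-trans; ⊆-antisym; ⊆-min; x∈⁅x⁆; ⊆-max; ∪-comm; ∪-identityˡ)
open import Data.List using (List; []; _∷_; _++_; map; concatMap; filter; allFin; lookup; length)
open import Data.List.Membership.Propositional using () renaming (_∈_ to _∈ˡ_)
open import Data.List.Membership.Propositional.Properties using (∈-map⁺; ∈-map⁻; ∈-++⁺ˡ; ∈-++⁺ʳ; ∈-++⁻; ∈-concat⁻′; ∈-filter⁻; ∈-allFin; ∈-filter⁺)
open import Data.List.Relation.Binary.Permutation.Propositional using (_↭_; ↭-trans; ↭-reflexive; ↭-sym)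
open import Data.List.Relation.Unary.All using (All) renaming ([] to []ᵃ)
open import Data.List.Relation.Unary.AllPairs using (AllPairs) renaming (_∷_ to _∷ᵘ_; [] to []ᵘ)
open import Data.List.Relation.Unary.Any using (here; there)
open import Data.List.Relation.Unary.Unique.Propositional using (Unique)
open import Data.Nat using (_<_; s≤s; ℕ; _+_; _≤_; _∸_; z≤n; _*_; _≤?_)
open import Data.Product using (∃; _×_; _,_; proj₁; proj₂)
open import Data.Rational using (ℚ; 0ℚ; 1ℚ) renaming (_+_ to _⊕_; _*_ to _⊗_; -_ to ⊖_; _-_ to _⊝_)
open import Data.Rational.Solver using (module +-*-Solver)
open import Data.Sum using (inj₁; inj₂; _⊎_)
open import Data.Vec using (_[_]≔_)
open import Function using (_∘_)
open import Relation.Binary.PropositionalEquality using (_≡_; _≢_; refl; sym; cong; cong₂; module ≡-Reasoning; subst; subst₂)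
open import Relation.Nullary using (Dec; yes; no; does; ¬_)
open import Relation.Nullary.Decidable using (¬?; _→-dec_; _×-dec_)
open import Relation.Nullary.Negation using (contradiction)
open import Relation.Unary using (Decidable)
import Data.List.Relation.Unary.All as All
import Data.List.Relation.Unary.All.Properties as AllP
import Data.List.Relation.Unary.AllPairs as AllPairs
import Data.List.Relation.Unary.AllPairs.Properties as AllPairsP
import Data.List.Relation.Unary.Any as Any
import Data.List.Relation.Unary.Any.Properties as AnyP
import Data.List.Membership.DecPropositional as DecMem
import Relation.Binary.PropositionalEquality as Eq
import Data.Fin.Properties as FinP
import Data.List.Properties as ListP
import Data.List.Relation.Binary.Permutation.Propositional.Properties as Perm
import Data.Rational.Properties as QP
import Data.List.Relation.Unary.Unique.Propositional.Properties as Unique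
import Data.List.Relation.Unary.Unique.DecPropositional.Properties as UniqueDec
import Data.Vec.Relation.Unary.All as VAll
import Data.Vec as Vec
import Data.Vec.Functional.Properties as VecF
import Data.Vec.Properties as VecP
import Data.Nat as ℕ

-- For `F ≠ ⊤`, once the 1 is joined to the term `G = ⊤`, the summands of the recursion for `N_F`
-- are already palindromic about the right centre. But `1 + x + x² = (1 + x)² − x`, so γ-positivity
-- cannot be read off summand by summand; this is why the recursion is regrouped by labels before
-- any induction. Graded dimension is given by an arbitrary basis in each degree, with which the
-- number of nested words has to be compared. The arguments about the rings are therefore dual: no
-- quotient is formed, and elements are probed by functionals on monomials that annihilate the
-- ideal. Spanning means that such a functional vanishes in degree `k` once it vanishes on the
-- nested monomials; the rewriting happens in its values, and no ideal membership has to be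
-- exhibited for it. The dual functionals live on words whose letters `A` stand for `h_A`. Möbius
-- inversion over the flats expresses `x_F` by these letters, and Weisner's theorem shows that the
-- resulting functionals kill `x_F x_G` for incomparable `F` and `G`.

-- Finite rational sums and indicators.

module Sums where

  open import Data.Nat using (zero; suc)
  open import Data.Fin using (zero; suc)
  open import Data.List using (concat)
  open import Data.List.Membership.Propositional using (_∈_)
  open import Function using (id)
  open import Relation.Binary.PropositionalEquality using (trans)

  open +-*-Solver

  ∑ : {A : Set} → List A → (A → ℚ) → ℚ
  ∑ []       f = 0ℚ
  ∑ (x ∷ xs) f = f x ⊕ ∑ xs f

  ind : {P : Set} → Dec P → ℚ
  ind d = if does d then 1ℚ else 0ℚ

  module _ {P : Set} where

    ind-yes : (d : Dec P) → P → ind d ≡ 1ℚ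
    ind-yes (yes _) _ = refl
    ind-yes (no ¬p) p = contradiction p ¬p

    ind-no : (d : Dec P) → ¬ P → ind d ≡ 0ℚ
    ind-no (yes p) ¬p = contradiction p ¬p
    ind-no (no _)  _  = refl

  ind-cong : {P R : Set} (d : Dec P) (e : Dec R) → (P → R) → (R → P) → ind d ≡ ind e
  ind-cong (yes p) e f g = sym (ind-yes e (f p))
  ind-cong (no ¬p) e f g = sym (ind-no e (¬p ∘ g))

  module _ {A : Set} where

    ∑-cong-∈ : ∀ (xs : List A) {f g} → (∀ {x} → x ∈ xs → f x ≡ g x) → ∑ xs f ≡ ∑ xs g
    ∑-cong-∈ []       e = refl
    ∑-cong-∈ (x ∷ xs) e = cong₂ _⊕_ (e (here refl)) (∑-cong-∈ xs (e ∘ there))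

    ∑-cong : ∀ (xs : List A) {f g} → (∀ x → f x ≡ g x) → ∑ xs f ≡ ∑ xs g
    ∑-cong xs e = ∑-cong-∈ xs (λ {x} _ → e x)

    ∑-0 : ∀ (xs : List A) → ∑ xs (λ _ → 0ℚ) ≡ 0ℚ
    ∑-0 []       = refl
    ∑-0 (x ∷ xs) = trans (QP.+-identityˡ _) (∑-0 xs)

    ∑-zero-∈ : ∀ (xs : List A) {f} → (∀ {x} → x ∈ xs → f x ≡ 0ℚ) → ∑ xs f ≡ 0ℚ
    ∑-zero-∈ xs e = trans (∑-cong-∈ xs e) (∑-0 xs)

    ∑-zero : ∀ (xs : List A) {f} → (∀ x → f x ≡ 0ℚ) → ∑ xs f ≡ 0ℚ
    ∑-zero xs e = ∑-zero-∈ xs (λ {x} _ → e x)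

    ∑-⊕ : ∀ (xs : List A) f g → ∑ xs (λ x → f x ⊕ g x) ≡ ∑ xs f ⊕ ∑ xs g
    ∑-⊕ []       f g = refl
    ∑-⊕ (x ∷ xs) f g = trans (cong (f x ⊕ g x ⊕_) (∑-⊕ xs f g))
      (solve 4 (λ a b c d → a :+ b :+ (c :+ d) := a :+ c :+ (b :+ d)) refl (f x) (g x) (∑ xs f) (∑ xs g))

    ∑-⊗ˡ : ∀ (xs : List A) c f → ∑ xs (λ x → c ⊗ f x) ≡ c ⊗ ∑ xs f
    ∑-⊗ˡ []       c f = sym (QP.*-zeroʳ c)
    ∑-⊗ˡ (x ∷ xs) c f = trans (cong (c ⊗ f x ⊕_) (∑-⊗ˡ xs c f)) (sym (QP.*-distribˡ-+ c (f x) (∑ xs f)))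

    ∑-⊗ʳ : ∀ (xs : List A) c f → ∑ xs (λ x → f x ⊗ c) ≡ ∑ xs f ⊗ c
    ∑-⊗ʳ xs c f = trans (∑-cong xs (λ x → QP.*-comm (f x) c)) (trans (∑-⊗ˡ xs c f) (QP.*-comm c _))

    ∑-⊖ : ∀ (xs : List A) f → ∑ xs (λ x → ⊖ f x) ≡ ⊖ ∑ xs f
    ∑-⊖ []       f = refl
    ∑-⊖ (x ∷ xs) f = trans (cong (⊖ f x ⊕_) (∑-⊖ xs f)) (sym (QP.neg-distrib-+ (f x) (∑ xs f)))

    ∑-⊝ : ∀ (xs : List A) f g → ∑ xs (λ x → f x ⊝ g x) ≡ ∑ xs f ⊝ ∑ xs g
    ∑-⊝ xs f g = trans (∑-⊕ xs f (⊖_ ∘ g)) (cong (∑ xs f ⊕_) (∑-⊖ xs g))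

    ∑-++ : ∀ (xs ys : List A) f → ∑ (xs ++ ys) f ≡ ∑ xs f ⊕ ∑ ys f
    ∑-++ []       ys f = sym (QP.+-identityˡ _)
    ∑-++ (x ∷ xs) ys f = trans (cong (f x ⊕_) (∑-++ xs ys f)) (sym (QP.+-assoc (f x) _ _))

    ∑-filter : ∀ {P : A → Set} (P? : Decidable P) (xs : List A) f →
               ∑ (filter P? xs) f ≡ ∑ xs (λ x → ind (P? x) ⊗ f x)
    ∑-filter P? []       f = refl
    ∑-filter P? (x ∷ xs) f with P? x
    ... | yes _ = cong₂ _⊕_ (sym (QP.*-identityˡ (f x))) (∑-filter P? xs f)
    ... | no  _ = trans (∑-filter P? xs f) (sym (trans (cong (_⊕ ∑ xs _) (QP.*-zeroˡ (f x))) (QP.+-identityˡ _)))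

    ∑-pick : ∀ {xs : List A} {x} (f : A → ℚ) → Unique xs → x ∈ xs →
             (∀ {y} → y ∈ xs → y ≢ x → f y ≡ 0ℚ) → ∑ xs f ≡ f x
    ∑-pick {y ∷ xs} f (u ∷ᵘ us) (here refl) z =
      trans (cong (f y ⊕_) (∑-zero-∈ xs (λ i → z (there i) (λ { refl → All.lookup u i refl })))) (QP.+-identityʳ _)
    ∑-pick {y ∷ xs} f (u ∷ᵘ us) (there i) z =
      trans (cong₂ _⊕_ (z (here refl) (λ { refl → All.lookup u i refl })) (∑-pick f us i (z ∘ there)))
            (QP.+-identityˡ _)

  module _ {A B : Set} where

    ∑-map : ∀ (g : A → B) (xs : List A) f → ∑ (map g xs) f ≡ ∑ xs (f ∘ g)
    ∑-map g []       f = refl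
    ∑-map g (x ∷ xs) f = cong (f (g x) ⊕_) (∑-map g xs f)

    ∑-swap : ∀ (xs : List A) (ys : List B) (f : A → B → ℚ) →
             ∑ xs (λ x → ∑ ys (f x)) ≡ ∑ ys (λ y → ∑ xs (λ x → f x y))
    ∑-swap []       ys f = sym (∑-0 ys)
    ∑-swap (x ∷ xs) ys f = trans (cong (∑ ys (f x) ⊕_) (∑-swap xs ys f)) (sym (∑-⊕ ys (f x) _))

  ∑-concat : ∀ {A : Set} (xss : List (List A)) f → ∑ (concat xss) f ≡ ∑ xss (λ xs → ∑ xs f)
  ∑-concat []         f = refl
  ∑-concat (xs ∷ xss) f = trans (∑-++ xs (concat xss) f) (cong (∑ xs f ⊕_) (∑-concat xss f))

  ∑-concatMap : ∀ {A B : Set} (g : A → List B) (xs : List A) f →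
                ∑ (concatMap g xs) f ≡ ∑ xs (λ x → ∑ (g x) f)
  ∑-concatMap g xs f = trans (∑-concat (map g xs) f) (∑-map g xs _)

  ∑-allFin-suc : ∀ {n} (f : Fin (suc n) → ℚ) → ∑ (allFin (suc n)) f ≡ f zero ⊕ ∑ (allFin n) (f ∘ suc)
  ∑-allFin-suc {n} f = cong (f zero ⊕_) (trans (cong (λ l → ∑ l f) (sym (ListP.map-tabulate id suc))) (∑-map suc (allFin n) f))

  ∑-lookup : ∀ {A : Set} (xs : List A) f → ∑ (allFin (length xs)) (f ∘ lookup xs) ≡ ∑ xs f
  ∑-lookup []       f = refl
  ∑-lookup (x ∷ xs) f = trans (∑-allFin-suc {length xs} (f ∘ lookup (x ∷ xs))) (cong (f x ⊕_) (∑-lookup xs f))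

-- Nonzero solutions of underdetermined homogeneous linear systems.

module Kernel where

  open Sums
  open import Data.Nat using (zero; suc)
  open import Data.Fin using (zero; suc; punchIn)
  open import Data.Vec.Functional using (insertAt)
  open import Data.Rational using (1/_; NonZero; ≢-nonZero)
  open import Data.Product using (Σ)
  open import Relation.Binary.PropositionalEquality using (trans)

  open +-*-Solver

  ∑-punchIn : ∀ {n} (p : Fin (suc n)) (f : Fin (suc n) → ℚ) →
              ∑ (allFin (suc n)) f ≡ f p ⊕ ∑ (allFin n) (f ∘ punchIn p)
  ∑-punchIn zero f = ∑-allFin-suc f
  ∑-punchIn {suc n} (suc p) f = begin
    ∑ (allFin (suc (suc n))) f                      ≡⟨ ∑-allFin-suc f ⟩
    f zero ⊕ ∑ (allFin (suc n)) (f ∘ suc)           ≡⟨ cong (f zero ⊕_) (∑-punchIn p (f ∘ suc)) ⟩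
    f zero ⊕ (f (suc p) ⊕ rest)                     ≡⟨ solve 3 (λ a b c → a :+ (b :+ c) := b :+ (a :+ c)) refl (f zero) (f (suc p)) rest ⟩
    f (suc p) ⊕ (f zero ⊕ rest)                     ≡⟨ cong (f (suc p) ⊕_) (∑-allFin-suc (f ∘ punchIn (suc p))) ⟨
    f (suc p) ⊕ ∑ (allFin (suc n)) (f ∘ punchIn (suc p)) ∎
    where
    open ≡-Reasoning
    rest = ∑ (allFin n) (f ∘ suc ∘ punchIn p)

  -- Back-substitution: the row entries `A j ⊕ r j ⊗ b` differ from the reduced ones by multiples of
  -- the pivot entry `b`, and the value `⊖ Σ t r` of the pivot unknown cancels these multiples.
  eliminate : ∀ {h} (t A r : Fin h → ℚ) (b : ℚ) → ∑ (allFin h) (λ j → t j ⊗ A j) ≡ 0ℚ →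
              (⊖ ∑ (allFin h) (λ j → t j ⊗ r j)) ⊗ b ⊕ ∑ (allFin h) (λ j → t j ⊗ (A j ⊕ r j ⊗ b)) ≡ 0ℚ
  eliminate {h} t A r b tA≡0 = begin
    (⊖ R) ⊗ b ⊕ ∑ (allFin h) (λ j → t j ⊗ (A j ⊕ r j ⊗ b))
      ≡⟨ cong ((⊖ R) ⊗ b ⊕_) (∑-cong (allFin h) (λ j →
          solve 4 (λ t a r b → t :* (a :+ r :* b) := t :* a :+ t :* r :* b) refl (t j) (A j) (r j) b)) ⟩
    (⊖ R) ⊗ b ⊕ ∑ (allFin h) (λ j → t j ⊗ A j ⊕ t j ⊗ r j ⊗ b)
      ≡⟨ cong ((⊖ R) ⊗ b ⊕_) (∑-⊕ (allFin h) _ _) ⟩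
    (⊖ R) ⊗ b ⊕ (∑ (allFin h) (λ j → t j ⊗ A j) ⊕ ∑ (allFin h) (λ j → t j ⊗ r j ⊗ b))
      ≡⟨ cong₂ (λ u v → (⊖ R) ⊗ b ⊕ (u ⊕ v)) tA≡0 (∑-⊗ʳ (allFin h) b _) ⟩
    (⊖ R) ⊗ b ⊕ (0ℚ ⊕ R ⊗ b)
      ≡⟨ solve 2 (λ r b → (:- r) :* b :+ (con 0ℚ :+ r :* b) := con 0ℚ) refl R b ⟩
    0ℚ ∎
    where
    open ≡-Reasoning
    R = ∑ (allFin h) (λ j → t j ⊗ r j)

  -- Gaussian elimination on the first column. A zero column imposes nothing; otherwise a pivot row
  -- clears it, and the numbers of equations and unknowns both drop by one.
  kernel : ∀ N {h} → N < h → (A : Fin h → Fin N → ℚ) →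
           Σ (Fin h → ℚ) λ t → (∃ λ j → t j ≢ 0ℚ) × (∀ l → ∑ (allFin h) (λ j → t j ⊗ A j l) ≡ 0ℚ)
  kernel zero    {suc h} _         A = (λ _ → 1ℚ) , (zero , λ ()) , λ ()
  kernel (suc N) {suc h} (s≤s N<h) A with FinP.all? (λ j → A j zero QP.≟ 0ℚ)
  ... | yes col≡0 with t , t≢0 , e ← kernel N (ℕP.m<n⇒m<1+n N<h) (λ j l → A j (suc l)) =
    t , t≢0 , λ where
      zero    → ∑-zero (allFin (suc h)) (λ j → trans (cong (t j ⊗_) (col≡0 j)) (QP.*-zeroʳ (t j)))
      (suc l) → e l
  ... | no ¬col≡0 with p , Ap≢0 ← FinP.¬∀⟶∃¬ _ _ (λ j → A j zero QP.≟ 0ℚ) ¬col≡0 = t , nonzero , vanish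
    where
    instance
      pivot-nonZero : NonZero (A p zero)
      pivot-nonZero = ≢-nonZero Ap≢0
    r : Fin h → ℚ
    r j = A (punchIn p j) zero ⊗ 1/ A p zero
    A′ : Fin h → Fin N → ℚ
    A′ j l = A (punchIn p j) (suc l) ⊝ r j ⊗ A p (suc l)
    ih = kernel N N<h A′
    t′ = proj₁ ih
    t : Fin (suc h) → ℚ
    t = insertAt t′ p (⊖ ∑ (allFin h) (λ j → t′ j ⊗ r j))
    t-p : t p ≡ ⊖ ∑ (allFin h) (λ j → t′ j ⊗ r j)
    t-p = VecF.insertAt-lookup t′ p _
    t-punchIn : ∀ j → t (punchIn p j) ≡ t′ j
    t-punchIn = VecF.insertAt-punchIn t′ p _
    nonzero : ∃ λ j → t j ≢ 0ℚ
    nonzero with j , t′j≢0 ← proj₁ (proj₂ ih) = punchIn p j , λ e → t′j≢0 (trans (sym (t-punchIn j)) e)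
    combine : ∀ l (B : Fin h → ℚ) → ∑ (allFin h) (λ j → t′ j ⊗ B j) ≡ 0ℚ →
              (∀ j → A (punchIn p j) l ≡ B j ⊕ r j ⊗ A p l) → ∑ (allFin (suc h)) (λ j → t j ⊗ A j l) ≡ 0ℚ
    combine l B tB≡0 dec = trans (∑-punchIn p (λ j → t j ⊗ A j l)) (trans
      (cong₂ _⊕_ (cong (_⊗ A p l) t-p) (∑-cong (allFin h) (λ j → cong₂ _⊗_ (t-punchIn j) (dec j))))
      (eliminate t′ B r (A p l) tB≡0))
    vanish : ∀ l → ∑ (allFin (suc h)) (λ j → t j ⊗ A j l) ≡ 0ℚ
    vanish zero = combine zero (λ _ → 0ℚ) (∑-zero (allFin h) (λ j → QP.*-zeroʳ (t′ j))) λ j → begin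
      A (punchIn p j) zero                              ≡⟨ QP.*-identityʳ _ ⟨
      A (punchIn p j) zero ⊗ 1ℚ                         ≡⟨ cong (A (punchIn p j) zero ⊗_) (QP.*-inverseˡ (A p zero)) ⟨
      A (punchIn p j) zero ⊗ (1/ A p zero ⊗ A p zero)   ≡⟨ QP.*-assoc (A (punchIn p j) zero) _ _ ⟨
      r j ⊗ A p zero                                    ≡⟨ QP.+-identityˡ _ ⟨
      0ℚ ⊕ r j ⊗ A p zero                               ∎
      where open ≡-Reasoning
    vanish (suc l) = combine (suc l) (λ j → A′ j l) (proj₂ (proj₂ ih) l) λ j →
      solve 2 (λ a b → a := a :- b :+ b) refl (A (punchIn p j) (suc l)) (r j ⊗ A p (suc l))

-- Polynomials paired with functions on monomials, and ideals seen through them.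

module Pairing where

  open Sums
  open import Algebra.Properties.CommutativeSemigroup ℕP.+-commutativeSemigroup using (interchange)
  open import Data.Nat using (zero; suc)
  open import Data.Fin using (zero; suc)
  open import Data.Vec using ([]; _∷_; replicate; zipWith)
  open import Data.Vec.Properties using (≡-dec)
  open import Data.List using (deduplicate)
  open import Data.List.Membership.Propositional using (_∈_)
  open import Data.List.Membership.Propositional.Properties using (∈-deduplicate⁺)
  open import Relation.Binary.PropositionalEquality using (trans)

  open +-*-Solver

  _≟M_ : ∀ {m} (μ ν : Mon m) → Dec (μ ≡ ν)
  _≟M_ = ≡-dec ℕ._≟_

  infixl 6 _+M_
  _+M_ : ∀ {m} → Mon m → Mon m → Mon m
  _+M_ = zipWith _+_

  ⟪_,_⟫ : ∀ {m} → Poly m → (Mon m → ℚ) → ℚ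
  ⟪ p , f ⟫ = ∑ p (λ t → proj₁ t ⊗ f (proj₂ t))

  module _ {m : ℕ} where

    pair-++ : ∀ (p q : Poly m) f → ⟪ p ++ q , f ⟫ ≡ ⟪ p , f ⟫ ⊕ ⟪ q , f ⟫
    pair-++ p q f = ∑-++ p q _

    pair-scale : ∀ c (p : Poly m) f → ⟪ scaleP c p , f ⟫ ≡ c ⊗ ⟪ p , f ⟫
    pair-scale c p f = trans (∑-map _ p _)
      (trans (∑-cong p (λ t → QP.*-assoc c (proj₁ t) _)) (∑-⊗ˡ p c _))

    pair-sub : ∀ (p q : Poly m) f → ⟪ p -P q , f ⟫ ≡ ⟪ p , f ⟫ ⊝ ⟪ q , f ⟫
    pair-sub p q f = trans (pair-++ p _ f) (cong (⟪ p , f ⟫ ⊕_) (trans (pair-scale (⊖ 1ℚ) q f)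
      (solve 1 (λ a → (:- con 1ℚ) :* a := :- a) refl ⟪ q , f ⟫)))

    pair-sum : ∀ (ps : List (Poly m)) f → ⟪ sumP ps , f ⟫ ≡ ∑ ps (λ p → ⟪ p , f ⟫)
    pair-sum ps f = ∑-concat ps _

    pair-mul : ∀ (p q : Poly m) f → ⟪ p *P q , f ⟫ ≡ ∑ p (λ s → proj₁ s ⊗ ⟪ q , (λ ν → f (proj₂ s +M ν)) ⟫)
    pair-mul p q f = trans (∑-concatMap _ p _) (∑-cong p (λ s → trans (∑-map _ q _)
      (trans (∑-cong q (λ t → QP.*-assoc (proj₁ s) (proj₁ t) _)) (∑-⊗ˡ q (proj₁ s) _))))

    pair-var : ∀ (i : Fin m) f → ⟪ varP i , f ⟫ ≡ f (replicate m 0 [ i ]≔ 1)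
    pair-var i f = trans (QP.+-identityʳ _) (QP.*-identityˡ _)

    pair-linear : ∀ (p : Poly m) (c : ℚ) f → ⟪ p , (λ μ → c ⊗ f μ) ⟫ ≡ c ⊗ ⟪ p , f ⟫
    pair-linear p c f = trans (∑-cong p (λ t →
      solve 3 (λ a b c → a :* (b :* c) := b :* (a :* c)) refl (proj₁ t) c (f (proj₂ t)))) (∑-⊗ˡ p c _)

    pair-∑ : ∀ {A : Set} (p : Poly m) (xs : List A) (f : A → Mon m → ℚ) →
             ⟪ p , (λ μ → ∑ xs (λ x → f x μ)) ⟫ ≡ ∑ xs (λ x → ⟪ p , f x ⟫)
    pair-∑ p xs f = trans (∑-cong p (λ t → sym (∑-⊗ˡ xs (proj₁ t) _))) (∑-swap p xs _)

    coeff-pair : ∀ (p : Poly m) μ → coeff p μ ≡ ⟪ p , (λ ν → ind (ν ≟M μ)) ⟫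
    coeff-pair [] μ = refl
    coeff-pair ((c , ν) ∷ p) μ with ν ≟M μ
    ... | yes _ = cong₂ _⊕_ (sym (QP.*-identityʳ c)) (coeff-pair p μ)
    ... | no  _ = trans (coeff-pair p μ) (sym (trans (cong (_⊕ _) (QP.*-zeroʳ c)) (QP.+-identityˡ _)))

    -- A polynomial may list a monomial several times. Collecting its terms over a duplicate-free
    -- support makes the pairing depend on coefficients alone, so that functionals respect `≈P`.
    pair-coeff : ∀ (p : Poly m) {S : List (Mon m)} → Unique S → (∀ {t} → t ∈ p → proj₂ t ∈ S) → ∀ f →
                 ⟪ p , f ⟫ ≡ ∑ S (λ ν → coeff p ν ⊗ f ν)
    pair-coeff p {S} u S∋ f = begin
      ∑ p (λ t → proj₁ t ⊗ f (proj₂ t))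
        ≡⟨ ∑-cong-∈ p (λ {t} t∈p → cong (proj₁ t ⊗_) (sym (pick t t∈p))) ⟩
      ∑ p (λ t → proj₁ t ⊗ ∑ S (λ ν → ind (proj₂ t ≟M ν) ⊗ f ν))
        ≡⟨ pair-∑ p S (λ ν μ → ind (μ ≟M ν) ⊗ f ν) ⟩
      ∑ S (λ ν → ∑ p (λ t → proj₁ t ⊗ (ind (proj₂ t ≟M ν) ⊗ f ν)))
        ≡⟨ ∑-cong S (λ ν → trans (∑-cong p (λ t → sym (QP.*-assoc (proj₁ t) _ (f ν)))) (∑-⊗ʳ p (f ν) _)) ⟩
      ∑ S (λ ν → ⟪ p , (λ μ → ind (μ ≟M ν)) ⟫ ⊗ f ν)
        ≡⟨ ∑-cong S (λ ν → cong (_⊗ f ν) (sym (coeff-pair p ν))) ⟩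
      ∑ S (λ ν → coeff p ν ⊗ f ν) ∎
      where
      open ≡-Reasoning
      pick : ∀ t → t ∈ p → ∑ S (λ ν → ind (proj₂ t ≟M ν) ⊗ f ν) ≡ f (proj₂ t)
      pick t t∈p = trans
        (∑-pick _ u (S∋ t∈p) (λ {ν} _ ν≢ → trans (cong (_⊗ f ν) (ind-no (proj₂ t ≟M ν) (ν≢ ∘ sym))) (QP.*-zeroˡ (f ν))))
        (trans (cong (_⊗ f (proj₂ t)) (ind-yes (proj₂ t ≟M proj₂ t) refl)) (QP.*-identityˡ _))

    pair-≈ : ∀ (p q : Poly m) → p ≈P q → ∀ f → ⟪ p , f ⟫ ≡ ⟪ q , f ⟫
    pair-≈ p q p≈q f = trans (pair-coeff p u (λ i → ∈-deduplicate⁺ _≟M_ (∈-++⁺ˡ (∈-map⁺ proj₂ i))) f)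
      (trans (∑-cong (deduplicate _≟M_ (map proj₂ p ++ map proj₂ q)) (λ ν → cong (_⊗ f ν) (p≈q ν)))
        (sym (pair-coeff q u (λ i → ∈-deduplicate⁺ _≟M_ (∈-++⁺ʳ (map proj₂ p) (∈-map⁺ proj₂ i))) f)))
      where
      u = UniqueDec.deduplicate-! _≟M_ (map proj₂ p ++ map proj₂ q)

    ≈-pair : ∀ (p q : Poly m) → (∀ f → ⟪ p , f ⟫ ≡ ⟪ q , f ⟫) → p ≈P q
    ≈-pair p q e μ = trans (coeff-pair p μ) (trans (e _) (sym (coeff-pair q μ)))

  deg-+M : ∀ {m} (μ ν : Mon m) → deg (μ +M ν) ≡ deg μ + deg ν
  deg-+M []      []      = refl
  deg-+M (a ∷ μ) (b ∷ ν) = trans (cong (a + b +_) (deg-+M μ ν)) (interchange a b (deg μ) (deg ν))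

  -- Monomial multiples of the generators span the ideal, so this is annihilation of the ideal.
  Annihilates : ∀ {m} → (Mon m → ℚ) → List (Poly m) → Set
  Annihilates f gs = ∀ w i → ⟪ lookup gs i , (λ ν → f (w +M ν)) ⟫ ≡ 0ℚ

  module _ {m : ℕ} (gs : List (Poly m)) where

    private
      combination : List (Poly m × Fin (length gs)) → Poly m
      combination qs = sumP (map (λ t → proj₁ t *P lookup gs (proj₂ t)) qs)

      pair-combination : ∀ qs f → ⟪ combination qs , f ⟫ ≡ ∑ qs (λ t → ⟪ proj₁ t *P lookup gs (proj₂ t) , f ⟫)
      pair-combination qs f = trans (pair-sum (map (λ t → proj₁ t *P lookup gs (proj₂ t)) qs) f) (∑-map _ qs (λ p → ⟪ p , f ⟫))

    annihilates-ideal : ∀ f p → Annihilates f gs → InIdeal gs p → ⟪ p , f ⟫ ≡ 0ℚ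
    annihilates-ideal f p ann (qs , p≈) = trans (pair-≈ p (combination qs) p≈ f) (trans (pair-combination qs f)
      (∑-zero qs (λ t → trans (pair-mul (proj₁ t) (lookup gs (proj₂ t)) f)
        (∑-zero (proj₁ t) (λ s → trans (cong (proj₁ s ⊗_) (ann (proj₂ s) (proj₂ t))) (QP.*-zeroʳ (proj₁ s)))))))

    ideal-≈ : ∀ p q → (∀ f → ⟪ p , f ⟫ ≡ ⟪ q , f ⟫) → InIdeal gs q → InIdeal gs p
    ideal-≈ p q e (qs , q≈) = qs , λ μ → trans (≈-pair p q e μ) (q≈ μ)

    ideal-gen : ∀ w i → InIdeal gs (((1ℚ , w) ∷ []) *P lookup gs i)
    ideal-gen w i = ((((1ℚ , w) ∷ []) , i) ∷ []) , ≈-pair (((1ℚ , w) ∷ []) *P lookup gs i) (combination qs)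
      (λ f → sym (trans (pair-combination qs f) (QP.+-identityʳ _)))
      where qs = (((1ℚ , w) ∷ []) , i) ∷ []

    ideal-0 : InIdeal gs []
    ideal-0 = [] , λ _ → refl

    ideal-+ : ∀ p q → InIdeal gs p → InIdeal gs q → InIdeal gs (p ++ q)
    ideal-+ p q (ps , p≈) (qs , q≈) = (ps ++ qs) , ≈-pair (p ++ q) (combination (ps ++ qs)) λ f → begin
      ⟪ p ++ q , f ⟫                                   ≡⟨ pair-++ p q f ⟩
      ⟪ p , f ⟫ ⊕ ⟪ q , f ⟫                            ≡⟨ cong₂ _⊕_ (pair-≈ p (combination ps) p≈ f) (pair-≈ q (combination qs) q≈ f) ⟩
      ⟪ combination ps , f ⟫ ⊕ ⟪ combination qs , f ⟫  ≡⟨ cong₂ _⊕_ (pair-combination ps f) (pair-combination qs f) ⟩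
      _                                                ≡⟨ ∑-++ ps qs _ ⟨
      _                                                ≡⟨ pair-combination (ps ++ qs) f ⟨
      ⟪ combination (ps ++ qs) , f ⟫                   ∎
      where open ≡-Reasoning

    ideal-scale : ∀ c p → InIdeal gs p → InIdeal gs (scaleP c p)
    ideal-scale c p (ps , p≈) = map scale ps , ≈-pair (scaleP c p) (combination (map scale ps)) λ f → begin
      ⟪ scaleP c p , f ⟫                        ≡⟨ pair-scale c p f ⟩
      c ⊗ ⟪ p , f ⟫                             ≡⟨ cong (c ⊗_) (trans (pair-≈ p (combination ps) p≈ f) (pair-combination ps f)) ⟩
      c ⊗ ∑ ps (λ t → ⟪ proj₁ t *P lookup gs (proj₂ t) , f ⟫)  ≡⟨ ∑-⊗ˡ ps c _ ⟨
      ∑ ps (λ t → c ⊗ ⟪ proj₁ t *P lookup gs (proj₂ t) , f ⟫)  ≡⟨ ∑-cong ps (λ t → scale-mul (proj₁ t) (lookup gs (proj₂ t)) f) ⟩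
      ∑ ps (λ t → ⟪ scaleP c (proj₁ t) *P lookup gs (proj₂ t) , f ⟫)  ≡⟨ ∑-map scale ps _ ⟨
      _                                         ≡⟨ pair-combination (map scale ps) f ⟨
      ⟪ combination (map scale ps) , f ⟫        ∎
      where
      open ≡-Reasoning
      scale : Poly m × Fin (length gs) → Poly m × Fin (length gs)
      scale t = scaleP c (proj₁ t) , proj₂ t
      scale-mul : ∀ q g f → c ⊗ ⟪ q *P g , f ⟫ ≡ ⟪ scaleP c q *P g , f ⟫
      scale-mul q g f = trans (cong (c ⊗_) (pair-mul q g f)) (trans (sym (∑-⊗ˡ q c _))
        (trans (∑-cong q (λ s → sym (QP.*-assoc c (proj₁ s) _)))
          (trans (sym (∑-map _ q _)) (sym (pair-mul (scaleP c q) g f)))))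

    ideal-∑ : ∀ {A : Set} (xs : List A) (p : A → Poly m) → (∀ {x} → x ∈ xs → InIdeal gs (p x)) → InIdeal gs (concatMap p xs)
    ideal-∑ []       p e = ideal-0
    ideal-∑ (x ∷ xs) p e = ideal-+ (p x) (concatMap p xs) (e (here refl)) (ideal-∑ xs p (e ∘ there))

  -- Termwise, hence stronger than `Homogeneous`, under which terms of other degrees may be present
  -- and cancel.
  AllDeg : ∀ {m} → ℕ → Poly m → Set
  AllDeg d p = ∀ {t} → t ∈ p → deg (proj₂ t) ≡ d

  module _ {m : ℕ} where

    allDeg-++ : ∀ {d} {p q : Poly m} → AllDeg d p → AllDeg d q → AllDeg d (p ++ q)
    allDeg-++ {p = p} dp dq i with ∈-++⁻ p i
    ... | inj₁ i∈p = dp i∈p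
    ... | inj₂ i∈q = dq i∈q

    allDeg-concatMap : ∀ {A : Set} {d} (f : A → Poly m) (xs : List A) → (∀ x → AllDeg d (f x)) → AllDeg d (concatMap f xs)
    allDeg-concatMap f (x ∷ xs) e = allDeg-++ {p = f x} (e x) (allDeg-concatMap f xs e)

    allDeg-sumP : ∀ {A : Set} {d} (f : A → Poly m) (xs : List A) → (∀ x → AllDeg d (f x)) → AllDeg d (sumP (map f xs))
    allDeg-sumP = allDeg-concatMap

    allDeg-scale : ∀ {d} c {p : Poly m} → AllDeg d p → AllDeg d (scaleP c p)
    allDeg-scale c {p} dp i with t , t∈p , refl ← ∈-map⁻ _ i = dp t∈p

    allDeg-sub : ∀ {d} {p q : Poly m} → AllDeg d p → AllDeg d q → AllDeg d (p -P q)
    allDeg-sub {p = p} {q} dp dq = allDeg-++ {p = p} dp (allDeg-scale (⊖ 1ℚ) {q} dq)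

    allDeg-mul : ∀ {d e} {p q : Poly m} → AllDeg d p → AllDeg e q → AllDeg (d + e) (p *P q)
    allDeg-mul {d} {e} {p = p} {q} dp dq {t} i =
      let xs , i∈xs , xs∈ = ∈-concat⁻′ (map row p) i in go xs∈ i∈xs
      where
      cell : ℚ × Mon m → ℚ × Mon m → ℚ × Mon m
      cell s t = proj₁ s ⊗ proj₁ t , proj₂ s +M proj₂ t
      row : ℚ × Mon m → Poly m
      row s = map (cell s) q
      go : ∀ {xs} → xs ∈ map row p → t ∈ xs → deg (proj₂ t) ≡ d + e
      go xs∈ t∈ with s , s∈p , refl ← ∈-map⁻ row xs∈ with t , t∈q , refl ← ∈-map⁻ (cell s) t∈ =
        trans (deg-+M (proj₂ s) (proj₂ t)) (cong₂ _+_ (dp s∈p) (dq t∈q))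

    allDeg-var : ∀ (i : Fin m) → AllDeg 1 (varP i)
    allDeg-var i (here refl) = deg-unit i
      where
      deg-0 : ∀ m → deg (replicate m 0) ≡ 0
      deg-0 zero    = refl
      deg-0 (suc m) = deg-0 m
      deg-unit : ∀ {m} (i : Fin m) → deg (replicate m 0 [ i ]≔ 1) ≡ 1
      deg-unit {suc m} zero    = cong suc (deg-0 m)
      deg-unit {suc m} (suc i) = deg-unit i

    allDeg⇒coeff : ∀ {d} {p : Poly m} → AllDeg d p → ∀ {μ} → deg μ ≢ d → coeff p μ ≡ 0ℚ
    allDeg⇒coeff {p = p} dp {μ} degμ≢ = trans (coeff-pair p μ) (∑-zero-∈ p (λ {t} t∈p →
      trans (cong (proj₁ t ⊗_) (ind-no (proj₂ t ≟M μ) (λ { refl → degμ≢ (dp t∈p) }))) (QP.*-zeroʳ (proj₁ t))))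

    allDeg⇒homogeneous : ∀ {d} {p : Poly m} → AllDeg d p → Homogeneous d p
    allDeg⇒homogeneous {d} {p} dp μ c≢0 with deg μ ℕ.≟ d
    ... | yes e = e
    ... | no ¬e = contradiction (allDeg⇒coeff {p = p} dp ¬e) c≢0

-- A dual criterion for the dimension of a graded piece.

module Dimension where

  open Sums
  open Kernel
  open Pairing
  open import Data.Vec using (Vec; []; _∷_; replicate; tabulate)
  open import Data.Vec.Membership.Propositional.Properties using (∈-lookup)
  open import Data.List.Relation.Unary.Unique.Propositional.Properties using (allFin⁺)
  open import Relation.Binary.Definitions using (tri<; tri≈; tri>)
  open import Relation.Binary.PropositionalEquality using (trans)

  open +-*-Solver

  pair-linComb : ∀ {m h} (c : Vec ℚ h) (B : Vec (Poly m) h) f →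
                 ⟪ linComb c B , f ⟫ ≡ ∑ (allFin h) (λ j → Vec.lookup c j ⊗ ⟪ Vec.lookup B j , f ⟫)
  pair-linComb [] [] f = refl
  pair-linComb (c ∷ cs) (b ∷ B) f = trans (pair-++ (scaleP c b) (linComb cs B) f)
    (trans (cong₂ _⊕_ (pair-scale c b f) (pair-linComb cs B f)) (sym (∑-allFin-suc (λ j → Vec.lookup (c ∷ cs) j ⊗ ⟪ Vec.lookup (b ∷ B) j , f ⟫))))

  module Coordinates (P : Presentation) {k h : ℕ} (gd : GradedDim P k h)
    (gens-deg : ∀ i → ∃ λ d → AllDeg d (lookup (gens P) i)) where

    private
      m = nvars P
      I = gens P
      B = proj₁ gd
      B-hom = proj₁ (proj₂ gd)
      independent = proj₁ (proj₂ (proj₂ gd))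
      span = proj₂ (proj₂ (proj₂ gd))

      allDeg-mon : ∀ {μ : Mon m} → deg μ ≡ k → AllDeg k ((1ℚ , μ) ∷ [])
      allDeg-mon e (here refl) = e

    -- Coordinates modulo the ideal in the given basis. The value zero in all other degrees turns
    -- each coordinate into a functional on the whole polynomial ring.
    coordinates : Mon m → Vec ℚ h
    coordinates μ with deg μ ℕ.≟ k
    ... | yes e = proj₁ (span ((1ℚ , μ) ∷ []) (allDeg⇒homogeneous {p = (1ℚ , μ) ∷ []} (allDeg-mon e)))
    ... | no _  = replicate h 0ℚ

    coord : Fin h → Mon m → ℚ
    coord j μ = Vec.lookup (coordinates μ) j

    private
      coordinates-span : ∀ μ → deg μ ≡ k → InIdeal I (((1ℚ , μ) ∷ []) -P linComb (coordinates μ) B)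
      coordinates-span μ e with deg μ ℕ.≟ k
      ... | yes e′ = proj₂ (span ((1ℚ , μ) ∷ []) (allDeg⇒homogeneous {p = (1ℚ , μ) ∷ []} (allDeg-mon e′)))
      ... | no ¬e = contradiction e ¬e

      coord-0 : ∀ j μ → deg μ ≢ k → coord j μ ≡ 0ℚ
      coord-0 j μ ¬e with deg μ ℕ.≟ k
      ... | yes e = contradiction e ¬e
      ... | no _ = VecP.lookup-replicate j 0ℚ

      cs : Poly m → Vec ℚ h
      cs p = tabulate (λ j → ⟪ p , coord j ⟫)

      pair-cs : ∀ p f → ⟪ linComb (cs p) B , f ⟫ ≡ ∑ (allFin h) (λ j → ⟪ p , coord j ⟫ ⊗ ⟪ Vec.lookup B j , f ⟫)
      pair-cs p f = trans (pair-linComb (cs p) B f)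
        (∑-cong (allFin h) (λ j → cong (_⊗ _) (VecP.lookup∘tabulate _ j)))

    reduce : ∀ p → AllDeg k p → InIdeal I (p -P linComb (cs p) B)
    reduce p dp = ideal-≈ I (p -P linComb (cs p) B) (concatMap term p) eq
      (ideal-∑ I p term (λ {t} t∈p → ideal-scale I (proj₁ t) (rem t) (coordinates-span (proj₂ t) (dp t∈p))))
      where
      rem : ℚ × Mon m → Poly m
      rem t = ((1ℚ , proj₂ t) ∷ []) -P linComb (coordinates (proj₂ t)) B
      term : ℚ × Mon m → Poly m
      term t = scaleP (proj₁ t) (rem t)
      eq : ∀ f → ⟪ p -P linComb (cs p) B , f ⟫ ≡ ⟪ concatMap term p , f ⟫
      eq f = sym (begin
        ⟪ concatMap term p , f ⟫
          ≡⟨ ∑-concatMap term p _ ⟩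
        ∑ p (λ t → ⟪ term t , f ⟫)
          ≡⟨ ∑-cong p (λ t → trans (pair-scale (proj₁ t) (rem t) f) (cong (proj₁ t ⊗_)
               (trans (pair-sub ((1ℚ , proj₂ t) ∷ []) (linComb (coordinates (proj₂ t)) B) f)
                      (cong₂ _⊝_ (trans (QP.+-identityʳ _) (QP.*-identityˡ (f (proj₂ t)))) (pair-linComb (coordinates (proj₂ t)) B f))))) ⟩
        ∑ p (λ t → proj₁ t ⊗ (f (proj₂ t) ⊝ ∑ (allFin h) (λ j → coord j (proj₂ t) ⊗ b j)))
          ≡⟨ ∑-cong p (λ t → solve 3 (λ a b c → a :* (b :- c) := a :* b :- a :* c) refl (proj₁ t) (f (proj₂ t)) _) ⟩
        ∑ p (λ t → proj₁ t ⊗ f (proj₂ t) ⊝ proj₁ t ⊗ ∑ (allFin h) (λ j → coord j (proj₂ t) ⊗ b j))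
          ≡⟨ ∑-⊝ p _ _ ⟩
        ⟪ p , f ⟫ ⊝ ∑ p (λ t → proj₁ t ⊗ ∑ (allFin h) (λ j → coord j (proj₂ t) ⊗ b j))
          ≡⟨ cong (⟪ p , f ⟫ ⊝_) (pair-∑ p (allFin h) (λ j μ → coord j μ ⊗ b j)) ⟩
        ⟪ p , f ⟫ ⊝ ∑ (allFin h) (λ j → ∑ p (λ t → proj₁ t ⊗ (coord j (proj₂ t) ⊗ b j)))
          ≡⟨ cong (⟪ p , f ⟫ ⊝_) (∑-cong (allFin h) (λ j →
               trans (∑-cong p (λ t → sym (QP.*-assoc (proj₁ t) _ (b j)))) (∑-⊗ʳ p (b j) _))) ⟩
        ⟪ p , f ⟫ ⊝ ∑ (allFin h) (λ j → ⟪ p , coord j ⟫ ⊗ b j)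
          ≡⟨ cong (⟪ p , f ⟫ ⊝_) (pair-cs p f) ⟨
        ⟪ p , f ⟫ ⊝ ⟪ linComb (cs p) B , f ⟫
          ≡⟨ pair-sub p (linComb (cs p) B) f ⟨
        ⟪ p -P linComb (cs p) B , f ⟫ ∎)
        where
        open ≡-Reasoning
        b = λ j → ⟪ Vec.lookup B j , f ⟫

    coord-ideal : ∀ p → AllDeg k p → InIdeal I p → ∀ j → ⟪ p , coord j ⟫ ≡ 0ℚ
    coord-ideal p dp p∈I j = trans (sym (VecP.lookup∘tabulate _ j)) (independent (cs p)
      (ideal-≈ I (linComb (cs p) B) (p ++ scaleP (⊖ 1ℚ) r)
        (λ f → sym (trans (pair-++ p (scaleP (⊖ 1ℚ) r) f)
          (trans (cong (⟪ p , f ⟫ ⊕_) (trans (pair-scale (⊖ 1ℚ) r f) (cong (⊖ 1ℚ ⊗_) (pair-sub p (linComb (cs p) B) f))))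
            (solve 2 (λ a b → a :+ (:- con 1ℚ) :* (a :- b) := b) refl ⟪ p , f ⟫ ⟪ linComb (cs p) B , f ⟫))))
        (ideal-+ I p (scaleP (⊖ 1ℚ) r) p∈I (ideal-scale I (⊖ 1ℚ) r (reduce p dp)))) j)
      where
      r = p -P linComb (cs p) B

    -- Here homogeneity of the generators enters: a monomial multiple of a generator lies wholly in
    -- degree `k`, where it is an ideal element and independence of the basis makes its coordinates
    -- zero, or wholly outside, where `coord` is zero by convention.
    coord-annihilates : ∀ j → Annihilates (coord j) I
    coord-annihilates j w i with d , dg ← gens-deg i with deg w + d ℕ.≟ k
    ... | no ¬e = ∑-zero-∈ (lookup I i) (λ {t} t∈g → trans
      (cong (proj₁ t ⊗_) (coord-0 j (w +M proj₂ t) (λ e → ¬e (trans (cong (deg w +_) (sym (dg t∈g))) (trans (sym (deg-+M w (proj₂ t))) e)))))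
      (QP.*-zeroʳ (proj₁ t)))
    ... | yes e = trans (sym (trans (pair-mul ((1ℚ , w) ∷ []) (lookup I i) (coord j))
        (trans (QP.+-identityʳ _) (QP.*-identityˡ _))))
      (coord-ideal (((1ℚ , w) ∷ []) *P lookup I i)
        (subst (λ d → AllDeg d (((1ℚ , w) ∷ []) *P lookup I i)) e
          (allDeg-mul {p = (1ℚ , w) ∷ []} {q = lookup I i} (λ { (here refl) → refl }) dg))
        (ideal-gen I w i) j)

    private
      -- The basis elements are homogeneous only up to cancellation. Dropping the terms of other
      -- degrees leaves an equal polynomial to which the termwise statements apply.
      homPart : Fin h → Poly m
      homPart j = filter (λ t → deg (proj₂ t) ℕ.≟ k) (Vec.lookup B j)

      homPart-deg : ∀ j → AllDeg k (homPart j)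
      homPart-deg j i = proj₂ (∈-filter⁻ (λ t → deg (proj₂ t) ℕ.≟ k) {xs = Vec.lookup B j} i)

      homPart-≈ : ∀ j → homPart j ≈P Vec.lookup B j
      homPart-≈ j μ with deg μ ℕ.≟ k
      ... | no ¬e = trans (allDeg⇒coeff {p = homPart j} (homPart-deg j) ¬e) (sym coeffB≡0)
        where
        coeffB≡0 : coeff (Vec.lookup B j) μ ≡ 0ℚ
        coeffB≡0 with coeff (Vec.lookup B j) μ QP.≟ 0ℚ
        ... | yes z = z
        ... | no ¬z = contradiction (VAll.lookup B-hom (∈-lookup j B) μ ¬z) ¬e
      ... | yes e = trans (coeff-pair (homPart j) μ) (trans (∑-filter _ (Vec.lookup B j) _)
        (trans (∑-cong (Vec.lookup B j) same) (sym (coeff-pair (Vec.lookup B j) μ))))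
        where
        same : ∀ t → ind (deg (proj₂ t) ℕ.≟ k) ⊗ (proj₁ t ⊗ ind (proj₂ t ≟M μ)) ≡ proj₁ t ⊗ ind (proj₂ t ≟M μ)
        same t with proj₂ t ≟M μ
        ... | yes refl = trans (cong (_⊗ (proj₁ t ⊗ 1ℚ)) (ind-yes (deg (proj₂ t) ℕ.≟ k) e)) (QP.*-identityˡ _)
        ... | no _ = trans (cong (ind (deg (proj₂ t) ℕ.≟ k) ⊗_) (QP.*-zeroʳ (proj₁ t)))
                       (trans (QP.*-zeroʳ (ind (deg (proj₂ t) ℕ.≟ k))) (sym (QP.*-zeroʳ (proj₁ t))))

      δ : Fin h → Fin h → ℚ
      δ j l = ind (j FinP.≟ l)

      ∑-δ : ∀ j (g : Fin h → ℚ) → ∑ (allFin h) (λ l → δ j l ⊗ g l) ≡ g j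
      ∑-δ j g = trans (∑-pick _ (allFin⁺ h) (∈-allFin j)
          (λ {l} _ l≢j → trans (cong (_⊗ g l) (ind-no (j FinP.≟ l) (l≢j ∘ sym))) (QP.*-zeroˡ (g l))))
        (trans (cong (_⊗ g j) (ind-yes (j FinP.≟ j) refl)) (QP.*-identityˡ _))

      -- The coordinates form the dual basis: a basis element minus its own expansion is a
      -- combination of the basis lying in the ideal, so its coefficients are zero.
      coord-homPart : ∀ j l → ⟪ homPart j , coord l ⟫ ≡ δ j l
      coord-homPart j l = trans (solve 2 (λ a b → a := b :- (b :- a)) refl ⟪ p , coord l ⟫ (δ j l))
        (trans (cong (δ j l ⊝_) (trans (sym (VecP.lookup∘tabulate _ l)) (independent d∈ inI l))) (QP.+-identityʳ _))
        where
        p = homPart j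
        d∈ : Vec ℚ h
        d∈ = tabulate (λ l → δ j l ⊝ ⟪ p , coord l ⟫)
        inI : InIdeal I (linComb d∈ B)
        inI = ideal-≈ I (linComb d∈ B) (p -P linComb (cs p) B) eq (reduce p (homPart-deg j))
          where
          open ≡-Reasoning
          eq : ∀ f → ⟪ linComb d∈ B , f ⟫ ≡ ⟪ p -P linComb (cs p) B , f ⟫
          eq f = begin
            ⟪ linComb d∈ B , f ⟫
              ≡⟨ pair-linComb d∈ B f ⟩
            ∑ (allFin h) (λ l → Vec.lookup d∈ l ⊗ b l)
              ≡⟨ ∑-cong (allFin h) (λ l → trans (cong (_⊗ b l) (VecP.lookup∘tabulate _ l))
                   (solve 3 (λ a b c → (a :- b) :* c := a :* c :- b :* c) refl (δ j l) ⟪ p , coord l ⟫ (b l))) ⟩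
            ∑ (allFin h) (λ l → δ j l ⊗ b l ⊝ ⟪ p , coord l ⟫ ⊗ b l)
              ≡⟨ ∑-⊝ (allFin h) _ _ ⟩
            ∑ (allFin h) (λ l → δ j l ⊗ b l) ⊝ ∑ (allFin h) (λ l → ⟪ p , coord l ⟫ ⊗ b l)
              ≡⟨ cong₂ _⊝_ (∑-δ j b) (sym (pair-cs p f)) ⟩
            b j ⊝ ⟪ linComb (cs p) B , f ⟫
              ≡⟨ cong (_⊝ ⟪ linComb (cs p) B , f ⟫) (sym (pair-≈ p (Vec.lookup B j) (homPart-≈ j) f)) ⟩
            ⟪ p , f ⟫ ⊝ ⟪ linComb (cs p) B , f ⟫
              ≡⟨ pair-sub p (linComb (cs p) B) f ⟨
            ⟪ p -P linComb (cs p) B , f ⟫ ∎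
            where
            b = λ l → ⟪ Vec.lookup B l , f ⟫

    -- Either strict inequality leaves more unknowns than equations. If `N < h`, a nonzero
    -- combination of coordinate functionals kills every `b l`, hence all of degree `k`, yet its
    -- values on the basis are its own coefficients. If `h < N`, a nonzero combination of the `b l`
    -- has zero coordinates, so it lies in the ideal and every annihilating functional kills it.
    dimension-unique : ∀ N (b : Fin N → Poly m) → (∀ l → AllDeg k (b l)) →
      (∀ f → Annihilates f I → (∀ l → ⟪ b l , f ⟫ ≡ 0ℚ) → ∀ μ → deg μ ≡ k → f μ ≡ 0ℚ) →
      (∀ u → (∀ f → Annihilates f I → ∑ (allFin N) (λ l → u l ⊗ ⟪ b l , f ⟫) ≡ 0ℚ) → ∀ l → u l ≡ 0ℚ) →
      h ≡ N
    dimension-unique N b b-deg spanning indep with ℕP.<-cmp N h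
    ... | tri≈ _ N≡h _ = sym N≡h
    ... | tri< N<h _ _ with t , (j , tj≢0) , e ← kernel N N<h (λ j l → ⟪ b l , coord j ⟫) =
      contradiction tj≡0 tj≢0
      where
      f : Mon m → ℚ
      f μ = ∑ (allFin h) (λ j → t j ⊗ coord j μ)
      pair-f : ∀ p → ⟪ p , f ⟫ ≡ ∑ (allFin h) (λ j → t j ⊗ ⟪ p , coord j ⟫)
      pair-f p = trans (pair-∑ p (allFin h) (λ j μ → t j ⊗ coord j μ)) (∑-cong (allFin h) (λ j → pair-linear p (t j) (coord j)))
      f-annihilates : Annihilates f I
      f-annihilates w i = trans (pair-∑ (lookup I i) (allFin h) (λ j ν → t j ⊗ coord j (w +M ν)))
        (∑-zero (allFin h) (λ j → trans (pair-linear (lookup I i) (t j) _)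
          (trans (cong (t j ⊗_) (coord-annihilates j w i)) (QP.*-zeroʳ (t j)))))
      f-zero : ∀ μ → deg μ ≡ k → f μ ≡ 0ℚ
      f-zero = spanning f f-annihilates (λ l → trans (pair-f (b l)) (e l))
      tj≡0 : t j ≡ 0ℚ
      tj≡0 = trans (sym (trans (∑-cong (allFin h) (λ l → trans (cong (t l ⊗_) (coord-homPart j l)) (QP.*-comm (t l) _))) (∑-δ j t)))
        (trans (sym (pair-f (homPart j))) (∑-zero-∈ (homPart j) (λ {s} s∈ →
          trans (cong (proj₁ s ⊗_) (f-zero (proj₂ s) (homPart-deg j s∈))) (QP.*-zeroʳ (proj₁ s)))))
    ... | tri> _ _ h<N with u , (l , ul≢0) , e ← kernel h h<N (λ l j → ⟪ b l , coord j ⟫) =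
      contradiction (indep u vanish l) ul≢0
      where
      p : Poly m
      p = concatMap (λ l → scaleP (u l) (b l)) (allFin N)
      p-deg : AllDeg k p
      p-deg = allDeg-concatMap (λ l → scaleP (u l) (b l)) (allFin N) (λ l → allDeg-scale (u l) {b l} (b-deg l))
      pair-p : ∀ f → ⟪ p , f ⟫ ≡ ∑ (allFin N) (λ l → u l ⊗ ⟪ b l , f ⟫)
      pair-p f = trans (∑-concatMap (λ l → scaleP (u l) (b l)) (allFin N) _) (∑-cong (allFin N) (λ l → pair-scale (u l) (b l) f))
      p∈I : InIdeal I p
      p∈I = ideal-≈ I p (p -P linComb (cs p) B) (λ f → sym (trans (pair-sub p (linComb (cs p) B) f)
        (trans (cong (⟪ p , f ⟫ ⊝_) (trans (pair-cs p f) (∑-zero (allFin h) (λ j →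
          trans (cong (_⊗ ⟪ Vec.lookup B j , f ⟫) (trans (pair-p (coord j)) (e j))) (QP.*-zeroˡ ⟪ Vec.lookup B j , f ⟫)))))
          (QP.+-identityʳ _)))) (reduce p p-deg)
      vanish : ∀ f → Annihilates f I → ∑ (allFin N) (λ l → u l ⊗ ⟪ b l , f ⟫) ≡ 0ℚ
      vanish f ann = trans (sym (pair-p f)) (annihilates-ideal I f p ann p∈I)

-- Rank, closure and the lattice of flats.

module Flats where

  import Data.Empty
  open import Data.Fin.Subset.Properties
  open import Data.Nat using (zero; suc)
  open import Data.Fin using (zero; suc)
  open import Data.Bool using (true; false)
  open import Data.Fin.Subset using (⊤; _∩_; _∈_; ∣_∣; inside; outside)
  open import Data.Vec using ([]; _∷_)
  open import Data.Sum using ([_,_])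
  open import Relation.Nullary.Decidable using (decidable-stable)
  open import Relation.Binary.PropositionalEquality using (trans)

  ∪-lub : ∀ {n} {A B C : Subset n} → A ⊆ C → B ⊆ C → A ∪ B ⊆ C
  ∪-lub {A = A} {B} a b x∈ = [ a , b ] (x∈p∪q⁻ A B x∈)

  ∪-mono : ∀ {n} {A B C D : Subset n} → A ⊆ C → B ⊆ D → A ∪ B ⊆ C ∪ D
  ∪-mono {C = C} {D} a b = ∪-lub (⊆-trans a (p⊆p∪q D)) (⊆-trans b (q⊆p∪q C D))

  ⁅⁆-⊆ : ∀ {n} {e : Fin n} {A : Subset n} → e ∈ A → ⁅ e ⁆ ⊆ A
  ⁅⁆-⊆ {e = e} e∈A x∈ with refl ← x∈⁅y⁆⇒x≡y e x∈ = e∈A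

  ⊈-witness : ∀ {n} {A B : Subset n} → ¬ (A ⊆ B) → ∃ λ e → e ∈ A × e ∉ B
  ⊈-witness {A = A} {B} A⊈B with FinP.any? (λ e → (e ∈? A) ×-dec ¬? (e ∈? B))
  ... | yes w = w
  ... | no ¬w = contradiction (λ {x} x∈A → decidable-stable (x ∈? B) (λ x∉B → ¬w (x , x∈A , x∉B))) A⊈B

  allSubsets-complete : ∀ {n} (A : Subset n) → A ∈ˡ allSubsets n
  allSubsets-complete []          = here refl
  allSubsets-complete (false ∷ A) = ∈-++⁺ˡ (∈-map⁺ (outside ∷_) (allSubsets-complete A))
  allSubsets-complete (true ∷ A)  = ∈-++⁺ʳ (map (outside ∷_) (allSubsets _)) (∈-map⁺ (inside ∷_) (allSubsets-complete A))

  allSubsets-unique : ∀ n → Unique (allSubsets n)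
  allSubsets-unique zero    = []ᵃ ∷ᵘ []ᵘ
  allSubsets-unique (suc n) = Unique.++⁺ (Unique.map⁺ (λ { refl → refl }) (allSubsets-unique n))
    (Unique.map⁺ (λ { refl → refl }) (allSubsets-unique n)) λ where
      (i , j) → case (∈-map⁻ (outside ∷_) i) (∈-map⁻ (inside ∷_) j)
    where
    case : ∀ {v : Subset (suc n)} → (∃ λ A → A ∈ˡ allSubsets n × v ≡ outside ∷ A) →
           (∃ λ A → A ∈ˡ allSubsets n × v ≡ inside ∷ A) → Data.Empty.⊥
    case (_ , _ , refl) (_ , _ , ())

  module FlatLattice {n : ℕ} (M : Matroid n) where

    private
      r = rank M

    Flat : Subset n → Set
    Flat = IsFlat M

    rank-⊥ : r ⊥ ≡ 0
    rank-⊥ = ℕP.n≤0⇒n≡0 (subst (r ⊥ ≤_) (∣⊥∣≡0 n) (rank-≤card M ⊥))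

    rank-⁅⁆ : ∀ e → r ⁅ e ⁆ ≤ 1
    rank-⁅⁆ e = subst (r ⁅ e ⁆ ≤_) (∣⁅x⁆∣≡1 e) (rank-≤card M ⁅ e ⁆)

    rank-∪ : ∀ A B → r (A ∪ B) ≤ r A + r B
    rank-∪ A B = ℕP.≤-trans (ℕP.m≤m+n (r (A ∪ B)) (r (A ∩ B))) (rank-submod M A B)

    rank-uncross : ∀ {A B C D} → D ⊆ A → D ⊆ B → C ⊆ A ∪ B → r C + r D ≤ r A + r B
    rank-uncross {A} {B} D⊆A D⊆B C⊆ = ℕP.≤-trans
      (ℕP.+-mono-≤ (rank-mono M C⊆) (rank-mono M (λ x → x∈p∩q⁺ (D⊆A x , D⊆B x)))) (rank-submod M A B)

    -- Submodularity for `X ∪ A` and `B`, both of which contain `A`: what adds no rank to `A` adds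
    -- none to `X ∪ A`.
    rank-absorb : ∀ {A B} X → A ⊆ B → r B ≤ r A → r (X ∪ A) ≡ r (X ∪ B)
    rank-absorb {A} {B} X A⊆B rB≤rA = ℕP.≤-antisym (rank-mono M (∪-mono ⊆-refl A⊆B))
      (ℕP.+-cancelʳ-≤ (r A) _ _ (ℕP.≤-trans
        (rank-uncross {X ∪ A} {B} (q⊆p∪q X A) A⊆B (∪-mono (p⊆p∪q A) ⊆-refl))
        (ℕP.+-monoʳ-≤ (r (X ∪ A)) rB≤rA)))

    flat-absorb : ∀ {A B F} → Flat F → A ⊆ B → r B ≤ r A → A ⊆ F → B ⊆ F
    flat-absorb {A} {B} {F} flat A⊆B rB≤rA A⊆F {e} e∈B = decidable-stable (e ∈? F) λ e∉F →
      ℕP.<⇒≱ (flat e e∉F) (ℕP.≤-trans (rank-mono M (∪-mono ⊆-refl (⁅⁆-⊆ e∈B)))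
        (subst (_≤ r F) (rank-absorb F A⊆B rB≤rA) (rank-mono M (∪-lub ⊆-refl A⊆F))))

    flat-rank-< : ∀ {A B} → Flat A → A ⊆ B → ¬ (B ⊆ A) → r A < r B
    flat-rank-< {A} {B} flat A⊆B B⊈A with e , e∈B , e∉A ← ⊈-witness B⊈A =
      ℕP.<-≤-trans (flat e e∉A) (rank-mono M (∪-lub A⊆B (⁅⁆-⊆ e∈B)))

    flat-rank-≡ : ∀ {A B} → Flat A → A ⊆ B → r B ≤ r A → A ≡ B
    flat-rank-≡ {A} {B} flat A⊆B rB≤rA with B ⊆? A
    ... | yes B⊆A = ⊆-antisym A⊆B B⊆A
    ... | no B⊈A  = contradiction rB≤rA (ℕP.<⇒≱ (flat-rank-< flat A⊆B B⊈A))

    flat-⊤ : Flat ⊤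
    flat-⊤ e e∉⊤ = contradiction ∈⊤ e∉⊤

    private
      -- Elements that do not raise the rank are added one by one; the fuel `k` is at least the
      -- number of elements still outside `A`.
      close : ∀ k A → n ≤ k + ∣ A ∣ → ∃ λ B → Flat B × A ⊆ B × r B ≤ r A
      close k A n≤ with isFlat? M A
      ... | yes flat = A , flat , ⊆-refl , ℕP.≤-refl
      ... | no ¬flat with e , ¬i ← FinP.¬∀⟶∃¬ n _ (λ e → ¬? (e ∈? A) →-dec (r A ℕ.<? r (A ∪ ⁅ e ⁆))) ¬flat
                     with e ∈? A
      ...   | yes e∈A = contradiction (λ e∉A → contradiction e∈A e∉A) ¬i
      ...   | no e∉A = grow k n≤
        where
        A⊂ : ∣ A ∣ < ∣ A ∪ ⁅ e ⁆ ∣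
        A⊂ = p⊂q⇒∣p∣<∣q∣ (p⊆p∪q ⁅ e ⁆ , e , q⊆p∪q A ⁅ e ⁆ (x∈⁅x⁆ e) , e∉A)
        grow : ∀ k → n ≤ k + ∣ A ∣ → ∃ λ B → Flat B × A ⊆ B × r B ≤ r A
        grow zero n≤ = contradiction (subst (e ∈_) (sym (∣p∣≡n⇒p≡⊤ (ℕP.≤-antisym (∣p∣≤n A) n≤))) ∈⊤) e∉A
        grow (suc k) n≤ with B , flat , A⊆B , rB≤ ← close k (A ∪ ⁅ e ⁆)
          (ℕP.≤-trans n≤ (subst (_≤ k + ∣ A ∪ ⁅ e ⁆ ∣) (ℕP.+-suc k ∣ A ∣) (ℕP.+-monoʳ-≤ k A⊂))) =
          B , flat , ⊆-trans (p⊆p∪q ⁅ e ⁆) A⊆B , ℕP.≤-trans rB≤ (ℕP.≮⇒≥ (λ lt → ¬i (λ _ → lt)))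

      abstract
        closure : ∀ A → ∃ λ B → Flat B × A ⊆ B × r B ≤ r A
        closure A = close n A (ℕP.m≤m+n n ∣ A ∣)

    cl : Subset n → Subset n
    cl A = proj₁ (closure A)

    cl-flat : ∀ A → Flat (cl A)
    cl-flat A = proj₁ (proj₂ (closure A))

    cl-⊇ : ∀ A → A ⊆ cl A
    cl-⊇ A = proj₁ (proj₂ (proj₂ (closure A)))

    rank-cl-≤ : ∀ A → r (cl A) ≤ r A
    rank-cl-≤ A = proj₂ (proj₂ (proj₂ (closure A)))

    rank-cl : ∀ A → r (cl A) ≡ r A
    rank-cl A = ℕP.≤-antisym (rank-cl-≤ A) (rank-mono M (cl-⊇ A))

    cl-least : ∀ {A F} → Flat F → A ⊆ F → cl A ⊆ F
    cl-least {A} flat = flat-absorb flat (cl-⊇ A) (rank-cl-≤ A)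

    rank-∪-cl : ∀ X A → r (X ∪ cl A) ≡ r (X ∪ A)
    rank-∪-cl X A = sym (rank-absorb X (cl-⊇ A) (rank-cl-≤ A))

    infixr 6 _∨_
    _∨_ : Subset n → Subset n → Subset n
    A ∨ B = cl (A ∪ B)

    ∨-left : ∀ A B → A ⊆ A ∨ B
    ∨-left A B = ⊆-trans (p⊆p∪q B) (cl-⊇ (A ∪ B))

    ∨-right : ∀ A B → B ⊆ A ∨ B
    ∨-right A B = ⊆-trans (q⊆p∪q A B) (cl-⊇ (A ∪ B))

    ∨-least : ∀ {A B F} → Flat F → A ⊆ F → B ⊆ F → A ∨ B ⊆ F
    ∨-least flat A⊆F B⊆F = cl-least flat (∪-lub A⊆F B⊆F)

    rank-cover : ∀ {F e} → Flat F → e ∉ F → r (F ∨ ⁅ e ⁆) ≡ suc (r F)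
    rank-cover {F} {e} flat e∉F = trans (rank-cl (F ∪ ⁅ e ⁆)) (ℕP.≤-antisym
      (ℕP.≤-trans (rank-∪ F ⁅ e ⁆) (subst (r F + r ⁅ e ⁆ ≤_) (ℕP.+-comm (r F) 1) (ℕP.+-monoʳ-≤ (r F) (rank-⁅⁆ e))))
      (flat e e∉F))

    flats : List (Subset n)
    flats = filter (isFlat? M) (allSubsets n)

    ∈-flats : ∀ {F} → Flat F → F ∈ˡ flats
    ∈-flats flat = ∈-filter⁺ (isFlat? M) (allSubsets-complete _) flat

    flats-flat : ∀ {F} → F ∈ˡ flats → Flat F
    flats-flat i = proj₂ (∈-filter⁻ (isFlat? M) {xs = allSubsets n} i)

    flats-unique : Unique flats
    flats-unique = Unique.filter⁺ (isFlat? M) (allSubsets-unique n)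

    Above : Subset n → Subset n → Set
    Above F G = F ⊆ G × ¬ (G ⊆ F)

    above? : ∀ F G → Dec (Above F G)
    above? F G = (F ⊆? G) ×-dec ¬? (G ⊆? F)

    above : Subset n → List (Subset n)
    above F = filter (above? F) flats

-- Nested words and their enumeration without repetition.

module NestedWords where

  open Flats
  open import Data.Nat using (zero; suc)
  open import Data.List using (replicate)
  open import Data.List.Membership.Propositional using (_∈_)
  open import Data.List.Membership.Propositional.Properties using (∈-concat⁺′)
  open import Data.List.Relation.Binary.Disjoint.Propositional using (Disjoint)

  module Nesting {n : ℕ} (M : Matroid n) (s : ℕ) where

    open FlatLattice M

    ρ : Subset n → ℕ
    ρ A = s + rank M A

    Elem : Subset n → Set
    Elem A = Flat A × 1 ≤ ρ A

    Word : Set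
    Word = List (Subset n)

    -- Supports and exponents of the basis monomials h_{G₁}^{a₁} h_{G₂}^{a₂} ⋯ with
    -- F ⊂ G₁ ⊂ G₂ ⊂ ⋯ and 0 < aᵢ < ρ Gᵢ − ρ Gᵢ₋₁, where the bottom F is given the rank c.
    data Nested (F : Subset n) (c : ℕ) : Word → Set where
      nil  : Nested F c []
      step : ∀ {G a w} → Flat G → Above F G → suc a + suc c ≤ ρ G → Nested G (ρ G) w →
             Nested F c (replicate (suc a) G ++ w)

    start : ℕ → List Word
    start zero    = [] ∷ []
    start (suc k) = []

    -- The fuel `f` bounds the number of distinct flats in a word; since ranks grow strictly,
    -- `rk M − rank F` suffices. In `powers` the exponent of `G` is built one copy at a time: after
    -- each copy the word either moves on to larger flats or takes another of the `m` copies
    -- allowed.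
    enum : ℕ → Subset n → ℕ → ℕ → List Word
    powers : ℕ → Subset n → ℕ → ℕ → List Word

    enum zero    F c k = start k
    enum (suc f) F c k = start k ++ concatMap (λ G → powers f G (ρ G ∸ suc c) k) (above F)

    powers f G zero    k       = []
    powers f G (suc m) zero    = []
    powers f G (suc m) (suc k) = map (G ∷_) (enum f G (ρ G) k ++ powers f G m k)

    powers-complete : ∀ f G m a w → suc a ≤ m → w ∈ enum f G (ρ G) (length w) →
                      replicate (suc a) G ++ w ∈ powers f G m (length (replicate (suc a) G ++ w))
    powers-complete f G (suc m) zero    w _        i = ∈-map⁺ (G ∷_) (∈-++⁺ˡ i)
    powers-complete f G (suc m) (suc a) w (s≤s le) i = ∈-map⁺ (G ∷_) (∈-++⁺ʳ (enum f G (ρ G) _) (powers-complete f G m a w le i))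

    enum-complete : ∀ f {F c w} → rk M ≤ f + rank M F → Flat F → Nested F c w → w ∈ enum f F c (length w)
    enum-complete zero    le flatF nil = here refl
    enum-complete (suc f) le flatF nil = here refl
    enum-complete zero    {F} le flatF (step {G} flat (F⊆G , G⊈F) _ _) =
      contradiction (ℕP.≤-trans (rank-mono M {G} ⊆⊤) le) (ℕP.<⇒≱ (flat-rank-< flatF F⊆G G⊈F))
    enum-complete (suc f) {F} {c} le flatF (step {G} {a} {w} flat (F⊆G , G⊈F) room nested) =
      ∈-++⁺ʳ (start (length (replicate (suc a) G ++ w))) (∈-concat⁺′
        (powers-complete f G (ρ G ∸ suc c) a w (ℕP.m+n≤o⇒m≤o∸n (suc a) room) (enum-complete f
          (ℕP.≤-trans le (subst (_≤ f + rank M G) (ℕP.+-suc f (rank M F)) (ℕP.+-monoʳ-≤ f (flat-rank-< flatF F⊆G G⊈F))))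
          flat nested))
        (∈-map⁺ (λ G → powers f G (ρ G ∸ suc c) _) (∈-filter⁺ (above? F) (∈-flats flat) (F⊆G , G⊈F))))

    private
      start-sound : ∀ k {w} → w ∈ start k → w ≡ [] × length w ≡ k
      start-sound zero (here refl) = refl , refl

    enum-sound : ∀ f F c k {w} → w ∈ enum f F c k → Nested F c w × length w ≡ k
    powers-sound : ∀ f G m k {w} → w ∈ powers f G m k →
      ∃ λ a → ∃ λ v → w ≡ replicate (suc a) G ++ v × suc a ≤ m × Nested G (ρ G) v × length w ≡ k

    enum-sound zero F c k i with refl , e ← start-sound k i = nil , e
    enum-sound (suc f) F c k i with ∈-++⁻ (start k) i
    ... | inj₁ i₁ with refl , e ← start-sound k i₁ = nil , e
    ... | inj₂ i₂ with xs , w∈xs , xs∈ ← ∈-concat⁻′ (map (λ G → powers f G (ρ G ∸ suc c) k) (above F)) i₂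
      with G , G∈ , refl ← ∈-map⁻ (λ G → powers f G (ρ G ∸ suc c) k) xs∈
      with G∈flats , F⊂G ← ∈-filter⁻ (above? F) {xs = flats} G∈
      with a , v , refl , a≤ , nested , e ← powers-sound f G (ρ G ∸ suc c) k w∈xs =
        step (flats-flat G∈flats) F⊂G
          (room a≤) nested , e
      where
      room : ∀ {a m} → suc a ≤ m ∸ suc c → suc a + suc c ≤ m
      room {a} {m} a≤ = subst (suc a + suc c ≤_) (ℕP.m∸n+n≡m {m} {suc c} (ℕP.<⇒≤ (ℕP.m∸n≢0⇒n<m {m} {suc c} (λ e → ℕP.<⇒≱ a≤ (subst (_≤ a) (sym e) z≤n))))) (ℕP.+-monoˡ-≤ (suc c) a≤)

    powers-sound f G (suc m) (suc k) i with v , v∈ , refl ← ∈-map⁻ (G ∷_) i with ∈-++⁻ (enum f G (ρ G) k) v∈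
    ... | inj₁ v∈₁ with nested , e ← enum-sound f G (ρ G) k v∈₁ = 0 , v , refl , s≤s z≤n , nested , cong suc e
    ... | inj₂ v∈₂ with a , u , refl , a≤ , nested , e ← powers-sound f G m k v∈₂ =
      suc a , u , refl , s≤s a≤ , nested , cong suc e

    private
      start-unique : ∀ k → Unique (start k)
      start-unique zero    = []ᵃ ∷ᵘ []ᵘ
      start-unique (suc k) = []ᵘ

      enum-head : ∀ f F c k {w G} → w ∈ enum f F c k → ∀ {v} → w ≡ G ∷ v → Above F G
      enum-head f F c k i e with enum-sound f F c k i
      enum-head f F c k i refl | step _ F⊂G _ _ , _ = F⊂G

      powers-head : ∀ f G m k {w} → w ∈ powers f G m k → ∃ λ v → w ≡ G ∷ v
      powers-head f G m k i with a , v , e , _ ← powers-sound f G m k i = _ , e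

    -- The first letter tells the branches apart: different flats in `enum`, and in `powers` a flat
    -- strictly above `G` against one more copy of `G`.
    enum-unique : ∀ f F c k → Unique (enum f F c k)
    powers-unique : ∀ f G m k → Unique (powers f G m k)

    enum-unique zero    F c k = start-unique k
    enum-unique (suc f) F c k = Unique.++⁺ (start-unique k)
      (Unique.concat⁺ (AllP.map⁺ (All.universal (λ G → powers-unique f G (ρ G ∸ suc c) k) (above F)))
        (AllPairsP.map⁺ (AllPairs.map
          (λ {G} {H} → powers-disjoint {G} {H})
          (Unique.filter⁺ (above? F) flats-unique))))
      λ (i , j) → start-disjoint (start-sound k i) j
      where
      disjoint : ∀ {G H : Subset n} {w : Word} → G ≢ H → (∃ λ v → w ≡ G ∷ v) → ¬ (∃ λ v → w ≡ H ∷ v)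
      disjoint G≢H (_ , refl) (_ , refl) = G≢H refl
      powers-disjoint : ∀ {G H} → G ≢ H → Disjoint (powers f G (ρ G ∸ suc c) k) (powers f H (ρ H ∸ suc c) k)
      powers-disjoint {G} {H} G≢H (i , j) =
        disjoint G≢H (powers-head f G (ρ G ∸ suc c) k i) (powers-head f H (ρ H ∸ suc c) k j)
      start-disjoint : ∀ {w} → w ≡ [] × length w ≡ k → ¬ (w ∈ concatMap (λ G → powers f G (ρ G ∸ suc c) k) (above F))
      start-disjoint (refl , _) j with xs , w∈xs , xs∈ ← ∈-concat⁻′ (map (λ G → powers f G (ρ G ∸ suc c) k) (above F)) j
        with G , _ , refl ← ∈-map⁻ (λ G → powers f G (ρ G ∸ suc c) k) xs∈
        with _ , () ← powers-head f G (ρ G ∸ suc c) k w∈xs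

    powers-unique f G zero    k       = []ᵘ
    powers-unique f G (suc m) zero    = []ᵘ
    powers-unique f G (suc m) (suc k) = Unique.map⁺ ListP.∷-injectiveʳ
      (Unique.++⁺ (enum-unique f G (ρ G) k) (powers-unique f G m k)
        λ (i , j) → proj₂ (enum-head f G (ρ G) k i (proj₂ (powers-head f G m k j))) ⊆-refl)

-- Operations that preserve γ-positivity.

module GammaClosure where

  open import Algebra.Properties.CommutativeSemigroup ℕP.+-commutativeSemigroup using (interchange)
  open import Data.Nat using (zero; suc; ⌊_/2⌋)
  open import Data.Nat.Combinatorics using (_C_; k>n⇒nCk≡0; nCk+nC[k+1]≡[n+1]C[k+1])
  open import Relation.Binary.PropositionalEquality using (trans)

  -- A polynomial is given by its coefficient function; this is multiplication by x.
  shift : (ℕ → ℕ) → ℕ → ℕ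
  shift f zero    = 0
  shift f (suc k) = f k

  one : ℕ → ℕ
  one zero    = 1
  one (suc k) = 0

  shift-cong : ∀ {f g} → (∀ k → f k ≡ g k) → ∀ k → shift f k ≡ shift g k
  shift-cong e zero    = refl
  shift-cong e (suc k) = e k

  shift-+ : ∀ f g k → shift (λ k → f k + g k) k ≡ shift f k + shift g k
  shift-+ f g zero    = refl
  shift-+ f g (suc k) = refl

  sumTo-cong : ∀ N {f g} → (∀ i → i ≤ N → f i ≡ g i) → sumTo N f ≡ sumTo N g
  sumTo-cong zero    e = e 0 z≤n
  sumTo-cong (suc N) e = cong₂ _+_ (sumTo-cong N (λ i i≤N → e i (ℕP.m≤n⇒m≤1+n i≤N))) (e (suc N) ℕP.≤-refl)

  sumTo-0 : ∀ N {f} → (∀ i → f i ≡ 0) → sumTo N f ≡ 0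
  sumTo-0 zero    e = e 0
  sumTo-0 (suc N) e = cong₂ _+_ (sumTo-0 N e) (e (suc N))

  sumTo-+ : ∀ N f g → sumTo N (λ i → f i + g i) ≡ sumTo N f + sumTo N g
  sumTo-+ zero    f g = refl
  sumTo-+ (suc N) f g = trans (cong (_+ (f (suc N) + g (suc N))) (sumTo-+ N f g)) (interchange (sumTo N f) (sumTo N g) _ _)

  sumTo-suc : ∀ N f → sumTo (suc N) f ≡ f 0 + sumTo N (λ i → f (suc i))
  sumTo-suc zero    f = refl
  sumTo-suc (suc N) f = trans (cong (_+ f (suc (suc N))) (sumTo-suc N f)) (ℕP.+-assoc (f 0) _ _)

  basis-≤ : ∀ d {i k} → i ≤ k → gammaBasisCoeff d i k ≡ (d ∸ 2 * i) C (k ∸ i)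
  basis-≤ d {i} {k} i≤k with i ≤? k
  ... | yes _ = refl
  ... | no ¬p = contradiction i≤k ¬p

  basis-> : ∀ d {i k} → ¬ (i ≤ k) → gammaBasisCoeff d i k ≡ 0
  basis-> d {i} {k} i≰k with i ≤? k
  ... | yes p = contradiction p i≰k
  ... | no _  = refl

  basis-shift : ∀ d i k → gammaBasisCoeff (2 + d) (suc i) k ≡ shift (gammaBasisCoeff d i) k
  basis-shift d i zero    = basis-> (2 + d) {suc i} {0} λ ()
  basis-shift d i (suc k) with i ≤? k
  ... | yes i≤k = trans (basis-≤ (2 + d) (s≤s i≤k)) (cong (λ z → (2 + d ∸ z) C (k ∸ i)) (ℕP.*-suc 2 i))
  ... | no i≰k  = basis-> (2 + d) {suc i} {suc k} λ { (s≤s p) → i≰k p }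

  -- Pascal's rule, read as multiplication of `x^i (1+x)^(d−2i)` by `1 + x`; the bound makes
  -- `suc d ∸ 2 * i` equal to `suc (d ∸ 2 * i)`.
  basis-pascal : ∀ d i k → 2 * i ≤ d → gammaBasisCoeff (suc d) i k ≡ gammaBasisCoeff d i k + shift (gammaBasisCoeff d i) k
  basis-pascal d i k 2i≤d with i ≤? k
  ... | no i≰k = trans (sym (ℕP.+-identityˡ _)) (cong (0 +_) (sym (below k i≰k)))
    where
    below : ∀ k → ¬ (i ≤ k) → shift (gammaBasisCoeff d i) k ≡ 0
    below zero    _  = refl
    below (suc k) i≰ = basis-> d (λ p → i≰ (ℕP.m≤n⇒m≤1+n p))
  ... | yes i≤k with ℕP.m≤n⇒m<n∨m≡n i≤k
  ...   | inj₂ refl = begin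
    (suc d ∸ 2 * i) C (i ∸ i)                                  ≡⟨ cong ((suc d ∸ 2 * i) C_) (ℕP.n∸n≡0 i) ⟩
    (suc d ∸ 2 * i) C 0                                        ≡⟨⟩
    1                                                          ≡⟨⟩
    (d ∸ 2 * i) C 0                                            ≡⟨ cong ((d ∸ 2 * i) C_) (ℕP.n∸n≡0 i) ⟨
    (d ∸ 2 * i) C (i ∸ i)                                      ≡⟨ ℕP.+-identityʳ _ ⟨
    (d ∸ 2 * i) C (i ∸ i) + 0                                  ≡⟨ cong ((d ∸ 2 * i) C (i ∸ i) +_) (below i refl) ⟨
    (d ∸ 2 * i) C (i ∸ i) + shift (gammaBasisCoeff d i) i      ∎
    where
    open ≡-Reasoning
    below : ∀ k → i ≡ k → shift (gammaBasisCoeff d i) k ≡ 0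
    below zero    _    = refl
    below (suc k) refl = basis-> d {suc k} {k} (ℕP.<⇒≱ ℕP.≤-refl)
  basis-pascal d i (suc k) 2i≤d | yes _ | inj₁ (s≤s i≤k) = begin
    (suc d ∸ 2 * i) C (suc k ∸ i)                          ≡⟨ cong₂ _C_ (ℕP.+-∸-assoc 1 2i≤d) (ℕP.+-∸-assoc 1 i≤k) ⟩
    suc (d ∸ 2 * i) C suc (k ∸ i)                          ≡⟨ nCk+nC[k+1]≡[n+1]C[k+1] (d ∸ 2 * i) (k ∸ i) ⟨
    (d ∸ 2 * i) C (k ∸ i) + (d ∸ 2 * i) C suc (k ∸ i)      ≡⟨ ℕP.+-comm ((d ∸ 2 * i) C (k ∸ i)) _ ⟩
    (d ∸ 2 * i) C suc (k ∸ i) + (d ∸ 2 * i) C (k ∸ i)      ≡⟨ cong₂ _+_ (cong ((d ∸ 2 * i) C_) (sym (ℕP.+-∸-assoc 1 i≤k))) (sym (basis-≤ d i≤k)) ⟩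
    (d ∸ 2 * i) C (suc k ∸ i) + gammaBasisCoeff d i k      ∎
    where open ≡-Reasoning

  γ-ext : ∀ d {f g} → (∀ k → f k ≡ g k) → GammaPositive d f → GammaPositive d g
  γ-ext d e (γ , p) = γ , λ k → trans (sym (e k)) (p k)

  γ-0 : ∀ d → GammaPositive d (λ _ → 0)
  γ-0 d = (λ _ → 0) , λ k → sym (sumTo-0 ⌊ d /2⌋ (λ _ → refl))

  γ-+ : ∀ d {f g} → GammaPositive d f → GammaPositive d g → GammaPositive d (λ k → f k + g k)
  γ-+ d (γ , p) (δ , q) = (λ i → γ i + δ i) , λ k → trans (cong₂ _+_ (p k) (q k)) (trans
    (sym (sumTo-+ ⌊ d /2⌋ _ _))
    (sumTo-cong ⌊ d /2⌋ (λ i _ → sym (ℕP.*-distribʳ-+ (gammaBasisCoeff d i k) (γ i) (δ i)))))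

  γ-one : GammaPositive 0 one
  γ-one = (λ _ → 1) , λ where
    zero    → refl
    (suc k) → sym (trans (ℕP.+-identityʳ _) (trans (basis-≤ 0 {0} {suc k} z≤n) (k>n⇒nCk≡0 (s≤s (z≤n {k})))))

  -- Since `x · x^i (1+x)^(d−2i) = x^(i+1) (1+x)^(d+2−2(i+1))`, the coefficients move up by one
  -- index and a zero enters at index 0.
  γ-shift : ∀ d {f} → GammaPositive d f → GammaPositive (2 + d) (shift f)
  γ-shift d {f} (γ , p) = γ′ , λ k → trans (shift-cong p k) (sym (trans (sumTo-suc ⌊ d /2⌋ _) (go k)))
    where
    γ′ : ℕ → ℕ
    γ′ zero    = 0
    γ′ (suc i) = γ i
    go : ∀ k → sumTo ⌊ d /2⌋ (λ i → γ i * gammaBasisCoeff (2 + d) (suc i) k) ≡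
               shift (λ k → sumTo ⌊ d /2⌋ (λ i → γ i * gammaBasisCoeff d i k)) k
    go k = trans (sumTo-cong ⌊ d /2⌋ (λ i _ → cong (γ i *_) (basis-shift d i k))) (pull k)
      where
      pull : ∀ k → sumTo ⌊ d /2⌋ (λ i → γ i * shift (gammaBasisCoeff d i) k) ≡
                   shift (λ k → sumTo ⌊ d /2⌋ (λ i → γ i * gammaBasisCoeff d i k)) k
      pull zero    = sumTo-0 ⌊ d /2⌋ (λ i → ℕP.*-zeroʳ (γ i))
      pull (suc k) = refl

  -- The coefficients stay the same. When `d` is odd, the basis for `d + 1` has one more member than
  -- that for `d`, and `γ′` gives it the coefficient zero.
  γ-1+x : ∀ d {f} → GammaPositive d f → GammaPositive (suc d) (λ k → f k + shift f k)
  γ-1+x d {f} (γ , p) = γ′ , λ k → begin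
    f k + shift f k
      ≡⟨ cong₂ _+_ (p k) (trans (shift-cong p k) (pull k)) ⟩
    sumTo D (λ i → γ i * gammaBasisCoeff d i k) + sumTo D (λ i → γ i * shift (gammaBasisCoeff d i) k)
      ≡⟨ sumTo-+ D _ _ ⟨
    sumTo D (λ i → γ i * gammaBasisCoeff d i k + γ i * shift (gammaBasisCoeff d i) k)
      ≡⟨ sumTo-cong D (λ i i≤ → trans (sym (ℕP.*-distribˡ-+ (γ i) _ _)) (cong (γ i *_) (sym (basis-pascal d i k (double i≤))))) ⟩
    sumTo D (λ i → γ i * gammaBasisCoeff (suc d) i k)
      ≡⟨ sumTo-cong D (λ i i≤ → cong (_* gammaBasisCoeff (suc d) i k) (sym (γ′-≤ i≤))) ⟩
    sumTo D (λ i → γ′ i * gammaBasisCoeff (suc d) i k)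
      ≡⟨ extend k ⟩
    sumTo ⌊ suc d /2⌋ (λ i → γ′ i * gammaBasisCoeff (suc d) i k) ∎
    where
    open ≡-Reasoning
    D = ⌊ d /2⌋
    γ′ : ℕ → ℕ
    γ′ i with i ≤? D
    ... | yes _ = γ i
    ... | no _  = 0
    γ′-≤ : ∀ {i} → i ≤ D → γ′ i ≡ γ i
    γ′-≤ {i} i≤ with i ≤? D
    ... | yes _ = refl
    ... | no ¬p = contradiction i≤ ¬p
    γ′-> : ∀ {i} → ¬ (i ≤ D) → γ′ i ≡ 0
    γ′-> {i} i≰ with i ≤? D
    ... | yes p = contradiction p i≰
    ... | no _  = refl
    pull : ∀ k → shift (λ k → sumTo D (λ i → γ i * gammaBasisCoeff d i k)) k ≡
                 sumTo D (λ i → γ i * shift (gammaBasisCoeff d i) k)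
    pull zero    = sym (sumTo-0 D (λ i → ℕP.*-zeroʳ (γ i)))
    pull (suc k) = refl
    2⌊d/2⌋≤d : ∀ d → 2 * ⌊ d /2⌋ ≤ d
    2⌊d/2⌋≤d zero          = z≤n
    2⌊d/2⌋≤d (suc zero)    = z≤n
    2⌊d/2⌋≤d (suc (suc d)) = subst (_≤ 2 + d) (sym (ℕP.*-suc 2 ⌊ d /2⌋)) (s≤s (s≤s (2⌊d/2⌋≤d d)))
    double : ∀ {i} → i ≤ D → 2 * i ≤ d
    double i≤ = ℕP.≤-trans (ℕP.*-monoʳ-≤ 2 i≤) (2⌊d/2⌋≤d d)
    halves : ∀ d → ⌊ suc d /2⌋ ≡ ⌊ d /2⌋ ⊎ ⌊ suc d /2⌋ ≡ suc ⌊ d /2⌋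
    halves zero          = inj₁ refl
    halves (suc zero)    = inj₂ refl
    halves (suc (suc d)) with halves d
    ... | inj₁ e = inj₁ (cong suc e)
    ... | inj₂ e = inj₂ (cong suc e)
    extend : ∀ k → sumTo D (λ i → γ′ i * gammaBasisCoeff (suc d) i k) ≡
                   sumTo ⌊ suc d /2⌋ (λ i → γ′ i * gammaBasisCoeff (suc d) i k)
    extend k with halves d
    ... | inj₁ e = cong (λ N → sumTo N (λ i → γ′ i * gammaBasisCoeff (suc d) i k)) (sym e)
    ... | inj₂ e = trans (sym (trans (cong (λ z → sumTo D (λ i → γ′ i * gammaBasisCoeff (suc d) i k) + z * gammaBasisCoeff (suc d) (suc D) k)
                                           (γ′-> (ℕP.<⇒≱ ℕP.≤-refl))) (ℕP.+-identityʳ _)))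
                     (cong (λ N → sumTo N (λ i → γ′ i * gammaBasisCoeff (suc d) i k)) (sym e))

-- The generating function of nested words and its γ-positivity.

module Counting where

  open Flats
  open NestedWords
  open GammaClosure
  open import Algebra.Properties.CommutativeSemigroup ℕP.+-commutativeSemigroup using (interchange)
  open import Data.Nat using (zero; suc)
  open import Data.Fin using (zero; suc; toℕ)
  open import Data.Fin.Subset using (⊤; _∈_)
  open import Data.Empty using (⊥-elim)
  open import Relation.Binary.PropositionalEquality using (trans)

  χ : {P : Set} → Dec P → ℕ
  χ d = if does d then 1 else 0

  module _ {P : Set} where

    χ-yes : (d : Dec P) → P → ∀ a → χ d * a ≡ a
    χ-yes (yes _) _ a = ℕP.+-identityʳ a
    χ-yes (no ¬p) p a = contradiction p ¬p

    χ-no : (d : Dec P) → ¬ P → ∀ a → χ d * a ≡ 0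
    χ-no (yes p) ¬p a = contradiction p ¬p
    χ-no (no _)  _  a = refl

    χ-cong : (d : Dec P) {a b : ℕ} → (P → a ≡ b) → χ d * a ≡ χ d * b
    χ-cong (yes p) e = cong (1 *_) (e p)
    χ-cong (no _)  e = refl

  χ-≡ : {P R : Set} (d : Dec P) (e : Dec R) → (P → R) → (R → P) → χ d ≡ χ e
  χ-≡ (yes p) (yes _) f g = refl
  χ-≡ (yes p) (no ¬r) f g = contradiction (f p) ¬r
  χ-≡ (no ¬p) (yes r) f g = contradiction (g r) ¬p
  χ-≡ (no _)  (no _)  f g = refl

  χ-∧ : {P R : Set} (d : Dec P) (e : Dec R) → ¬ (P × R) → χ d * χ e ≡ 0
  χ-∧ (yes p) (yes r) ¬b = contradiction (p , r) ¬b
  χ-∧ (yes _) (no _)  ¬b = refl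
  χ-∧ (no _)  _       ¬b = refl

  ∑ₙ : {A : Set} → List A → (A → ℕ) → ℕ
  ∑ₙ []       f = 0
  ∑ₙ (x ∷ xs) f = f x + ∑ₙ xs f

  module _ {A : Set} where

    ∑ₙ-cong : ∀ (xs : List A) {f g} → (∀ {x} → x ∈ˡ xs → f x ≡ g x) → ∑ₙ xs f ≡ ∑ₙ xs g
    ∑ₙ-cong []       e = refl
    ∑ₙ-cong (x ∷ xs) e = cong₂ _+_ (e (here refl)) (∑ₙ-cong xs (e ∘ there))

    ∑ₙ-0 : ∀ (xs : List A) {f} → (∀ {x} → x ∈ˡ xs → f x ≡ 0) → ∑ₙ xs f ≡ 0
    ∑ₙ-0 []       e = refl
    ∑ₙ-0 (x ∷ xs) e = cong₂ _+_ (e (here refl)) (∑ₙ-0 xs (e ∘ there))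

    ∑ₙ-+ : ∀ (xs : List A) f g → ∑ₙ xs (λ x → f x + g x) ≡ ∑ₙ xs f + ∑ₙ xs g
    ∑ₙ-+ []       f g = refl
    ∑ₙ-+ (x ∷ xs) f g = trans (cong (f x + g x +_) (∑ₙ-+ xs f g)) (interchange (f x) (g x) _ _)

    ∑ₙ-*ˡ : ∀ (xs : List A) c f → ∑ₙ xs (λ x → c * f x) ≡ c * ∑ₙ xs f
    ∑ₙ-*ˡ []       c f = sym (ℕP.*-zeroʳ c)
    ∑ₙ-*ˡ (x ∷ xs) c f = trans (cong (c * f x +_) (∑ₙ-*ˡ xs c f)) (sym (ℕP.*-distribˡ-+ c (f x) _))

    ∑ₙ-*ʳ : ∀ (xs : List A) c f → ∑ₙ xs (λ x → f x * c) ≡ ∑ₙ xs f * c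
    ∑ₙ-*ʳ []       c f = refl
    ∑ₙ-*ʳ (x ∷ xs) c f = trans (cong (f x * c +_) (∑ₙ-*ʳ xs c f)) (sym (ℕP.*-distribʳ-+ c (f x) _))

    ∑ₙ-filter : ∀ {P : A → Set} (P? : Decidable P) (xs : List A) f →
                ∑ₙ (filter P? xs) f ≡ ∑ₙ xs (λ x → χ (P? x) * f x)
    ∑ₙ-filter P? []       f = refl
    ∑ₙ-filter P? (x ∷ xs) f with P? x
    ... | yes _ = cong₂ _+_ (sym (ℕP.+-identityʳ (f x))) (∑ₙ-filter P? xs f)
    ... | no  _ = ∑ₙ-filter P? xs f

    ∑ₙ-pick : ∀ {xs : List A} {x} (f : A → ℕ) → Unique xs → x ∈ˡ xs →
              (∀ {y} → y ∈ˡ xs → y ≢ x → f y ≡ 0) → ∑ₙ xs f ≡ f x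
    ∑ₙ-pick {y ∷ xs} f (u ∷ᵘ us) (here refl) z =
      trans (cong (f y +_) (∑ₙ-0 xs (λ i → z (there i) (λ { refl → All.lookup u i refl })))) (ℕP.+-identityʳ _)
    ∑ₙ-pick {y ∷ xs} f (u ∷ᵘ us) (there i) z =
      cong₂ _+_ (z (here refl) (λ { refl → All.lookup u i refl })) (∑ₙ-pick f us i (z ∘ there))

    length-concatMap : ∀ {B : Set} (f : A → List B) xs → length (concatMap f xs) ≡ ∑ₙ xs (length ∘ f)
    length-concatMap f []       = refl
    length-concatMap f (x ∷ xs) = trans (ListP.length-++ (f x)) (cong (length (f x) +_) (length-concatMap f xs))

    shift-∑ₙ : ∀ (xs : List A) (f : A → ℕ → ℕ) k → shift (λ k → ∑ₙ xs (λ x → f x k)) k ≡ ∑ₙ xs (λ x → shift (f x) k)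
    shift-∑ₙ xs f zero    = sym (∑ₙ-0 xs (λ _ → refl))
    shift-∑ₙ xs f (suc k) = refl

    γ-∑ₙ : ∀ d (xs : List A) {f : A → ℕ → ℕ} → (∀ x → GammaPositive d (f x)) → GammaPositive d (λ k → ∑ₙ xs (λ x → f x k))
    γ-∑ₙ d []       e = γ-0 d
    γ-∑ₙ d (x ∷ xs) e = γ-+ d (e x) (γ-∑ₙ d xs e)

  ∑ₙ-swap : ∀ {A B : Set} (xs : List A) (ys : List B) (f : A → B → ℕ) →
            ∑ₙ xs (λ x → ∑ₙ ys (f x)) ≡ ∑ₙ ys (λ y → ∑ₙ xs (λ x → f x y))
  ∑ₙ-swap []       ys f = sym (∑ₙ-0 ys (λ _ → refl))
  ∑ₙ-swap (x ∷ xs) ys f = trans (cong (∑ₙ ys (f x) +_) (∑ₙ-swap xs ys f)) (sym (∑ₙ-+ ys (f x) _))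

  shift-χ : ∀ {P : Set} (d : Dec P) f k → shift (λ k → χ d * f k) k ≡ χ d * shift f k
  shift-χ d f zero    = sym (ℕP.*-zeroʳ (χ d))
  shift-χ d f (suc k) = refl

  γ-χ : ∀ {P : Set} d {f} (p? : Dec P) → (P → GammaPositive d f) → GammaPositive d (λ k → χ p? * f k)
  γ-χ d {f} (yes p) g = γ-ext d (λ k → sym (ℕP.+-identityʳ (f k))) (g p)
  γ-χ d (no _) g = γ-0 d

  -- Multiplication by x + x² + ⋯ + xᵐ.
  geom : ℕ → (ℕ → ℕ) → ℕ → ℕ
  geom zero    f k = 0
  geom (suc m) f k = shift (λ k → f k + geom m f k) k

  geom-cong : ∀ m {f g} → (∀ k → f k ≡ g k) → ∀ k → geom m f k ≡ geom m g k
  geom-cong zero    e k = refl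
  geom-cong (suc m) e k = shift-cong (λ k → cong₂ _+_ (e k) (geom-cong m e k)) k

  geom-1 : ∀ f k → geom 1 f k ≡ shift f k
  geom-1 f zero    = refl
  geom-1 f (suc k) = ℕP.+-identityʳ (f k)

  -- This is `x (x+⋯+x^m) + (x+⋯+x^(m+2)) = (1+x)(x+⋯+x^(m+1))`, the origin of the factor `1 +
  -- x` in the recurrence for `V 1`.
  geom-recurrence : ∀ m f k → shift (geom m f) k + geom (2 + m) f k ≡ geom (1 + m) f k + shift (geom (1 + m) f) k
  geom-recurrence m f zero    = refl
  geom-recurrence m f (suc k) = trans (sym (ℕP.+-assoc (geom m f k) (f k) _))
    (cong (_+ geom (1 + m) f k) (ℕP.+-comm (geom m f k) (f k)))

  smallest : ∀ {n} {P : Fin n → Set} → Decidable P → ∃ P → ∃ λ e → P e × (∀ {e′} → P e′ → toℕ e ≤ toℕ e′)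
  smallest {suc n} P? w with P? zero
  ... | yes p = zero , p , λ _ → z≤n
  ... | no ¬p with w
  ...   | zero  , p = contradiction p ¬p
  ...   | suc i , p with e , pe , least ← smallest (P? ∘ suc) (i , p) =
    suc e , pe , λ { {zero} q → contradiction q ¬p ; {suc _} q → s≤s (least q) }

  module Count {n : ℕ} (M : Matroid n) where

    open FlatLattice M

    private
      r = rank M

    -- The recursion for `N_F` with fuel. Ranks replace `ρ`, because the summand `s` cancels in
    -- `ρ G − ρ F − 1`.
    num : ℕ → Subset n → ℕ → ℕ
    num zero    F k = one k
    num (suc f) F k = one k + ∑ₙ (above F) (λ G → geom (r G ∸ suc (r F)) (num f G) k)

    above-sound : ∀ {F G} → G ∈ˡ above F → Flat G × Above F G
    above-sound {F} i with j , a ← ∈-filter⁻ (above? F) {xs = flats} i = flats-flat j , a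

    private
      above-full : ∀ {F} → Flat F → rk M ≤ r F → ∀ {G} → ¬ (G ∈ˡ above F)
      above-full flat le {G} i with _ , F⊆G , G⊈F ← above-sound i =
        contradiction (ℕP.≤-trans (rank-mono M {G} ⊆⊤) le) (ℕP.<⇒≱ (flat-rank-< flat F⊆G G⊈F))

      fuel-step : ∀ {f F G} → Flat F → Above F G → rk M ≤ suc f + r F → rk M ≤ f + r G
      fuel-step {f} {F} {G} flat (F⊆G , G⊈F) le = ℕP.≤-trans le
        (subst (_≤ f + r G) (ℕP.+-suc f (r F)) (ℕP.+-monoʳ-≤ f (flat-rank-< flat F⊆G G⊈F)))

    num-fuel : ∀ f f′ {F} → Flat F → rk M ≤ f + r F → rk M ≤ f′ + r F → ∀ k → num f F k ≡ num f′ F k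
    num-fuel zero    zero     flat le le′ k = refl
    num-fuel zero    (suc f′) {F} flat le le′ k = sym (trans (cong (one k +_) (∑ₙ-0 (above F) (λ i → contradiction i (above-full flat le)))) (ℕP.+-identityʳ _))
    num-fuel (suc f) zero     {F} flat le le′ k = trans (cong (one k +_) (∑ₙ-0 (above F) (λ i → contradiction i (above-full flat le′)))) (ℕP.+-identityʳ _)
    num-fuel (suc f) (suc f′) {F} flat le le′ k = cong (one k +_) (∑ₙ-cong (above F) (λ {G} i → let flatG , F⊂G = above-sound i in
      geom-cong (r G ∸ suc (r F)) (num-fuel f f′ flatG (fuel-step {f} flat F⊂G le) (fuel-step {f′} flat F⊂G le′)) k))

    count : Subset n → ℕ → ℕ
    count F = num (rk M ∸ r F) F

    private
      fuel-ok : ∀ F → rk M ≤ rk M ∸ r F + r F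
      fuel-ok F = ℕP.≤-reflexive (sym (ℕP.m∸n+n≡m (rank-mono M ⊆⊤)))

    num-count : ∀ f {F} → Flat F → rk M ≤ f + r F → ∀ k → num f F k ≡ count F k
    num-count f {F} flat le = num-fuel f _ flat le (fuel-ok F)

    count-eq : ∀ {F} → Flat F → ∀ k → count F k ≡ one k + ∑ₙ (above F) (λ G → geom (r G ∸ suc (r F)) (count G) k)
    count-eq {F} flat k = trans (num-fuel _ (suc (rk M ∸ r F)) flat (fuel-ok F) (ℕP.m≤n⇒m≤1+n (fuel-ok F)) k)
      (cong (one k +_) (∑ₙ-cong (above F) (λ {G} i → let flatG , F⊂G = above-sound i in
        geom-cong (r G ∸ suc (r F)) (num-count (rk M ∸ r F) flatG (fuel-step {rk M ∸ r F} flat F⊂G (ℕP.m≤n⇒m≤1+n (fuel-ok F)))) k)))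

    -- The increasing chain from `F` to `G` starts with the label min (G ∖ F), so for `G` strictly
    -- above `F` this bounds its first label from below.
    Within : Subset n → ℕ → Subset n → Set
    Within F ℓ G = ∀ e → e ∈ G → e ∉ F → ℓ ≤ toℕ e

    within? : ∀ F ℓ G → Dec (Within F ℓ G)
    within? F ℓ G = FinP.all? (λ e → (e ∈? G) →-dec (¬? (e ∈? F) →-dec (ℓ ≤? toℕ e)))

    In In° : Subset n → ℕ → Subset n → Set
    In  F ℓ G = F ⊆ G × Within F ℓ G
    In° F ℓ G = Above F G × Within F ℓ G

    in? : ∀ F ℓ G → Dec (In F ℓ G)
    in? F ℓ G = (F ⊆? G) ×-dec within? F ℓ G

    in°? : ∀ F ℓ G → Dec (In° F ℓ G)
    in°? F ℓ G = above? F G ×-dec within? F ℓ G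

    -- e is the label min (G ∖ F) of the cover F ⋖ G = F ∨ e, and this label is at least ℓ.
    Lead : Subset n → ℕ → Fin n → Set
    Lead F ℓ e = e ∉ F × ℓ ≤ toℕ e × Within F (toℕ e) (F ∨ ⁅ e ⁆)

    lead? : ∀ F ℓ e → Dec (Lead F ℓ e)
    lead? F ℓ e = ¬? (e ∈? F) ×-dec (ℓ ≤? toℕ e) ×-dec within? F (toℕ e) (F ∨ ⁅ e ⁆)

    S S° : Subset n → ℕ → (Subset n → ℕ) → ℕ
    S  F ℓ g = ∑ₙ flats (λ G → χ (in? F ℓ G) * g G)
    S° F ℓ g = ∑ₙ flats (λ G → χ (in°? F ℓ G) * g G)

    S-cong : ∀ F ℓ {g g′} → (∀ {G} → F ⊆ G → g G ≡ g′ G) → S F ℓ g ≡ S F ℓ g′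
    S-cong F ℓ e = ∑ₙ-cong flats (λ {G} _ → χ-cong (in? F ℓ G) (λ (F⊆G , _) → e F⊆G))

    S-split : ∀ {F} → Flat F → ∀ ℓ g → S F ℓ g ≡ g F + S° F ℓ g
    S-split {F} flat ℓ g = begin
      S F ℓ g
        ≡⟨ ∑ₙ-cong flats (λ {G} _ → split G) ⟩
      ∑ₙ flats (λ G → χ (G ≟S F) * g G + χ (in°? F ℓ G) * g G)
        ≡⟨ ∑ₙ-+ flats _ _ ⟩
      ∑ₙ flats (λ G → χ (G ≟S F) * g G) + S° F ℓ g
        ≡⟨ cong (_+ S° F ℓ g) (trans (∑ₙ-pick _ flats-unique (∈-flats flat) (λ {G} _ G≢F → χ-no (G ≟S F) G≢F (g G)))
             (χ-yes (F ≟S F) refl (g F))) ⟩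
      g F + S° F ℓ g ∎
      where
      open ≡-Reasoning
      split : ∀ G → χ (in? F ℓ G) * g G ≡ χ (G ≟S F) * g G + χ (in°? F ℓ G) * g G
      split G with G ≟S F
      ... | yes refl = trans (χ-yes (in? F ℓ F) (⊆-refl , λ e e∈ e∉ → contradiction e∈ e∉) (g F))
        (sym (trans (cong₂ _+_ (ℕP.+-identityʳ (g F)) (χ-no (in°? F ℓ F) (λ ((_ , ⊈) , _) → ⊈ ⊆-refl) (g F))) (ℕP.+-identityʳ _)))
      ... | no G≢F = cong (_* g G) (χ-≡ (in? F ℓ G) (in°? F ℓ G)
        (λ (F⊆G , w) → (F⊆G , λ G⊆F → G≢F (⊆-antisym G⊆F F⊆G)) , w) (λ ((F⊆G , _) , w) → F⊆G , w))

    private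
      lead-in : ∀ {F ℓ e G} → Lead F ℓ e → In (F ∨ ⁅ e ⁆) (suc (toℕ e)) G → In° F ℓ G
      lead-in {F} {ℓ} {e} {G} (e∉F , ℓ≤e , lead) (⊆G , w) =
        (⊆-trans (∨-left F ⁅ e ⁆) ⊆G , λ G⊆F → e∉F (G⊆F (⊆G (∨-right F ⁅ e ⁆ (x∈⁅x⁆ e))))) , bound
        where
        bound : Within F ℓ G
        bound e′ e′∈G e′∉F with e′ ∈? F ∨ ⁅ e ⁆
        ... | yes i = ℕP.≤-trans ℓ≤e (lead e′ i e′∉F)
        ... | no ¬i = ℕP.≤-trans ℓ≤e (ℕP.<⇒≤ (w e′ e′∈G ¬i))

      -- Only e = min (G ∖ F) contributes.
      count-leads : ∀ {F} → Flat F → ∀ ℓ {G} → Flat G →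
        ∑ₙ (allFin n) (λ e → χ (lead? F ℓ e) * χ (in? (F ∨ ⁅ e ⁆) (suc (toℕ e)) G)) ≡ χ (in°? F ℓ G)
      count-leads {F} flat ℓ {G} flatG = go (in°? F ℓ G)
        where
        term : Fin n → ℕ
        term e = χ (lead? F ℓ e) * χ (in? (F ∨ ⁅ e ⁆) (suc (toℕ e)) G)
        term-0 : ∀ e → ¬ (Lead F ℓ e × In (F ∨ ⁅ e ⁆) (suc (toℕ e)) G) → term e ≡ 0
        term-0 e = χ-∧ (lead? F ℓ e) (in? (F ∨ ⁅ e ⁆) (suc (toℕ e)) G)
        term-1 : ∀ e → Lead F ℓ e → In (F ∨ ⁅ e ⁆) (suc (toℕ e)) G → term e ≡ 1
        term-1 e l i = trans (χ-yes (lead? F ℓ e) l _) (trans (sym (ℕP.*-identityʳ _)) (χ-yes (in? (F ∨ ⁅ e ⁆) (suc (toℕ e)) G) i 1))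
        go : (d : Dec (In° F ℓ G)) → ∑ₙ (allFin n) term ≡ χ d
        go (no ¬p) = ∑ₙ-0 (allFin n) (λ {e} _ → term-0 e (λ (l , i) → ¬p (lead-in l i)))
        go (yes ((F⊆G , G⊈F) , w))
          with e , (e∈G , e∉F) , least ← smallest (λ e → (e ∈? G) ×-dec ¬? (e ∈? F)) (⊈-witness G⊈F) =
          trans (∑ₙ-pick term (Unique.allFin⁺ n) (∈-allFin e) (λ {e′} _ e′≢e → term-0 e′ (λ (l , i) → e′≢e (unique l i))))
            (term-1 e (e∉F , w e e∈G e∉F , λ e′ e′∈ e′∉F → least (F∨e⊆G e′∈ , e′∉F))
              (F∨e⊆G , λ e′ e′∈G e′∉ → ℕP.≤∧≢⇒< (least (e′∈G , e′∉ ∘ ∨-left F ⁅ e ⁆))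
                (λ eq → e′∉ (subst (_∈ F ∨ ⁅ e ⁆) (FinP.toℕ-injective eq) (∨-right F ⁅ e ⁆ (x∈⁅x⁆ e))))))
          where
          F∨e⊆G : F ∨ ⁅ e ⁆ ⊆ G
          F∨e⊆G = ∨-least flatG F⊆G (⁅⁆-⊆ e∈G)
          unique : ∀ {e′} → Lead F ℓ e′ → In (F ∨ ⁅ e′ ⁆) (suc (toℕ e′)) G → e′ ≡ e
          unique {e′} (e′∉F , _ , lead) (⊆G , w′) = FinP.toℕ-injective (ℕP.≤-antisym e′≤e
            (least (⊆G (∨-right F ⁅ e′ ⁆ (x∈⁅x⁆ e′)) , e′∉F)))
            where
            e′≤e : toℕ e′ ≤ toℕ e
            e′≤e with e ∈? F ∨ ⁅ e′ ⁆
            ... | yes i = lead e i e∉F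
            ... | no ¬i = ℕP.<⇒≤ (w′ e e∈G ¬i)

    -- The flats `G` are sorted by the first label `e` of their increasing chain. Asking for labels
    -- from `e + 1` on in the remainder loses no `G`, as `e` is the minimum of G ∖ F and belongs to
    -- `F ∨ e`.
    S°-leads : ∀ {F} → Flat F → ∀ ℓ g → S° F ℓ g ≡ ∑ₙ (allFin n) (λ e → χ (lead? F ℓ e) * S (F ∨ ⁅ e ⁆) (suc (toℕ e)) g)
    S°-leads {F} flat ℓ g = sym (begin
      ∑ₙ (allFin n) (λ e → χ (lead? F ℓ e) * S (F ∨ ⁅ e ⁆) (suc (toℕ e)) g)
        ≡⟨ ∑ₙ-cong (allFin n) (λ {e} _ → trans (sym (∑ₙ-*ˡ flats (χ (lead? F ℓ e)) _))
             (∑ₙ-cong flats (λ {G} _ → sym (ℕP.*-assoc (χ (lead? F ℓ e)) _ (g G))))) ⟩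
      ∑ₙ (allFin n) (λ e → ∑ₙ flats (λ G → χ (lead? F ℓ e) * χ (in? (F ∨ ⁅ e ⁆) (suc (toℕ e)) G) * g G))
        ≡⟨ ∑ₙ-swap (allFin n) flats _ ⟩
      ∑ₙ flats (λ G → ∑ₙ (allFin n) (λ e → χ (lead? F ℓ e) * χ (in? (F ∨ ⁅ e ⁆) (suc (toℕ e)) G) * g G))
        ≡⟨ ∑ₙ-cong flats (λ {G} i → trans (∑ₙ-*ʳ (allFin n) (g G) _) (cong (_* g G) (count-leads flat ℓ (flats-flat i)))) ⟩
      S° F ℓ g ∎)
      where open ≡-Reasoning

    -- Carries the summand 1 of `N_F`. Placed at `G = ⊤`, it takes part in the regrouping by labels
    -- like any other term of the sum over flats.
    top : Subset n → ℕ → ℕ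
    top G k = χ (G ≟S ⊤) * one k

    ∑ₙ-top : ∀ {P : Subset n → Set} (P? : Decidable P) → P ⊤ → ∀ k → ∑ₙ flats (λ G → χ (P? G) * top G k) ≡ one k
    ∑ₙ-top P? p k = trans (∑ₙ-pick _ flats-unique (∈-flats flat-⊤)
        (λ {G} _ G≢⊤ → trans (cong (χ (P? G) *_) (χ-no (G ≟S ⊤) G≢⊤ (one k))) (ℕP.*-zeroʳ (χ (P? G)))))
      (trans (χ-yes (P? ⊤) p _) (χ-yes (⊤ {n} ≟S ⊤) refl (one k)))

    -- Summing over the covers F ∨ e of F with label e, these satisfy
    --   V₀(F, ℓ) = Σ_{e ≥ ℓ} V₁(F ∨ e, e + 1),   V₁(F, ℓ) = Σ_{e < ℓ} x V₀(F ∨ e, e + 1) + Σ_{e ≥ ℓ} (1 + x) V₁(F ∨ e, e + 1),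
    -- which is where γ-positivity comes from; V₂ is auxiliary.
    V : ℕ → Subset n → ℕ → ℕ → ℕ
    V j F ℓ k = S F ℓ (λ G → geom (j + (r G ∸ r F)) (count G) k + top G k)

    -- Termwise `geom-recurrence` with `m = r G − r F`; the part `top` contributes `x + 1` times
    -- itself to both sides.
    V-recurrence : ∀ F ℓ k → shift (V 0 F ℓ) k + V 2 F ℓ k ≡ V 1 F ℓ k + shift (V 1 F ℓ) k
    V-recurrence F ℓ k = begin
      shift (V 0 F ℓ) k + V 2 F ℓ k
        ≡⟨ cong (_+ V 2 F ℓ k) (shift-S 0) ⟩
      S F ℓ (λ G → shift (w 0 G) k) + V 2 F ℓ k
        ≡⟨ S-+ _ _ ⟨
      S F ℓ (λ G → shift (w 0 G) k + w 2 G k)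
        ≡⟨ S-cong F ℓ (λ {G} _ → term G) ⟩
      S F ℓ (λ G → w 1 G k + shift (w 1 G) k)
        ≡⟨ S-+ _ _ ⟩
      V 1 F ℓ k + S F ℓ (λ G → shift (w 1 G) k)
        ≡⟨ cong (V 1 F ℓ k +_) (shift-S 1) ⟨
      V 1 F ℓ k + shift (V 1 F ℓ) k ∎
      where
      open ≡-Reasoning
      w : ℕ → Subset n → ℕ → ℕ
      w j G k = geom (j + (r G ∸ r F)) (count G) k + top G k
      S-+ : ∀ g g′ → S F ℓ (λ G → g G + g′ G) ≡ S F ℓ g + S F ℓ g′
      S-+ g g′ = trans (∑ₙ-cong flats (λ {G} _ → ℕP.*-distribˡ-+ (χ (in? F ℓ G)) (g G) (g′ G))) (∑ₙ-+ flats _ _)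
      shift-S : ∀ j → shift (V j F ℓ) k ≡ S F ℓ (λ G → shift (w j G) k)
      shift-S j = trans (shift-∑ₙ flats (λ G k → χ (in? F ℓ G) * w j G k) k)
        (∑ₙ-cong flats (λ {G} _ → shift-χ (in? F ℓ G) (w j G) k))
      term : ∀ G → shift (w 0 G) k + w 2 G k ≡ w 1 G k + shift (w 1 G) k
      term G = begin
        shift (w 0 G) k + (g 2 k + top G k)              ≡⟨ cong (_+ (g 2 k + top G k)) (shift-+ (g 0) (top G) k) ⟩
        shift (g 0) k + shift (top G) k + (g 2 k + top G k)  ≡⟨ interchange (shift (g 0) k) _ (g 2 k) _ ⟩
        shift (g 0) k + g 2 k + (shift (top G) k + top G k)  ≡⟨ cong₂ _+_ (geom-recurrence (r G ∸ r F) (count G) k) (ℕP.+-comm (shift (top G) k) _) ⟩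
        g 1 k + shift (g 1) k + (top G k + shift (top G) k)  ≡⟨ interchange (g 1 k) _ (top G k) _ ⟩
        w 1 G k + (shift (g 1) k + shift (top G) k)      ≡⟨ cong (w 1 G k +_) (shift-+ (g 1) (top G) k) ⟨
        w 1 G k + shift (w 1 G) k ∎
        where
        g : ℕ → ℕ → ℕ
        g j = geom (j + (r G ∸ r F)) (count G)

    private
      cover-∸ : ∀ {F e G} → Flat F → e ∉ F → F ∨ ⁅ e ⁆ ⊆ G → r G ∸ r F ≡ suc (r G ∸ r (F ∨ ⁅ e ⁆))
      cover-∸ {F} {e} {G} flat e∉F ⊆G = trans (ℕP.+-∸-assoc 1 {r G} {suc (r F)} suc≤) (cong (λ z → suc (r G ∸ z)) (sym (rank-cover flat e∉F)))
        where
        suc≤ : suc (r F) ≤ r G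
        suc≤ = subst (_≤ r G) (rank-cover flat e∉F) (rank-mono M ⊆G)

    -- The cover `F ∨ e` has rank one more than `F`, so the length `r G − r F − 1` of the geometric
    -- sum is exactly `r G − r (F ∨ e)`, as in `V 0` at the cover.
    count-leads-V : ∀ {F} → Flat F → ¬ (⊤ ⊆ F) → ∀ k →
      count F k ≡ ∑ₙ (allFin n) (λ e → χ (lead? F 0 e) * V 0 (F ∨ ⁅ e ⁆) (suc (toℕ e)) k)
    count-leads-V {F} flat ⊤⊈F k = begin
      count F k
        ≡⟨ count-eq flat k ⟩
      one k + ∑ₙ (above F) (λ G → geom (r G ∸ suc (r F)) (count G) k)
        ≡⟨ ℕP.+-comm (one k) _ ⟩
      ∑ₙ (above F) (λ G → geom (r G ∸ suc (r F)) (count G) k) + one k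
        ≡⟨ cong₂ _+_ (∑ₙ-filter (above? F) flats _) (sym (∑ₙ-top (above? F) (⊆⊤ , ⊤⊈F) k)) ⟩
      ∑ₙ flats (λ G → χ (above? F G) * geom (r G ∸ suc (r F)) (count G) k) + ∑ₙ flats (λ G → χ (above? F G) * top G k)
        ≡⟨ ∑ₙ-+ flats _ _ ⟨
      ∑ₙ flats (λ G → χ (above? F G) * geom (r G ∸ suc (r F)) (count G) k + χ (above? F G) * top G k)
        ≡⟨ ∑ₙ-cong flats (λ {G} _ → trans (sym (ℕP.*-distribˡ-+ (χ (above? F G)) _ (top G k)))
             (cong (_* (geom (r G ∸ suc (r F)) (count G) k + top G k)) (χ-≡ (above? F G) (in°? F 0 G) (λ a → a , λ _ _ _ → z≤n) proj₁))) ⟩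
      S° F 0 (λ G → geom (r G ∸ suc (r F)) (count G) k + top G k)
        ≡⟨ S°-leads flat 0 _ ⟩
      ∑ₙ (allFin n) (λ e → χ (lead? F 0 e) * S (F ∨ ⁅ e ⁆) (suc (toℕ e)) (λ G → geom (r G ∸ suc (r F)) (count G) k + top G k))
        ≡⟨ ∑ₙ-cong (allFin n) (λ {e} _ → χ-cong (lead? F 0 e) (λ (e∉F , _) → S-cong (F ∨ ⁅ e ⁆) (suc (toℕ e)) (λ {G} _ →
             cong (λ z → geom (r G ∸ z) (count G) k + top G k) (sym (rank-cover flat e∉F))))) ⟩
      ∑ₙ (allFin n) (λ e → χ (lead? F 0 e) * V 0 (F ∨ ⁅ e ⁆) (suc (toℕ e)) k) ∎
      where open ≡-Reasoning

    -- The term `G = F` gives `geom j (count F)`, which is zero for `j = 0` and `x N_F` for `j = 1`.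
    -- In the others the base moves up to a cover, which shortens `r G − r F` by one and is made up
    -- for by `suc j`.
    V-leads : ∀ j {F} → Flat F → ¬ (⊤ ⊆ F) → ∀ ℓ k →
      V j F ℓ k ≡ geom j (count F) k + ∑ₙ (allFin n) (λ e → χ (lead? F ℓ e) * V (suc j) (F ∨ ⁅ e ⁆) (suc (toℕ e)) k)
    V-leads j {F} flat ⊤⊈F ℓ k = trans (S-split flat ℓ _) (cong₂ _+_
      (trans (cong₂ _+_ (cong (λ z → geom z (count F) k) (trans (cong (j +_) (ℕP.n∸n≡0 (r F))) (ℕP.+-identityʳ j)))
                        (χ-no (F ≟S ⊤) (λ { refl → ⊤⊈F ⊆-refl }) (one k))) (ℕP.+-identityʳ _))
      (trans (S°-leads flat ℓ _) (∑ₙ-cong (allFin n) (λ {e} _ → χ-cong (lead? F ℓ e) (λ (e∉F , _) → S-cong (F ∨ ⁅ e ⁆) (suc (toℕ e)) (λ {G} ⊆G →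
        cong (λ z → geom z (count G) k + top G k) (trans (cong (j +_) (cover-∸ flat e∉F ⊆G)) (ℕP.+-suc j _))))))))

    private
      count-⊤ : ∀ k → count ⊤ k ≡ one k
      count-⊤ k = trans (count-eq flat-⊤ k) (trans (cong (one k +_) (∑ₙ-0 (above ⊤) (λ i → ⊥-elim (proj₂ (proj₂ (above-sound i)) ⊆⊤)))) (ℕP.+-identityʳ _))

      V-⊤ : ∀ j ℓ k → V j ⊤ ℓ k ≡ geom j one k + one k
      V-⊤ j ℓ k = trans (S-split flat-⊤ ℓ _) (trans (cong₂ _+_
        (cong₂ _+_ (trans (cong (λ z → geom z (count ⊤) k) (trans (cong (j +_) (ℕP.n∸n≡0 (r ⊤))) (ℕP.+-identityʳ j))) (geom-cong j count-⊤ k))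
                   (χ-yes (⊤ {n} ≟S ⊤) refl (one k)))
        (∑ₙ-0 flats (λ {G} _ → χ-no (in°? ⊤ ℓ G) (λ ((_ , ⊈) , _) → ⊈ ⊆⊤) _))) (ℕP.+-identityʳ _))

      V-γ-⊤ : ∀ d {F} → F ≡ ⊤ → d + r F ≡ rk M → ∀ ℓ → GammaPositive d (V 0 F ℓ) × GammaPositive (suc d) (V 1 F ℓ)
      V-γ-⊤ (suc d) refl eq ℓ = contradiction (ℕP.+-cancelʳ-≡ (r ⊤) (suc d) 0 eq) λ ()
      V-γ-⊤ zero refl eq ℓ =
        γ-ext 0 (λ k → sym (V-⊤ 0 ℓ k)) γ-one ,
        γ-ext 1 (λ k → sym (trans (V-⊤ 1 ℓ k) (trans (cong (_+ one k) (geom-1 one k)) (ℕP.+-comm (shift one k) (one k))))) (γ-1+x 0 γ-one)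

    -- The two claims need each other. `V 0` reduces to `V 1` at the covers. In `V 1` the term
    -- `x N_F` spreads as `x V₀` over the covers with every label, while `V₂` occurs only for labels
    -- at least `ℓ`; there `x V₀ + V₂` becomes `(1 + x) V₁`, and the smaller labels keep `x V₀`.
    V-γ : ∀ d {F} → Flat F → d + r F ≡ rk M → ∀ ℓ → GammaPositive d (V 0 F ℓ) × GammaPositive (suc d) (V 1 F ℓ)
    V-γ d {F} flat eq ℓ with ⊤ ⊆? F
    V-γ d flat eq ℓ | yes ⊤⊆F = V-γ-⊤ d (⊆-antisym ⊆⊤ ⊤⊆F) eq ℓ
    V-γ zero {F} flat eq ℓ | no ⊤⊈F = contradiction (flat-rank-< flat ⊆⊤ ⊤⊈F) (ℕP.<-irrefl eq)
    V-γ (suc d) {F} flat eq ℓ | no ⊤⊈F =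
      γ-ext (suc d) (λ k → sym (V-leads 0 flat ⊤⊈F ℓ k))
        (γ-∑ₙ (suc d) (allFin n) (λ e → γ-χ (suc d) (lead? F ℓ e) (λ l → proj₂ (ih l)))) ,
      γ-ext (2 + d) (λ k → sym (V1 k)) (γ-∑ₙ (2 + d) (allFin n) V1-term)
      where
      ih : ∀ {ℓ e} → Lead F ℓ e → GammaPositive d (V 0 (F ∨ ⁅ e ⁆) (suc (toℕ e))) × GammaPositive (suc d) (V 1 (F ∨ ⁅ e ⁆) (suc (toℕ e)))
      ih {e = e} (e∉F , _) = V-γ d (cl-flat _) (trans (cong (d +_) (rank-cover flat e∉F)) (trans (ℕP.+-suc d (r F)) eq)) (suc (toℕ e))
      V1 : ∀ k → V 1 F ℓ k ≡ ∑ₙ (allFin n) (λ e → χ (lead? F 0 e) * shift (V 0 (F ∨ ⁅ e ⁆) (suc (toℕ e))) k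
                                                 + χ (lead? F ℓ e) * V 2 (F ∨ ⁅ e ⁆) (suc (toℕ e)) k)
      V1 k = trans (V-leads 1 flat ⊤⊈F ℓ k) (trans (cong (_+ ∑ₙ (allFin n) (λ e → χ (lead? F ℓ e) * V 2 (F ∨ ⁅ e ⁆) (suc (toℕ e)) k)) (trans (geom-1 (count F) k) (trans (shift-cong (count-leads-V flat ⊤⊈F) k)
        (trans (shift-∑ₙ (allFin n) (λ e k → χ (lead? F 0 e) * V 0 (F ∨ ⁅ e ⁆) (suc (toℕ e)) k) k)
          (∑ₙ-cong (allFin n) (λ {e} _ → shift-χ (lead? F 0 e) (V 0 (F ∨ ⁅ e ⁆) (suc (toℕ e))) k))))))
        (sym (∑ₙ-+ (allFin n) _ _)))
      V1-term : ∀ e → GammaPositive (suc (suc d)) (λ k → χ (lead? F 0 e) * shift (V 0 (F ∨ ⁅ e ⁆) (suc (toℕ e))) k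
                                                 + χ (lead? F ℓ e) * V 2 (F ∨ ⁅ e ⁆) (suc (toℕ e)) k)
      V1-term e = go (lead? F ℓ e)
        where
        go : (d? : Dec (Lead F ℓ e)) → GammaPositive (suc (suc d)) (λ k → χ (lead? F 0 e) * shift (V 0 (F ∨ ⁅ e ⁆) (suc (toℕ e))) k
                                                 + χ d? * V 2 (F ∨ ⁅ e ⁆) (suc (toℕ e)) k)
        go (yes l@(e∉F , _ , lead)) = γ-ext (2 + d) (λ k → sym (trans
            (cong₂ _+_ (χ-yes (lead? F 0 e) (e∉F , z≤n , lead) (shift (V 0 (F ∨ ⁅ e ⁆) (suc (toℕ e))) k)) (ℕP.+-identityʳ _))
            (V-recurrence (F ∨ ⁅ e ⁆) (suc (toℕ e)) k)))
          (γ-1+x (suc d) (proj₂ (ih l)))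
        go (no _) = γ-ext (2 + d) (λ k → sym (ℕP.+-identityʳ _)) (γ-χ (2 + d) (lead? F 0 e) (λ l → γ-shift d (proj₁ (ih l))))

    count-γ : ∀ d {F} → Flat F → suc d + r F ≡ rk M → GammaPositive d (count F)
    count-γ d {F} flat eq = γ-ext d (λ k → sym (count-leads-V flat ⊤⊈F k))
      (γ-∑ₙ d (allFin n) (λ e → γ-χ d (lead? F 0 e) (λ (e∉F , _) →
        proj₁ (V-γ d (cl-flat _) (trans (cong (d +_) (rank-cover flat e∉F)) (trans (ℕP.+-suc d (r F)) eq)) (suc (toℕ e))))))
      where
      ⊤⊈F : ¬ (⊤ ⊆ F)
      ⊤⊈F ⊤⊆F = ℕP.<-irrefl refl (ℕP.≤-trans (ℕP.≤-trans (s≤s (ℕP.m≤n+m (r F) d)) (ℕP.≤-reflexive eq)) (rank-mono M ⊤⊆F))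

  module EnumCount {n : ℕ} (M : Matroid n) (s : ℕ) where

    open FlatLattice M
    open Nesting M s
    open Count M

    private
      r = rank M

    length-start : ∀ k → length (start k) ≡ one k
    length-start zero    = refl
    length-start (suc k) = refl

    length-powers : ∀ f G m k → length (powers f G m k) ≡ geom m (λ k → length (enum f G (ρ G) k)) k
    length-powers f G zero    k       = refl
    length-powers f G (suc m) zero    = refl
    length-powers f G (suc m) (suc k) = trans (ListP.length-map (G ∷_) (enum f G (ρ G) k ++ powers f G m k))
      (trans (ListP.length-++ (enum f G (ρ G) k)) (cong (length (enum f G (ρ G) k) +_) (length-powers f G m k)))

    length-enum-suc : ∀ f F c k → length (enum (suc f) F c k) ≡
      one k + ∑ₙ (above F) (λ G → geom (ρ G ∸ suc c) (λ k → length (enum f G (ρ G) k)) k)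
    length-enum-suc f F c k = trans (ListP.length-++ (start k)) (cong₂ _+_ (length-start k)
      (trans (length-concatMap (λ G → powers f G (ρ G ∸ suc c) k) (above F))
        (∑ₙ-cong (above F) (λ {G} _ → length-powers f G (ρ G ∸ suc c) k))))

    length-enum : ∀ f F k → length (enum f F (ρ F) k) ≡ num f F k
    length-enum zero    F k = length-start k
    length-enum (suc f) F k = trans (length-enum-suc f F (ρ F) k) (cong (one k +_) (∑ₙ-cong (above F) (λ {G} _ →
      trans (cong (λ m → geom m (λ k → length (enum f G (ρ G) k)) k) (trans (cong (ρ G ∸_) (sym (ℕP.+-suc s (r F)))) (ℕP.[m+n]∸[m+o]≡n∸o s (r G) (suc (r F)))))
            (geom-cong (r G ∸ suc (r F)) (length-enum f G) k))))

  module _ {n : ℕ} (M : Matroid n) where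

    open FlatLattice M
    open Count M

    enum-γ-chow : Flat ⊥ → 1 ≤ rk M → GammaPositive (rk M ∸ 1) (λ k → length (Nesting.enum M 0 (suc (rk M)) ⊥ 0 k))
    enum-γ-chow flat 1≤rk = γ-ext (rk M ∸ 1)
      (λ k → sym (trans (cong (λ c → length (Nesting.enum M 0 (suc (rk M)) ⊥ c k)) (sym rank-⊥))
        (trans (EnumCount.length-enum M 0 (suc (rk M)) ⊥ k)
          (num-count (suc (rk M)) flat (ℕP.≤-trans (ℕP.n≤1+n (rk M)) (ℕP.m≤m+n (suc (rk M)) _)) k))))
      (count-γ (rk M ∸ 1) flat (trans (cong (suc (rk M ∸ 1) +_) rank-⊥)
        (trans (ℕP.+-identityʳ _) (sym (ℕP.+-∸-assoc 1 1≤rk)))))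

    -- The bottom is given 0 although `ρ ⊥ = 1`, so the first geometric sum has length `r G` instead
    -- of `r G − 1`. That is already the shape of `V 0 ⊥ 0`, with centre `rk M / 2`.
    enum-γ-augmented : Flat ⊥ → GammaPositive (rk M) (λ k → length (Nesting.enum M 1 (suc (rk M)) ⊥ 0 k))
    enum-γ-augmented flat = γ-ext (rk M) (λ k → sym (eq k))
      (proj₁ (V-γ (rk M) flat (trans (cong (rk M +_) rank-⊥) (ℕP.+-identityʳ _)) 0))
      where
      open ≡-Reasoning
      r = rank M
      eq : ∀ k → length (Nesting.enum M 1 (suc (rk M)) ⊥ 0 k) ≡ V 0 ⊥ 0 k
      eq k = begin
        length (Nesting.enum M 1 (suc (rk M)) ⊥ 0 k)
          ≡⟨ EnumCount.length-enum-suc M 1 (rk M) ⊥ 0 k ⟩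
        one k + ∑ₙ (above ⊥) (λ G → geom (r G) (λ k → length (Nesting.enum M 1 (rk M) G (suc (r G)) k)) k)
          ≡⟨ ℕP.+-comm (one k) _ ⟩
        ∑ₙ (above ⊥) (λ G → geom (r G) (λ k → length (Nesting.enum M 1 (rk M) G (suc (r G)) k)) k) + one k
          ≡⟨ cong₂ _+_ (∑ₙ-cong (above ⊥) (λ {G} i → geom-cong (r G) (λ k → trans (EnumCount.length-enum M 1 (rk M) G k)
               (num-count (rk M) (proj₁ (above-sound i)) (ℕP.m≤m+n (rk M) _) k)) k)) (sym (∑ₙ-top (in? ⊥ 0) (⊆-min ⊤ , λ _ _ _ → z≤n) k)) ⟩
        ∑ₙ (above ⊥) (λ G → geom (r G) (count G) k) + ∑ₙ flats (λ G → χ (in? ⊥ 0 G) * top G k)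
          ≡⟨ cong (_+ ∑ₙ flats (λ G → χ (in? ⊥ 0 G) * top G k)) (trans (∑ₙ-filter (above? ⊥) flats _) (∑ₙ-cong flats (λ {G} _ → term G))) ⟩
        ∑ₙ flats (λ G → χ (in? ⊥ 0 G) * geom (r G ∸ r ⊥) (count G) k) + ∑ₙ flats (λ G → χ (in? ⊥ 0 G) * top G k)
          ≡⟨ ∑ₙ-+ flats _ _ ⟨
        ∑ₙ flats (λ G → χ (in? ⊥ 0 G) * geom (r G ∸ r ⊥) (count G) k + χ (in? ⊥ 0 G) * top G k)
          ≡⟨ ∑ₙ-cong flats (λ {G} _ → sym (ℕP.*-distribˡ-+ (χ (in? ⊥ 0 G)) (geom (r G ∸ r ⊥) (count G) k) (top G k))) ⟩
        V 0 ⊥ 0 k ∎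
        where
        term : ∀ G → χ (above? ⊥ G) * geom (r G) (count G) k ≡ χ (in? ⊥ 0 G) * geom (r G ∸ r ⊥) (count G) k
        term G = go (G ⊆? ⊥)
          where
          go : Dec (G ⊆ ⊥) → χ (above? ⊥ G) * geom (r G) (count G) k ≡ χ (in? ⊥ 0 G) * geom (r G ∸ r ⊥) (count G) k
          go (no G⊈⊥) = trans (χ-yes (above? ⊥ G) (⊆-min G , G⊈⊥) _)
            (trans (cong (λ z → geom (r G ∸ z) (count G) k) (sym rank-⊥)) (sym (χ-yes (in? ⊥ 0 G) (⊆-min G , λ _ _ _ → z≤n) _)))
          -- The flat `⊥` is missing on the left; on the right its geometric sum is empty.
          go (yes G⊆⊥) = trans (χ-no (above? ⊥ G) (λ (_ , G⊈⊥) → G⊈⊥ G⊆⊥) (geom (r G) (count G) k))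
            (sym (trans (cong (χ (in? ⊥ 0 G) *_) (cong (λ z → geom z (count G) k) (ℕP.m≤n⇒m∸n≡0 (rank-mono M G⊆⊥)))) (ℕP.*-zeroʳ (χ (in? ⊥ 0 G)))))

-- Monomials as words and substitution of linear forms.

module Multilinear where

  open Sums
  open Pairing
  open import Data.Nat using (zero; suc)
  open import Data.Fin using (zero; suc)
  open import Data.Vec using ([]; _∷_) renaming (replicate to replicateᵛ)
  open import Data.List using (replicate)
  open import Data.List.Membership.Propositional using (_∈_)
  open import Data.List.Relation.Unary.All using ([]; _∷_)
  open import Data.List.Relation.Binary.Permutation.Propositional using (refl; prep; swap; trans; ↭-refl)

  open +-*-Solver

  Symmetric : {I : Set} → (List I → ℚ) → Set
  Symmetric ξ = ∀ {w w′} → w ↭ w′ → ξ w ≡ ξ w′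

  -- The multilinear extension of ξ, evaluated at the linear forms Σᵢ v a i · i for a in the given word.
  ev : {A I : Set} → List I → (A → I → ℚ) → List A → (List I → ℚ) → ℚ
  ev xs v []       ξ = ξ []
  ev xs v (a ∷ as) ξ = ∑ xs (λ i → v a i ⊗ ev xs v as (λ w → ξ (i ∷ w)))

  module _ {A I : Set} (xs : List I) (v : A → I → ℚ) where

    ev-cong : ∀ as {ξ ζ} → (∀ w → All (_∈ xs) w → ξ w ≡ ζ w) → ev xs v as ξ ≡ ev xs v as ζ
    ev-cong []       e = e [] []
    ev-cong (a ∷ as) e = ∑-cong-∈ xs (λ {i} i∈ → cong (v a i ⊗_) (ev-cong as (λ w ws → e (i ∷ w) (i∈ ∷ ws))))

    ev-0 : ∀ as {ξ} → (∀ w → All (_∈ xs) w → ξ w ≡ 0ℚ) → ev xs v as ξ ≡ 0ℚ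
    ev-0 []       e = e [] []
    ev-0 (a ∷ as) e = ∑-zero-∈ xs (λ {i} i∈ →
      Eq.trans (cong (v a i ⊗_) (ev-0 as (λ w ws → e (i ∷ w) (i∈ ∷ ws)))) (QP.*-zeroʳ (v a i)))

    ev-∑ : ∀ {J : Set} as (ys : List J) (c : J → ℚ) (ξ : J → List I → ℚ) →
           ev xs v as (λ w → ∑ ys (λ j → c j ⊗ ξ j w)) ≡ ∑ ys (λ j → c j ⊗ ev xs v as (ξ j))
    ev-∑ []       ys c ξ = refl
    ev-∑ (a ∷ as) ys c ξ = begin
      ∑ xs (λ i → v a i ⊗ ev xs v as (λ w → ∑ ys (λ j → c j ⊗ ξ j (i ∷ w))))
        ≡⟨ ∑-cong xs (λ i → cong (v a i ⊗_) (ev-∑ as ys c (λ j w → ξ j (i ∷ w)))) ⟩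
      ∑ xs (λ i → v a i ⊗ ∑ ys (λ j → c j ⊗ ev xs v as (λ w → ξ j (i ∷ w))))
        ≡⟨ ∑-cong xs (λ i → sym (∑-⊗ˡ ys (v a i) _)) ⟩
      ∑ xs (λ i → ∑ ys (λ j → v a i ⊗ (c j ⊗ ev xs v as (λ w → ξ j (i ∷ w)))))
        ≡⟨ ∑-swap xs ys _ ⟩
      ∑ ys (λ j → ∑ xs (λ i → v a i ⊗ (c j ⊗ ev xs v as (λ w → ξ j (i ∷ w)))))
        ≡⟨ ∑-cong ys (λ j → Eq.trans
             (∑-cong xs (λ i → solve 3 (λ x y z → x :* (y :* z) := y :* (x :* z)) refl (v a i) (c j) (ev xs v as (λ w → ξ j (i ∷ w)))))
             (∑-⊗ˡ xs (c j) _)) ⟩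
      ∑ ys (λ j → c j ⊗ ev xs v (a ∷ as) (ξ j)) ∎
      where open ≡-Reasoning

    ev-⊕ : ∀ as ξ ζ → ev xs v as (λ w → ξ w ⊕ ζ w) ≡ ev xs v as ξ ⊕ ev xs v as ζ
    ev-⊕ []       ξ ζ = refl
    ev-⊕ (a ∷ as) ξ ζ = Eq.trans
      (∑-cong xs (λ i → Eq.trans (cong (v a i ⊗_) (ev-⊕ as (λ w → ξ (i ∷ w)) (λ w → ζ (i ∷ w)))) (QP.*-distribˡ-+ (v a i) _ _)))
      (∑-⊕ xs _ _)

    ev-perm : ∀ {as bs} {ξ} → Symmetric ξ → as ↭ bs → ev xs v as ξ ≡ ev xs v bs ξ
    ev-perm s refl = refl
    ev-perm s (prep a p) = ∑-cong xs (λ i → cong (v a i ⊗_) (ev-perm (λ q → s (prep i q)) p))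
    ev-perm s (trans p q) = Eq.trans (ev-perm s p) (ev-perm s q)
    ev-perm {ξ = ξ} s (swap {as} {bs} a b p) = begin
      ∑ xs (λ i → v a i ⊗ ∑ xs (λ j → v b j ⊗ ev xs v as (λ w → ξ (i ∷ j ∷ w))))
        ≡⟨ ∑-cong xs (λ i → sym (∑-⊗ˡ xs (v a i) _)) ⟩
      ∑ xs (λ i → ∑ xs (λ j → v a i ⊗ (v b j ⊗ ev xs v as (λ w → ξ (i ∷ j ∷ w)))))
        ≡⟨ ∑-swap xs xs _ ⟩
      ∑ xs (λ j → ∑ xs (λ i → v a i ⊗ (v b j ⊗ ev xs v as (λ w → ξ (i ∷ j ∷ w)))))
        ≡⟨ ∑-cong xs (λ j → Eq.trans (∑-cong xs (λ i → Eq.trans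
             (solve 3 (λ x y z → x :* (y :* z) := y :* (x :* z)) refl (v a i) (v b j) (ev xs v as (λ w → ξ (i ∷ j ∷ w))))
             (cong (λ z → v b j ⊗ (v a i ⊗ z)) (Eq.trans (ev-cong as (λ w _ → s (swap i j ↭-refl)))
               (ev-perm (λ q → s (prep j (prep i q))) p)))))
             (∑-⊗ˡ xs (v b j) _)) ⟩
      ∑ xs (λ j → v b j ⊗ ∑ xs (λ i → v a i ⊗ ev xs v bs (λ w → ξ (j ∷ i ∷ w)))) ∎
      where open ≡-Reasoning

  -- Substituting forms u in letters i, and then forms v in letters a, when for the functionals
  -- at hand (the class 𝒢) the composite of the two substitutions is the identity.
  ev-inverse : {A I : Set} (xs : List I) (ys : List A) (v : A → I → ℚ) (u : I → A → ℚ) (E : A → Set) (𝒢 : (List A → ℚ) → Set) →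
    (∀ η a → 𝒢 η → 𝒢 (λ w → η (a ∷ w))) →
    (∀ η a → E a → 𝒢 η → ∀ as → ∑ xs (λ i → v a i ⊗ ∑ ys (λ b → u i b ⊗ η (b ∷ as))) ≡ η (a ∷ as)) →
    ∀ as → All E as → ∀ η → 𝒢 η → ev xs v as (λ w → ev ys u w η) ≡ η as
  ev-inverse xs ys v u E 𝒢 tail inverse [] [] η g = refl
  ev-inverse xs ys v u E 𝒢 tail inverse (a ∷ as) (e ∷ es) η g = Eq.trans
    (∑-cong xs (λ i → cong (v a i ⊗_) (Eq.trans
      (ev-∑ xs v as ys (u i) (λ b w → ev ys u w (λ w′ → η (b ∷ w′))))
      (∑-cong ys (λ b → cong (u i b ⊗_) (ev-inverse xs ys v u E 𝒢 tail inverse as es (λ w → η (b ∷ w)) (tail η b g)))))))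
    (inverse η a e g as)

  unit : ∀ {m} → Fin m → Mon m
  unit {m} i = replicateᵛ m 0 [ i ]≔ 1

  expo : ∀ {m} → List (Fin m) → Mon m
  expo []      = replicateᵛ _ 0
  expo (i ∷ w) = unit i +M expo w

  +M-comm : ∀ {m} (μ ν : Mon m) → μ +M ν ≡ ν +M μ
  +M-comm []      []      = refl
  +M-comm (a ∷ μ) (b ∷ ν) = cong₂ _∷_ (ℕP.+-comm a b) (+M-comm μ ν)

  +M-assoc : ∀ {m} (μ ν κ : Mon m) → (μ +M ν) +M κ ≡ μ +M (ν +M κ)
  +M-assoc []      []      []      = refl
  +M-assoc (a ∷ μ) (b ∷ ν) (c ∷ κ) = cong₂ _∷_ (ℕP.+-assoc a b c) (+M-assoc μ ν κ)

  +M-identityˡ : ∀ {m} (μ : Mon m) → replicateᵛ m 0 +M μ ≡ μ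
  +M-identityˡ []      = refl
  +M-identityˡ (a ∷ μ) = cong (a ∷_) (+M-identityˡ μ)

  expo-perm : ∀ {m} {w w′ : List (Fin m)} → w ↭ w′ → expo w ≡ expo w′
  expo-perm refl = refl
  expo-perm (prep i p) = cong (unit i +M_) (expo-perm p)
  expo-perm (trans p q) = Eq.trans (expo-perm p) (expo-perm q)
  expo-perm (swap {w} {w′} i j p) = begin
    unit i +M (unit j +M expo w)    ≡⟨ +M-assoc (unit i) (unit j) (expo w) ⟨
    unit i +M unit j +M expo w      ≡⟨ cong₂ _+M_ (+M-comm (unit i) (unit j)) (expo-perm p) ⟩
    unit j +M unit i +M expo w′     ≡⟨ +M-assoc (unit j) (unit i) (expo w′) ⟩
    unit j +M (unit i +M expo w′)   ∎
    where open ≡-Reasoning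

  -- One fixed ordering of the letters of a monomial; a symmetric functional takes the same value on
  -- every other.
  word : ∀ {m} → Mon m → List (Fin m)
  word []      = []
  word (a ∷ μ) = replicate a zero ++ map suc (word μ)

  word-0 : ∀ m → word (replicateᵛ m 0) ≡ []
  word-0 zero    = refl
  word-0 (suc m) = cong (map suc) (word-0 m)

  word-unit : ∀ {m} (i : Fin m) μ → word (unit i +M μ) ↭ i ∷ word μ
  word-unit zero    (a ∷ μ) = ↭-reflexive (cong (λ ν → zero ∷ replicate a zero ++ map suc (word ν)) (+M-identityˡ μ))
  word-unit (suc i) (a ∷ μ) = ↭-trans (Perm.++⁺ˡ (replicate a zero) (Perm.map⁺ suc (word-unit i μ)))
    (Perm.shift (suc i) (replicate a zero) (map suc (word μ)))

  word-expo : ∀ {m} (w : List (Fin m)) → word (expo w) ↭ w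
  word-expo {m} []  = ↭-reflexive (word-0 m)
  word-expo (i ∷ w) = ↭-trans (word-unit i (expo w)) (prep i (word-expo w))

  expo-word : ∀ {m} (μ : Mon m) → expo (word μ) ≡ μ
  expo-word [] = refl
  expo-word {suc m} (a ∷ μ) = Eq.trans (go a) (cong (λ ν → a ∷ ν) (expo-word μ))
    where
    expo-suc : ∀ (w : List (Fin m)) → expo (map suc w) ≡ 0 ∷ expo w
    expo-suc []      = refl
    expo-suc (i ∷ w) = cong (unit (suc i) +M_) (expo-suc w)
    go : ∀ a → expo (replicate a zero ++ map suc (word μ)) ≡ a ∷ expo (word μ)
    go zero    = expo-suc (word μ)
    go (suc a) = Eq.trans (cong (unit zero +M_) (go a)) (cong (suc a ∷_) (+M-identityˡ (expo (word μ))))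

  length-word : ∀ {m} (μ : Mon m) → length (word μ) ≡ deg μ
  length-word []      = refl
  length-word (a ∷ μ) = Eq.trans (ListP.length-++ (replicate a zero)) (cong₂ _+_ (ListP.length-replicate a)
    (Eq.trans (ListP.length-map suc (word μ)) (length-word μ)))

  module _ {A : Set} {m : ℕ} (v : A → Fin m → ℚ) where

    form : A → Poly m
    form a = map (λ i → v a i , unit i) (allFin m)

    monomial : List A → Poly m
    monomial []       = (1ℚ , replicateᵛ m 0) ∷ []
    monomial (a ∷ as) = form a *P monomial as

    pair-monomial : ∀ as f → ⟪ monomial as , f ⟫ ≡ ev (allFin m) v as (f ∘ expo)
    pair-monomial []       f = Eq.trans (QP.+-identityʳ _) (QP.*-identityˡ _)
    pair-monomial (a ∷ as) f = Eq.trans (pair-mul (form a) (monomial as) f) (Eq.trans (∑-map _ (allFin m) _)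
      (∑-cong (allFin m) (λ i → cong (v a i ⊗_) (pair-monomial as (λ ν → f (unit i +M ν))))))

    monomial-deg : ∀ as → AllDeg (length as) (monomial as)
    monomial-deg [] (here refl) = deg-0 m
      where
      deg-0 : ∀ m → deg (replicateᵛ m 0) ≡ 0
      deg-0 zero    = refl
      deg-0 (suc m) = deg-0 m
    monomial-deg (a ∷ as) = allDeg-mul {p = form a} {q = monomial as} form-deg (monomial-deg as)
      where
      form-deg : AllDeg 1 (form a)
      form-deg t∈ with i , _ , refl ← ∈-map⁻ (λ i → v a i , unit i) t∈ = allDeg-var i (here refl)

-- Straightening of words into nested words.

module Spanning where

  open Flats
  open NestedWords
  open Multilinear using (Symmetric)
  open import Algebra.Properties.CommutativeSemigroup ℕP.+-commutativeSemigroup using (x∙yz≈y∙xz)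
  open import Data.Nat using (zero; suc)
  open import Data.List using (replicate)
  open import Data.List.Membership.Propositional using (find)
  open import Data.List.Membership.Propositional.Properties using (∈-∃++)
  open import Data.List.Relation.Unary.All using ([]; _∷_)
  open import Data.List.Relation.Binary.Permutation.Propositional using (refl; prep; swap; trans)

  extract : ∀ {A : Set} {x : A} {xs} → x ∈ˡ xs → ∃ λ ys → xs ↭ x ∷ ys
  extract {x = x} i with as , bs , refl ← ∈-∃++ i = as ++ bs , Perm.shift x as bs

  module RankSum {n : ℕ} (M : Matroid n) where

    open FlatLattice M

    rsum : List (Subset n) → ℕ
    rsum []      = 0
    rsum (A ∷ w) = rank M A + rsum w

    rsum-↭ : ∀ {w w′} → w ↭ w′ → rsum w ≡ rsum w′
    rsum-↭ refl        = refl
    rsum-↭ (prep A p)  = cong (rank M A +_) (rsum-↭ p)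
    rsum-↭ (swap A B p) = Eq.trans (x∙yz≈y∙xz (rank M A) (rank M B) _) (cong (λ z → rank M B + (rank M A + z)) (rsum-↭ p))
    rsum-↭ (trans p q) = Eq.trans (rsum-↭ p) (rsum-↭ q)

    rsum-++ : ∀ w w′ → rsum (w ++ w′) ≡ rsum w + rsum w′
    rsum-++ []      w′ = refl
    rsum-++ (A ∷ w) w′ = Eq.trans (cong (rank M A +_) (rsum-++ w w′)) (sym (ℕP.+-assoc (rank M A) _ _))

    rsum-≤ : ∀ w → rsum w ≤ length w * rk M
    rsum-≤ []      = z≤n
    rsum-≤ (A ∷ w) = ℕP.+-mono-≤ (rank-mono M (⊆-max A)) (rsum-≤ w)

    minimum-first : ∀ A w → ∃ λ G → ∃ λ w′ → A ∷ w ↭ G ∷ w′ × All (λ B → rank M G ≤ rank M B) w′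
    minimum-first A []      = A , [] , refl , []
    minimum-first A (B ∷ w) with G , w′ , p , least ← minimum-first B w with rank M A ≤? rank M G
    ... | yes A≤G = A , G ∷ w′ , prep A p , A≤G ∷ All.map (ℕP.≤-trans A≤G) least
    ... | no A≰G  = G , A ∷ w′ , ↭-trans (prep A p) (swap A G refl) , ℕP.<⇒≤ (ℕP.≰⇒> A≰G) ∷ least

    collect : ∀ (G : Subset n) w → ∃ λ a → ∃ λ u → w ↭ replicate a G ++ u × All (_≢ G) u
    collect G []      = 0 , [] , refl , []
    collect G (A ∷ w) with a , u , p , others ← collect G w with A ≟S G
    ... | yes refl = suc a , u , prep A p , others
    ... | no A≢G   = a , A ∷ u , ↭-trans (prep A p) (↭-sym (Perm.shift A (replicate a G) u)) , A≢G ∷ others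

  module Straightening {n : ℕ} (M : Matroid n) (s : ℕ) where

    open FlatLattice M
    open Nesting M s
    open RankSum M

    -- What a functional sees of the ring: the letter `A` stands for `h_A`, and each relation
    -- appears multiplied by an arbitrary monomial `w`.
    record Relations (η : Word → ℚ) : Set where
      field
        symmetric : Symmetric η
        atom-0    : ∀ {A} → Flat A → ρ A ≡ 1 → ∀ w → η (A ∷ w) ≡ 0ℚ
        modular   : ∀ {A B} → Elem A → Elem B → ∀ w →
                    η (A ∷ B ∷ w) ⊕ η (A ∨ B ∷ A ∨ B ∷ w) ≡ η (A ∷ A ∨ B ∷ w) ⊕ η (A ∨ B ∷ B ∷ w)
        cover     : ∀ {A e} → Elem A → e ∉ A → ∀ w →
                    η (A ∷ A ∨ ⁅ e ⁆ ∷ w) ≡ η (A ∨ ⁅ e ⁆ ∷ A ∨ ⁅ e ⁆ ∷ w)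

    module _ {η : Word → ℚ} (rel : Relations η)
      (atom-below : ∀ {G} → Elem G → ∃ λ A → Flat A × ρ A ≡ 1 × A ⊆ G) where

      open Relations rel

      private
        ρ-mono : ∀ {A B} → A ⊆ B → ρ A ≤ ρ B
        ρ-mono A⊆B = ℕP.+-monoʳ-≤ s (rank-mono M A⊆B)

        elem-⊇ : ∀ {A B} → Elem A → Flat B → A ⊆ B → Elem B
        elem-⊇ (_ , 1≤) flat A⊆B = flat , ℕP.≤-trans 1≤ (ρ-mono A⊆B)

      -- With `H` a cover of `F` below `G`: `h_F h_G^(d+1) = h_F h_H h_G^d = h_H² h_G^d = h_H
      -- h_G^(d+1) = h_G^(d+2)`. The second equality is the cover relation; the other three are the
      -- induction hypothesis for `H`, with cofactors `F`, `H` and `G`.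
      power : ∀ d {F G} → Elem F → Flat G → F ⊆ G → ρ G ≡ d + ρ F → ∀ z →
              η (F ∷ replicate d G ++ z) ≡ η (replicate (suc d) G ++ z)
      power zero {F} {G} (flatF , _) flatG F⊆G e z =
        cong (λ H → η (H ∷ z)) (flat-rank-≡ flatF F⊆G (ℕP.+-cancelˡ-≤ s _ _ (ℕP.≤-reflexive e)))
      power (suc d) {F} {G} elF@(flatF , _) flatG F⊆G e z with G ⊆? F
      ... | yes G⊆F = contradiction (ℕP.≤-trans (ℕP.≤-reflexive (sym e)) (ρ-mono G⊆F)) (ℕP.<⇒≱ (s≤s (ℕP.m≤n+m (ρ F) d)))
      ... | no G⊈F with x , x∈G , x∉F ← ⊈-witness G⊈F = begin
        η (F ∷ G ∷ replicate d G ++ z)                  ≡⟨ symmetric (↭-trans (↭-sym (Perm.shift F (replicate (suc d) G) z)) refl) ⟩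
        η (replicate (suc d) G ++ F ∷ z)                ≡⟨ ih (F ∷ z) ⟨
        η (H ∷ replicate d G ++ F ∷ z)                  ≡⟨ symmetric (↭-trans (prep H (Perm.shift F (replicate d G) z)) (swap H F refl)) ⟩
        η (F ∷ H ∷ replicate d G ++ z)                  ≡⟨ cover elF x∉F _ ⟩
        η (H ∷ H ∷ replicate d G ++ z)                  ≡⟨ symmetric (prep H (↭-sym (Perm.shift H (replicate d G) z))) ⟩
        η (H ∷ replicate d G ++ H ∷ z)                  ≡⟨ ih (H ∷ z) ⟩
        η (G ∷ replicate d G ++ H ∷ z)                  ≡⟨ symmetric (↭-trans (prep G (Perm.shift H (replicate d G) z)) (↭-trans (swap G H refl) (prep H (↭-sym (Perm.shift G (replicate d G) z))))) ⟩
        η (H ∷ replicate d G ++ G ∷ z)                  ≡⟨ ih (G ∷ z) ⟩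
        η (G ∷ replicate d G ++ G ∷ z)                  ≡⟨ symmetric (prep G (Perm.shift G (replicate d G) z)) ⟩
        η (G ∷ G ∷ replicate d G ++ z)                  ∎
        where
        open ≡-Reasoning
        H = F ∨ ⁅ x ⁆
        H⊆G : H ⊆ G
        H⊆G = ∨-least flatG F⊆G (⁅⁆-⊆ x∈G)
        ih : ∀ z → η (H ∷ replicate d G ++ z) ≡ η (G ∷ replicate d G ++ z)
        ih = power d (elem-⊇ elF (cl-flat _) (∨-left F ⁅ x ⁆)) flatG H⊆G
          (Eq.trans e (Eq.trans (sym (ℕP.+-suc d (ρ F))) (cong (d +_) (Eq.trans (sym (ℕP.+-suc s (rank M F))) (cong (s +_) (sym (rank-cover flatF x∉F)))))))

      private
        zero-sum : ∀ {a b c d : ℚ} → a ⊕ b ≡ c ⊕ d → b ≡ 0ℚ → c ≡ 0ℚ → d ≡ 0ℚ → a ≡ 0ℚ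
        zero-sum {a} e refl refl refl = Eq.trans (sym (QP.+-identityʳ a)) e

        replicate-split : ∀ {d a} (G : Subset n) u → d ≤ a → replicate a G ++ u ≡ replicate d G ++ (replicate (a ∸ d) G ++ u)
        replicate-split {zero}  {a}     G u le       = refl
        replicate-split {suc d} {suc a} G u (s≤s le) = cong (G ∷_) (replicate-split G u le)

        module _ (k R : ℕ) (higher : ∀ w → All Elem w → length w ≡ k → R < rsum w → η w ≡ 0ℚ) where

          Current : Word → Set
          Current w = All Elem w × length w ≡ k × rsum w ≡ R

          current-↭ : ∀ {w w′} → w ↭ w′ → Current w → Current w′
          current-↭ p (el , l , e) = Perm.All-resp-↭ p el , Eq.trans (sym (Perm.↭-length p)) l , Eq.trans (sym (rsum-↭ p)) e

          -- The join has larger rank than `A` and than `B`, so the other three words of the modular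
          -- relation have larger total rank and vanish by `higher`.
          incomparable-0 : ∀ {A B z} → Current (A ∷ B ∷ z) → ¬ (A ⊆ B) → ¬ (B ⊆ A) → η (A ∷ B ∷ z) ≡ 0ℚ
          incomparable-0 {A} {B} {z} (elA ∷ elB ∷ elz , l , e) A⊈B B⊈A = zero-sum (modular elA elB z)
            (higher _ (elJ ∷ elJ ∷ elz) l (subst (_< rank M J + (rank M J + rsum z)) e (ℕP.+-mono-<-≤ A<J (ℕP.+-monoˡ-≤ (rsum z) (ℕP.<⇒≤ B<J)))))
            (higher _ (elA ∷ elJ ∷ elz) l (subst (_< rank M A + (rank M J + rsum z)) e (ℕP.+-monoʳ-< (rank M A) (ℕP.+-monoˡ-< (rsum z) B<J))))
            (higher _ (elJ ∷ elB ∷ elz) l (subst (_< rank M J + (rank M B + rsum z)) e (ℕP.+-monoˡ-< (rank M B + rsum z) A<J)))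
            where
            J = A ∨ B
            elJ : Elem J
            elJ = elem-⊇ elA (cl-flat _) (∨-left A B)
            A<J : rank M A < rank M J
            A<J = flat-rank-< (proj₁ elA) (∨-left A B) (λ J⊆A → B⊈A (⊆-trans (∨-right A B) J⊆A))
            B<J : rank M B < rank M J
            B<J = flat-rank-< (proj₁ elB) (∨-right A B) (λ J⊆B → A⊈B (⊆-trans (∨-left A B) J⊆B))

          -- For an atom `A` below `G`, the power rule gives `h_G^(ρ G) = h_A h_G^(ρ G − 1)`, and
          -- `h_A = 0`.
          overfull-bottom : ∀ pre {G} a u → Current (pre ++ replicate (suc a) G ++ u) → ρ G ≤ suc a →
                            η (pre ++ replicate (suc a) G ++ u) ≡ 0ℚ
          overfull-bottom pre {G} a u cur ρ≤ with elG ∷ _ , _ ← current-↭ (Perm.shifts pre (replicate (suc a) G)) cur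
            with A , flatA , ρA≡1 , A⊆G ← atom-below elG = begin
            η (pre ++ replicate (suc a) G ++ u)                  ≡⟨ symmetric (Perm.shifts pre (replicate (suc a) G)) ⟩
            η (replicate (suc a) G ++ pre ++ u)                  ≡⟨ cong η (replicate-split G (pre ++ u) suc-d≤) ⟩
            η (replicate (suc d) G ++ z)                         ≡⟨ power d (flatA , ℕP.≤-reflexive (sym ρA≡1)) (proj₁ elG) A⊆G
                                                                      (Eq.trans ρ≡ (cong (d +_) (sym ρA≡1))) z ⟨
            η (A ∷ replicate d G ++ z)                           ≡⟨ atom-0 flatA ρA≡1 _ ⟩
            0ℚ                                                   ∎
            where
            open ≡-Reasoning
            d = ρ G ∸ 1
            z = replicate (suc a ∸ suc d) G ++ pre ++ u
            ρ≡ : ρ G ≡ d + 1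
            ρ≡ = sym (ℕP.m∸n+n≡m (proj₂ elG))
            suc-d≤ : suc d ≤ suc a
            suc-d≤ = subst (_≤ suc a) (Eq.trans ρ≡ (ℕP.+-comm d 1)) ρ≤

          -- The power rule trades `h_F h_G^d` for `h_G^(d+1)`, where `d = ρ G − ρ F`. This replaces
          -- a letter `F` by the larger `G`, so the total rank rises.
          overfull-at : ∀ {F} pre {G} a u → F ∈ˡ pre → Above F G → Current (pre ++ replicate (suc a) G ++ u) →
                        ρ G ≤ suc a + ρ F → η (pre ++ replicate (suc a) G ++ u) ≡ 0ℚ
          overfull-at {F} pre {G} a u F∈ (F⊆G , G⊈F) cur ρ≤ with pre′ , p ← extract F∈ = begin
            η (pre ++ replicate (suc a) G ++ u)   ≡⟨ symmetric rearrange ⟩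
            η (F ∷ replicate d G ++ z)            ≡⟨ power d elF (proj₁ elG) F⊆G (sym (ℕP.m∸n+n≡m (ρ-mono F⊆G))) z ⟩
            η (G ∷ replicate d G ++ z)            ≡⟨ higher _ (elG ∷ els) (proj₁ (proj₂ cur′))
                                                       (subst (_< rank M G + rsum (replicate d G ++ z)) (proj₂ (proj₂ cur′))
                                                         (ℕP.+-monoˡ-< (rsum (replicate d G ++ z)) (flat-rank-< (proj₁ elF) F⊆G G⊈F))) ⟩
            0ℚ                                    ∎
            where
            open ≡-Reasoning
            d = ρ G ∸ ρ F
            z = replicate (suc a ∸ d) G ++ pre′ ++ u
            d≤ : d ≤ suc a
            d≤ = ℕP.m≤n+o⇒m∸n≤o (ρ G) (ρ F) (subst (ρ G ≤_) (ℕP.+-comm (suc a) (ρ F)) ρ≤)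
            rearrange : pre ++ replicate (suc a) G ++ u ↭ F ∷ replicate d G ++ z
            rearrange = ↭-trans (Perm.++⁺ʳ (replicate (suc a) G ++ u) p)
              (prep F (↭-trans (Perm.shifts pre′ (replicate (suc a) G)) (↭-reflexive (replicate-split G (pre′ ++ u) d≤))))
            cur′ = current-↭ rearrange cur
            elF = All.head (proj₁ cur′)
            els = All.tail (proj₁ cur′)
            elG : Elem G
            elG = All.head (proj₁ (current-↭ (Perm.shifts pre (replicate (suc a) G)) cur))

          -- The part pre has been split off; it ends at the base F, which has rank c.
          data Base (pre w : Word) : Subset n → ℕ → Set where
            bottom : Base pre w ⊥ 0
            at     : ∀ {F} → F ∈ˡ pre → All (Above F) w → Base pre w F (ρ F)

          -- A letter `G` of least rank must come next in the chain, because a different letter not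
          -- above it is incomparable with it. Its copies are gathered; either their number is too
          -- large for the gap above the base, or they join `pre` and `G` becomes the new base.
          reduce : ∀ fuel pre w {F c} → length w ≤ fuel → Base pre w F c → Current (pre ++ w) →
                   (∀ v → Nested F c v → length v ≡ length w → η (pre ++ v) ≡ 0ℚ) → η (pre ++ w) ≡ 0ℚ
          reduce fuel pre [] le base cur nested-0 = nested-0 [] nil refl
          reduce (suc fuel) pre (A ∷ w₁) {F} {c} (s≤s le) base cur nested-0
            with G , w′ , p , least ← minimum-first A w₁ with a , u , q , others ← collect G w′ =
            Eq.trans (symmetric (Perm.++⁺ˡ pre p′)) (split (All.all? (G ⊆?_) u))
            where
            p′ : A ∷ w₁ ↭ replicate (suc a) G ++ u
            p′ = ↭-trans p (prep G q)
            cur′ : Current (pre ++ replicate (suc a) G ++ u)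
            cur′ = current-↭ (Perm.++⁺ˡ pre p′) cur
            els : All Elem (replicate (suc a) G ++ u)
            els = AllP.++⁻ʳ pre (proj₁ cur′)
            elG : Elem G
            elG = All.head els
            length-eq : length (A ∷ w₁) ≡ suc a + length u
            length-eq = Eq.trans (Perm.↭-length p′) (Eq.trans (ListP.length-++ (replicate (suc a) G)) (cong (_+ length u) (ListP.length-replicate (suc a))))
            above-G : All (G ⊆_) u → All (Above G) u
            above-G sup = All.tabulate (λ {B} B∈u → All.lookup sup B∈u , λ B⊆G → All.lookup others B∈u (⊆-antisym B⊆G (All.lookup sup B∈u)))
            recurse : ∀ {F c} → (∀ v → Nested F c v → length v ≡ length (A ∷ w₁) → η (pre ++ v) ≡ 0ℚ) →
                      All (G ⊆_) u → Above F G → suc a + suc c ≤ ρ G → η (pre ++ replicate (suc a) G ++ u) ≡ 0ℚ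
            recurse nested-0 sup F⊂G room = Eq.trans (cong η (sym (ListP.++-assoc pre (replicate (suc a) G) u)))
              (reduce fuel (pre ++ replicate (suc a) G) u
                (ℕP.≤-trans (ℕP.m≤n+m (length u) a) (subst (_≤ fuel) (ℕP.suc-injective length-eq) le))
                (at (AnyP.++⁺ʳ pre (here refl)) (above-G sup))
                (current-↭ (↭-reflexive (sym (ListP.++-assoc pre (replicate (suc a) G) u))) cur′)
                λ v nested l → Eq.trans (cong η (ListP.++-assoc pre (replicate (suc a) G) v))
                  (nested-0 _ (step (proj₁ elG) F⊂G room nested)
                    (Eq.trans (ListP.length-++ (replicate (suc a) G)) (Eq.trans (cong₂ _+_ (ListP.length-replicate (suc a)) l) (sym length-eq)))))
            comparable : ∀ {F c} → Base pre (A ∷ w₁) F c → (∀ v → Nested F c v → length v ≡ length (A ∷ w₁) → η (pre ++ v) ≡ 0ℚ) →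
                         All (G ⊆_) u → η (pre ++ replicate (suc a) G ++ u) ≡ 0ℚ
            comparable bottom nested-0 sup with suc a + 1 ≤? ρ G
            ... | no ¬room = overfull-bottom pre a u cur′ (ℕP.≤-pred (subst (ρ G <_) (cong suc (ℕP.+-comm a 1)) (ℕP.≰⇒> ¬room)))
            ... | yes room = recurse nested-0 sup (⊆-min G , λ G⊆⊥ → let B , _ , ρB≡1 , _ = atom-below elG in
              ℕP.<⇒≱ (ℕP.≤-trans (s≤s (ℕP.m≤n+m 1 a)) room) (ℕP.≤-trans (ρ-mono (⊆-trans G⊆⊥ (⊆-min B))) (ℕP.≤-reflexive ρB≡1))) room
            comparable {F} (at F∈ F⊂) nested-0 sup with suc a + suc (ρ F) ≤? ρ G
            ... | no ¬room = overfull-at pre a u F∈ (All.head (Perm.All-resp-↭ p F⊂)) cur′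
              (ℕP.≤-pred (subst (ρ G <_) (ℕP.+-suc (suc a) (ρ F)) (ℕP.≰⇒> ¬room)))
            ... | yes room = recurse nested-0 sup (All.head (Perm.All-resp-↭ p F⊂)) room
            split : Dec (All (G ⊆_) u) → η (pre ++ replicate (suc a) G ++ u) ≡ 0ℚ
            split (yes sup) = comparable base nested-0 sup
            split (no ¬sup) with B , B∈u , G⊈B ← find (AllP.¬All⇒Any¬ (G ⊆?_) u ¬sup)
              with z , r ← extract (AnyP.++⁺ʳ pre (AnyP.++⁺ʳ (replicate a G) B∈u)) =
              Eq.trans (symmetric rearrange) (incomparable-0 (current-↭ rearrange cur′) G⊈B B⊈G)
              where
              rearrange : pre ++ replicate (suc a) G ++ u ↭ G ∷ B ∷ z
              rearrange = ↭-trans (Perm.shift G pre (replicate a G ++ u)) (prep G r)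
              -- As `G` has least rank, `B ⊆ G` would force `B = G`, but every copy of `G` has been
              -- taken out of `u`.
              B⊈G : ¬ (B ⊆ G)
              B⊈G B⊆G = All.lookup others B∈u (flat-rank-≡ (proj₁ (All.lookup (AllP.++⁻ʳ (replicate (suc a) G) els) B∈u)) B⊆G
                (All.lookup (AllP.++⁻ʳ (replicate a G) (Perm.All-resp-↭ q least)) B∈u))

      -- Descending induction on the total rank, which is at most `k * rk M` for words of length
      -- `k`.
      spanning : ∀ k → (∀ w → Nested ⊥ 0 w → length w ≡ k → η w ≡ 0ℚ) → ∀ w → All Elem w → length w ≡ k → η w ≡ 0ℚ
      spanning k nested-0 w el l = go (suc (k * rk M)) w el l (s≤s (ℕP.m≤m+n (k * rk M) (rsum w)))
        where
        go : ∀ d w → All Elem w → length w ≡ k → k * rk M < d + rsum w → η w ≡ 0ℚ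
        go zero    w el l lt = contradiction (subst (λ k → rsum w ≤ k * rk M) l (rsum-≤ w)) (ℕP.<⇒≱ lt)
        go (suc d) w el l lt = reduce k (rsum w)
          (λ w′ el′ l′ R< → go d w′ el′ l′ (ℕP.<-≤-trans lt (subst (_≤ d + rsum w′) (ℕP.+-suc d (rsum w)) (ℕP.+-monoʳ-≤ d R<))))
          (length w) [] w ℕP.≤-refl bottom (el , l , refl)
          (λ v nested e → nested-0 v nested (Eq.trans e l))

-- Dual functionals from dragon Hall-Rado conditions.

module HallRado where

  open Sums
  open Flats
  open NestedWords
  open Multilinear using (Symmetric)
  open Spanning
  open import Algebra.Properties.CommutativeSemigroup ℕP.+-commutativeSemigroup using (interchange)
  open import Data.Nat using (zero; suc)
  open import Data.Fin.Subset.Properties using (p⊆p∪q; q⊆p∪q; ∪-assoc; ∪-identityʳ)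
  open import Data.List using (replicate)
  open import Data.List.Relation.Unary.All using ([]; _∷_)
  open import Data.List.Relation.Unary.AllPairs using ([]; _∷_)
  open import Data.List.Relation.Binary.Permutation.Propositional using (refl; prep; swap; trans)
  open import Relation.Nullary.Decidable using (_⊎-dec_)

  open +-*-Solver

  -- Inclusion-exclusion: the implications make `A` the conjunction and `B` the disjunction of `C`
  -- and `D`.
  ind-lattice : ∀ {A B C D : Set} (a : Dec A) (b : Dec B) (c : Dec C) (d : Dec D) →
    (A → C × D) → (C → D → A) → (B → C ⊎ D) → (C → B) → (D → B) → ind a ⊕ ind b ≡ ind c ⊕ ind d
  ind-lattice a b (yes c) (yes d) i j k l m = cong₂ _⊕_ (ind-yes a (j c d)) (ind-yes b (l c))
  ind-lattice a b (yes c) (no ¬d) i j k l m = cong₂ _⊕_ (ind-no a (¬d ∘ proj₂ ∘ i)) (ind-yes b (l c))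
  ind-lattice a b (no ¬c) (yes d) i j k l m = cong₂ _⊕_ (ind-no a (¬c ∘ proj₁ ∘ i)) (ind-yes b (m d))
  ind-lattice a b (no ¬c) (no ¬d) i j k l m = cong₂ _⊕_ (ind-no a (¬c ∘ proj₁ ∘ i)) (ind-no b λ x → neither (k x))
    where
    neither : ¬ (_ ⊎ _)
    neither (inj₁ c) = ¬c c
    neither (inj₂ d) = ¬d d

  module Dragon {n : ℕ} (M : Matroid n) (s : ℕ) where

    open FlatLattice M
    open Nesting M s
    open RankSum M

    private
      r = rank M

    -- The alternative `t ≡ 0` exempts the empty subfamily, for which the inequality would fail
    -- whenever `c = ρ U`.
    Leaf : ℕ → Subset n → ℕ → Set
    Leaf c U t = t ≡ 0 ⊎ t + suc c ≤ s + r U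

    -- The dragon Hall–Rado condition: every nonempty subfamily T of the given word
    -- satisfies |T| < s + rank (U ∪ ⋃ T) − c; here t counts the members already absorbed in U.
    Ok : ℕ → Subset n → ℕ → Word → Set
    Ok c U t []      = Leaf c U t
    Ok c U t (A ∷ S) = Ok c U t S × Ok c (U ∪ A) (suc t) S

    ok? : ∀ c U t S → Dec (Ok c U t S)
    ok? c U t []      = (t ℕ.≟ 0) ⊎-dec (t + suc c ≤? s + r U)
    ok? c U t (A ∷ S) = ok? c U t S ×-dec ok? c (U ∪ A) (suc t) S

    private
      ∪-swap : ∀ (U A B : Subset n) → (U ∪ A) ∪ B ≡ (U ∪ B) ∪ A
      ∪-swap U A B = Eq.trans (∪-assoc U A B) (Eq.trans (cong (U ∪_) (∪-comm A B)) (sym (∪-assoc U B A)))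

    ok-perm : ∀ {c U t S S′} → S ↭ S′ → Ok c U t S → Ok c U t S′
    ok-perm refl ok = ok
    ok-perm (prep A p) (ok₁ , ok₂) = ok-perm p ok₁ , ok-perm p ok₂
    ok-perm {c} {U} {t} {S′ = B ∷ A ∷ S′} (swap A B p) ((ok₁ , ok₂) , (ok₃ , ok₄)) =
      (ok-perm p ok₁ , ok-perm p ok₃) , (ok-perm p ok₂ , subst (λ V → Ok c V (suc (suc t)) S′) (∪-swap U A B) (ok-perm p ok₄))
    ok-perm (trans p q) ok = ok-perm q (ok-perm p ok)

    -- The condition is a tree with one leaf per subfamily of `S`. Here `X` is the union of a
    -- subfamily and `u` its size, so a comparison of leaves for all `X` and `u` suffices.
    ok-transfer : ∀ {c U t U′ t′} S → (∀ X u → Leaf c (U ∪ X) (u + t) → Leaf c (U′ ∪ X) (u + t′)) → Ok c U t S → Ok c U′ t′ S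
    ok-transfer {c} {U} {t} {U′} {t′} [] e ok =
      subst (λ V → Leaf c V t′) (∪-identityʳ U′) (e ⊥ 0 (subst (λ V → Leaf c V t) (sym (∪-identityʳ U)) ok))
    ok-transfer {c} {U} {t} {U′} {t′} (A ∷ S) e (ok₁ , ok₂) = ok-transfer S e ok₁ , ok-transfer S
      (λ X u l → subst₂ (Leaf c) (sym (∪-assoc U′ A X)) (sym (ℕP.+-suc u t′))
        (e (A ∪ X) (suc u) (subst₂ (Leaf c) (∪-assoc U A X) (ℕP.+-suc u t) l))) ok₂

    private
      leaf-≤ : ∀ {c U U′ t} → r U ≤ r U′ → Leaf c U t → Leaf c U′ t
      leaf-≤ le (inj₁ e) = inj₁ e
      leaf-≤ le (inj₂ l) = inj₂ (ℕP.≤-trans l (ℕP.+-monoʳ-≤ s le))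

    ok-mono : ∀ {c U U′ t} S → (∀ X → r (U ∪ X) ≤ r (U′ ∪ X)) → Ok c U t S → Ok c U′ t S
    ok-mono S le = ok-transfer S (λ X u → leaf-≤ (le X))

    -- Uncrossing: a violating family for each of U₁, U₂ gives one for their intersection or their union.
    ok-uncross : ∀ {c} S {U₁ U₂ U₃ U₄ t₁ t₂ t₃ t₄} → U₃ ⊆ U₁ → U₃ ⊆ U₂ → U₄ ⊆ U₁ ∪ U₂ → c ≤ s + r U₃ → 1 ≤ t₄ →
      t₁ + t₂ ≡ t₃ + t₄ → Ok c U₃ t₃ S → Ok c U₄ t₄ S → Ok c U₁ t₁ S ⊎ Ok c U₂ t₂ S
    ok-uncross {c} [] {U₁} {U₂} {U₃} {U₄} {t₁} {t₂} {t₃} {t₄} ₃⊆₁ ₃⊆₂ ₄⊆ c≤ 1≤t₄ t-eq ok₃ ok₄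
      with t₁ + suc c ≤? s + r U₁ | t₂ + suc c ≤? s + r U₂
    ... | yes l | _     = inj₁ (inj₂ l)
    ... | no _  | yes l = inj₂ (inj₂ l)
    ... | no ¬l₁ | no ¬l₂ = contradiction contra (ℕP.<-irrefl refl)
      where
      open ℕP.≤-Reasoning
      -- Since `t₃` may be zero, this bound is one short of the condition. The contradiction gets
      -- its strictness from the fourth family, where `1 ≤ t₄`.
      bound₃ : t₃ + c ≤ s + r U₃
      bound₃ = go ok₃
        where
        go : Leaf c U₃ t₃ → t₃ + c ≤ s + r U₃
        go (inj₁ refl) = c≤
        go (inj₂ l)    = ℕP.≤-trans (ℕP.+-monoʳ-≤ t₃ (ℕP.n≤1+n c)) l
      bound₄ : t₄ + suc c ≤ s + r U₄
      bound₄ = go ok₄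
        where
        go : Leaf c U₄ t₄ → t₄ + suc c ≤ s + r U₄
        go (inj₁ refl) = contradiction 1≤t₄ λ ()
        go (inj₂ l)    = l
      fails : ∀ {t U} → ¬ (t + suc c ≤ s + r U) → s + r U ≤ t + c
      fails {t} {U} ¬l = ℕP.≤-pred (subst (s + r U <_) (ℕP.+-suc t c) (ℕP.≰⇒> ¬l))
      contra : (t₃ + t₄) + (c + c) < (t₃ + t₄) + (c + c)
      contra = begin-strict
        (t₃ + t₄) + (c + c)            <⟨ ℕP.+-monoʳ-< (t₃ + t₄) (ℕP.+-monoʳ-< c (ℕP.n<1+n c)) ⟩
        (t₃ + t₄) + (c + suc c)        ≡⟨ interchange t₃ t₄ c (suc c) ⟩
        (t₃ + c) + (t₄ + suc c)        ≤⟨ ℕP.+-mono-≤ bound₃ bound₄ ⟩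
        (s + r U₃) + (s + r U₄)        ≡⟨ interchange s (r U₃) s (r U₄) ⟩
        (s + s) + (r U₃ + r U₄)        ≡⟨ cong (s + s +_) (ℕP.+-comm (r U₃) (r U₄)) ⟩
        (s + s) + (r U₄ + r U₃)        ≤⟨ ℕP.+-monoʳ-≤ (s + s) (rank-uncross ₃⊆₁ ₃⊆₂ ₄⊆) ⟩
        (s + s) + (r U₁ + r U₂)        ≡⟨ interchange s s (r U₁) (r U₂) ⟩
        (s + r U₁) + (s + r U₂)        ≤⟨ ℕP.+-mono-≤ (fails ¬l₁) (fails ¬l₂) ⟩
        (t₁ + c) + (t₂ + c)            ≡⟨ interchange t₁ c t₂ c ⟩
        (t₁ + t₂) + (c + c)            ≡⟨ cong (_+ (c + c)) t-eq ⟩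
        (t₃ + t₄) + (c + c)            ∎
    ok-uncross {c} (A ∷ S) {U₁} {U₂} {U₃} {U₄} {t₁} {t₂} {t₃} {t₄} ₃⊆₁ ₃⊆₂ ₄⊆ c≤ 1≤t₄ t-eq (ok₃ , ok₃⁺) (ok₄ , ok₄⁺) =
      combine
        (ok-uncross S ₃⊆₁ ₃⊆₂ ₄⊆ c≤ 1≤t₄ t-eq ok₃ ok₄)
        (ok-uncross S (⊆-trans ₃⊆₁ (p⊆p∪q A)) ₃⊆₂ (⊆-trans grow (∪-mono ⊆-refl ⊆-refl)) c≤ (ℕP.m≤n⇒m≤1+n 1≤t₄) (Eq.trans (cong suc t-eq) (sym (ℕP.+-suc t₃ t₄))) ok₃ ok₄⁺)
        (ok-uncross S ₃⊆₁ (⊆-trans ₃⊆₂ (p⊆p∪q A)) grow′ c≤ (ℕP.m≤n⇒m≤1+n 1≤t₄) (Eq.trans (ℕP.+-suc t₁ t₂) (Eq.trans (cong suc t-eq) (sym (ℕP.+-suc t₃ t₄)))) ok₃ ok₄⁺)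
        (ok-uncross S (∪-mono ₃⊆₁ ⊆-refl) (∪-mono ₃⊆₂ ⊆-refl) grow″ (ℕP.≤-trans c≤ (ℕP.+-monoʳ-≤ s (rank-mono M (p⊆p∪q A)))) (ℕP.m≤n⇒m≤1+n 1≤t₄)
          (Eq.trans (cong suc (ℕP.+-suc t₁ t₂)) (cong suc (Eq.trans (cong suc t-eq) (sym (ℕP.+-suc t₃ t₄))))) ok₃⁺ ok₄⁺)
      where
      grow : U₄ ∪ A ⊆ (U₁ ∪ A) ∪ U₂
      grow = ∪-lub (⊆-trans ₄⊆ (∪-mono (p⊆p∪q A) ⊆-refl)) (⊆-trans (q⊆p∪q U₁ A) (p⊆p∪q U₂))
      grow′ : U₄ ∪ A ⊆ U₁ ∪ (U₂ ∪ A)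
      grow′ = ∪-lub (⊆-trans ₄⊆ (∪-mono ⊆-refl (p⊆p∪q A))) (⊆-trans (q⊆p∪q U₂ A) (q⊆p∪q U₁ (U₂ ∪ A)))
      grow″ : U₄ ∪ A ⊆ (U₁ ∪ A) ∪ (U₂ ∪ A)
      grow″ = ⊆-trans grow (∪-mono ⊆-refl (p⊆p∪q A))
      -- The four calls show that a good branch occurs in every choice of one branch (with or
      -- without `A`) for each of the two sides. Hence one side is good in both of its branches.
      combine : ∀ {P P⁺ Q Q⁺ : Set} → P ⊎ Q → P⁺ ⊎ Q → P ⊎ Q⁺ → P⁺ ⊎ Q⁺ → (P × P⁺) ⊎ (Q × Q⁺)
      combine (inj₁ p) (inj₁ p⁺) _ _ = inj₁ (p , p⁺)
      combine (inj₂ q) _ (inj₂ q⁺) _ = inj₂ (q , q⁺)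
      combine (inj₂ q) _ (inj₁ p) (inj₁ p⁺) = inj₁ (p , p⁺)
      combine (inj₂ q) _ (inj₁ p) (inj₂ q⁺) = inj₂ (q , q⁺)
      combine (inj₁ p) (inj₂ q) _ (inj₁ p⁺) = inj₁ (p , p⁺)
      combine (inj₁ p) (inj₂ q) _ (inj₂ q⁺) = inj₂ (q , q⁺)

    private
      ≡⇒≤ : ∀ {a b : ℕ} → a ≡ b → a ≤ b
      ≡⇒≤ refl = ℕP.≤-refl

      rank-∪-≤ : ∀ {A B} X → A ⊆ B → r (A ∪ X) ≤ r (B ∪ X)
      rank-∪-≤ X A⊆B = rank-mono M (∪-mono A⊆B ⊆-refl)

      rank-within : ∀ {U V} X → V ⊆ cl U → r (V ∪ X) ≤ r (U ∪ X)
      rank-within {U} {V} X V⊆ = ℕP.≤-trans (rank-∪-≤ X V⊆) (≡⇒≤ (Eq.trans (cong r (∪-comm (cl U) X))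
        (Eq.trans (rank-∪-cl X U) (cong r (∪-comm X U)))))

    ok-closure : ∀ {c U V t} S → U ⊆ cl V → Ok c U t S → Ok c V t S
    ok-closure S U⊆ = ok-mono S (λ X → rank-within X U⊆)

    -- With `J = A ∨ B`, the condition for `A, B` amounts to those for `A, J` and `J, B` together,
    -- and the condition for `J, J` to one of these two. Choosing that one is the uncrossing of
    -- `F ∪ A` and `F ∪ B` against `F` and their union, whose closure contains `J`.
    ok-modular : ∀ {c F} A B S → c ≤ s + r F →
      ind (ok? c F 0 (A ∷ B ∷ S)) ⊕ ind (ok? c F 0 (A ∨ B ∷ A ∨ B ∷ S)) ≡
      ind (ok? c F 0 (A ∷ A ∨ B ∷ S)) ⊕ ind (ok? c F 0 (A ∨ B ∷ B ∷ S))
    ok-modular {c} {F} A B S c≤ = ind-lattice (ok? c F 0 (A ∷ B ∷ S)) (ok? c F 0 (J ∷ J ∷ S)) (ok? c F 0 (A ∷ J ∷ S)) (ok? c F 0 (J ∷ B ∷ S))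
      (λ ((p , qB) , (qA , rAB)) → ((p , B→J qB) , (qA , all AB⊆ rAB)) , ((p , qB) , (A→J qA , all AB⊆′ rAB)))
      (λ ((p , qJ) , (qA , rAJ)) ((_ , qB) , _) → (p , qB) , (qA , all AJ⊆ rAJ))
      (λ ((p , qJ) , (_ , rJJ)) → case p qJ rJJ (ok-uncross {c} S (p⊆p∪q A) (p⊆p∪q B) (cover-∪) c≤ (s≤s z≤n) refl p (all JJ⊆ rJJ)))
      (λ ((p , qJ) , (qA , rAJ)) → (p , qJ) , (A→J qA , all AJ⊆JJ rAJ))
      (λ ((p , qB) , (qJ , rJB)) → (p , B→J qB) , (qJ , all JB⊆JJ rJB))
      where
      J = A ∨ B
      A→J : ∀ {t} → Ok c (F ∪ A) t S → Ok c (F ∪ J) t S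
      A→J = ok-mono S (λ X → rank-∪-≤ X (∪-mono ⊆-refl (∨-left A B)))
      B→J : ∀ {t} → Ok c (F ∪ B) t S → Ok c (F ∪ J) t S
      B→J = ok-mono S (λ X → rank-∪-≤ X (∪-mono ⊆-refl (∨-right A B)))
      all : ∀ {U V t} → U ⊆ cl V → Ok c U t S → Ok c V t S
      all = ok-closure S
      F∪J⊆ : ∀ {V} → F ⊆ V → A ⊆ V → B ⊆ V → F ∪ J ⊆ cl V
      F∪J⊆ {V} f a b = ∪-lub (⊆-trans f (cl-⊇ V)) (∨-least (cl-flat V) (⊆-trans a (cl-⊇ V)) (⊆-trans b (cl-⊇ V)))
      J⊆ : ∀ {V} → A ⊆ V → B ⊆ V → J ⊆ cl V
      J⊆ {V} a b = ∨-least (cl-flat V) (⊆-trans a (cl-⊇ V)) (⊆-trans b (cl-⊇ V))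
      AB⊆ : (F ∪ A) ∪ B ⊆ cl ((F ∪ A) ∪ J)
      AB⊆ = ⊆-trans (∪-mono ⊆-refl (∨-right A B)) (cl-⊇ _)
      AB⊆′ : (F ∪ A) ∪ B ⊆ cl ((F ∪ J) ∪ B)
      AB⊆′ = ⊆-trans (∪-mono (∪-mono ⊆-refl (∨-left A B)) ⊆-refl) (cl-⊇ _)
      AJ⊆ : (F ∪ A) ∪ J ⊆ cl ((F ∪ A) ∪ B)
      AJ⊆ = ∪-lub (⊆-trans (p⊆p∪q B) (cl-⊇ _)) (J⊆ (⊆-trans (q⊆p∪q F A) (p⊆p∪q B)) (q⊆p∪q (F ∪ A) B))
      AJ⊆JJ : (F ∪ A) ∪ J ⊆ cl ((F ∪ J) ∪ J)
      AJ⊆JJ = ⊆-trans (∪-mono (∪-mono ⊆-refl (∨-left A B)) ⊆-refl) (cl-⊇ _)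
      JB⊆JJ : (F ∪ J) ∪ B ⊆ cl ((F ∪ J) ∪ J)
      JB⊆JJ = ⊆-trans (∪-mono ⊆-refl (∨-right A B)) (cl-⊇ _)
      JJ⊆ : (F ∪ J) ∪ J ⊆ cl ((F ∪ A) ∪ B)
      JJ⊆ = ∪-lub (F∪J⊆ (⊆-trans (p⊆p∪q A) (p⊆p∪q B)) (⊆-trans (q⊆p∪q F A) (p⊆p∪q B)) (q⊆p∪q (F ∪ A) B))
                  (J⊆ (⊆-trans (q⊆p∪q F A) (p⊆p∪q B)) (q⊆p∪q (F ∪ A) B))
      cover-∪ : (F ∪ A) ∪ B ⊆ (F ∪ A) ∪ (F ∪ B)
      cover-∪ = ∪-mono ⊆-refl (q⊆p∪q F B)
      case : Ok c F 0 S → Ok c (F ∪ J) 1 S → Ok c ((F ∪ J) ∪ J) 2 S → Ok c (F ∪ A) 1 S ⊎ Ok c (F ∪ B) 1 S →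
             Ok c F 0 (A ∷ J ∷ S) ⊎ Ok c F 0 (J ∷ B ∷ S)
      case p qJ rJJ (inj₁ qA) = inj₁ ((p , qJ) , (qA , all (⊆-trans JJ⊆ (cl-least (cl-flat _) AB⊆)) rJJ))
      case p qJ rJJ (inj₂ qB) = inj₂ ((p , qB) , (qJ , all (⊆-trans JJ⊆ (cl-least (cl-flat _) AB⊆′)) rJJ))

    ok-leaf : ∀ {c U t} S → Ok c U t S → Leaf c U t
    ok-leaf []      l        = l
    ok-leaf (A ∷ S) (ok , _) = ok-leaf S ok

    keep skip : {P : Set} → Dec P → Subset n → Word → Word
    keep (yes _) A xs = A ∷ xs
    keep (no _)  A xs = xs
    skip (yes _) A xs = xs
    skip (no _)  A xs = A ∷ xs

    inside outside : Subset n → Word → Word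
    inside G []      = []
    inside G (A ∷ m) = keep (A ⊆? G) A (inside G m)
    outside G []      = []
    outside G (A ∷ m) = skip (A ⊆? G) A (outside G m)

    inside-↭ : ∀ G {m m′} → m ↭ m′ → inside G m ↭ inside G m′
    inside-↭ G refl = refl
    inside-↭ G (trans p q) = trans (inside-↭ G p) (inside-↭ G q)
    inside-↭ G (prep A p) with A ⊆? G
    ... | yes _ = prep A (inside-↭ G p)
    ... | no _  = inside-↭ G p
    inside-↭ G (swap A B p) with A ⊆? G | B ⊆? G
    ... | yes _ | yes _ = swap A B (inside-↭ G p)
    ... | yes _ | no _  = prep A (inside-↭ G p)
    ... | no _  | yes _ = prep B (inside-↭ G p)
    ... | no _  | no _  = inside-↭ G p

    outside-↭ : ∀ G {m m′} → m ↭ m′ → outside G m ↭ outside G m′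
    outside-↭ G refl = refl
    outside-↭ G (trans p q) = trans (outside-↭ G p) (outside-↭ G q)
    outside-↭ G (prep A p) with A ⊆? G
    ... | yes _ = outside-↭ G p
    ... | no _  = prep A (outside-↭ G p)
    outside-↭ G (swap A B p) with A ⊆? G | B ⊆? G
    ... | yes _ | yes _ = outside-↭ G p
    ... | yes _ | no _  = prep B (outside-↭ G p)
    ... | no _  | yes _ = prep A (outside-↭ G p)
    ... | no _  | no _  = swap A B (outside-↭ G p)

    inside-outside : ∀ G m → m ↭ inside G m ++ outside G m
    inside-outside G []      = refl
    inside-outside G (A ∷ m) with A ⊆? G
    ... | yes _ = prep A (inside-outside G m)
    ... | no _  = ↭-trans (prep A (inside-outside G m)) (↭-sym (Perm.shift A (inside G m) (outside G m)))

    gap : ℕ → Subset n → ℕ → Word → ℚ → ℚ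
    gap a F c xs τ = ind (length xs ℕ.≟ suc a) ⊗ (ind (ok? c F 0 xs) ⊗ τ)

    -- The functional dual to a nested word G₁^{a₁} G₂^{a₂} ⋯: exactly aᵢ letters lie below Gᵢ but not
    -- below Gᵢ₋₁, and these satisfy the dragon Hall–Rado condition in the minor [Gᵢ₋₁, Gᵢ].
    Λ : ∀ {F c w} → Nested F c w → Word → ℚ
    Λ nil [] = 1ℚ
    Λ nil (_ ∷ _) = 0ℚ
    Λ {F} {c} (step {G} {a} _ _ _ N) m = gap a F c (inside G m) (Λ N (outside G m))

    private
      atom-bound : ∀ G {E} → r E ≤ 1 → s + r (G ∪ E) ≤ suc (ρ G)
      atom-bound G {E} rE≤1 = ℕP.≤-trans (ℕP.+-monoʳ-≤ s (ℕP.≤-trans (rank-∪ G E) (ℕP.+-monoʳ-≤ (r G) rE≤1)))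
        (≡⇒≤ (Eq.trans (cong (s +_) (ℕP.+-comm (r G) 1)) (ℕP.+-suc s (r G))))

      gap-0 : ∀ a F c xs → gap a F c xs 0ℚ ≡ 0ℚ
      gap-0 a F c xs = Eq.trans (cong (ind (length xs ℕ.≟ suc a) ⊗_) (QP.*-zeroʳ (ind (ok? c F 0 xs)))) (QP.*-zeroʳ (ind (length xs ℕ.≟ suc a)))

      gap-⊕ : ∀ a F c xs {τ₁ τ₂ τ₃ τ₄} → τ₁ ⊕ τ₂ ≡ τ₃ ⊕ τ₄ → gap a F c xs τ₁ ⊕ gap a F c xs τ₂ ≡ gap a F c xs τ₃ ⊕ gap a F c xs τ₄
      gap-⊕ a F c xs {τ₁} {τ₂} {τ₃} {τ₄} e = Eq.trans (factor τ₁ τ₂) (Eq.trans (cong (λ z → l ⊗ (o ⊗ z)) e) (sym (factor τ₃ τ₄)))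
        where
        l = ind (length xs ℕ.≟ suc a)
        o = ind (ok? c F 0 xs)
        factor : ∀ x y → l ⊗ (o ⊗ x) ⊕ l ⊗ (o ⊗ y) ≡ l ⊗ (o ⊗ (x ⊕ y))
        factor = solve 4 (λ l o x y → l :* (o :* x) :+ l :* (o :* y) := l :* (o :* (x :+ y))) refl l o

      gap-ok : ∀ a F c xs ys τ → length xs ≡ length ys → (Ok c F 0 xs → Ok c F 0 ys) → (Ok c F 0 ys → Ok c F 0 xs) →
               gap a F c xs τ ≡ gap a F c ys τ
      gap-ok a F c xs ys τ l i j = cong₂ _⊗_ (cong (λ z → ind (z ℕ.≟ suc a)) l) (cong (_⊗ τ) (ind-cong (ok? c F 0 xs) (ok? c F 0 ys) i j))

    Λ-symmetric : ∀ {F c w} (N : Nested F c w) → Symmetric (Λ N)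
    Λ-symmetric nil {[]}    p with refl ← Perm.↭-empty-inv (↭-sym p) = refl
    Λ-symmetric nil {A ∷ m} {[]} p = contradiction p Perm.¬x∷xs↭[]
    Λ-symmetric nil {A ∷ m} {B ∷ m′} p = refl
    Λ-symmetric {F} {c} (step {G} {a} _ _ _ N) {m} {m′} p = Eq.trans
      (gap-ok a F c (inside G m) (inside G m′) (Λ N (outside G m)) (Perm.↭-length q) (ok-perm q) (ok-perm (↭-sym q)))
      (cong (gap a F c (inside G m′)) (Λ-symmetric N (outside-↭ G p)))
      where
      q = inside-↭ G p

    -- Over the base `F` the letters `A` and `B` generate the same flat. Lying below `G` and the
    -- ranks of unions containing `F` depend on nothing else, and the hypothesis persists over the
    -- larger base `G`.
    Λ-absorb : ∀ {F c w} (N : Nested F c w) {A B} m → A ⊆ cl (F ∪ B) → B ⊆ cl (F ∪ A) → Λ N (A ∷ m) ≡ Λ N (B ∷ m)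
    Λ-absorb nil m A⊆ B⊆ = refl
    Λ-absorb {F} {c} (step {G} {a} flatG (F⊆G , _) _ N) {A} {B} m A⊆ B⊆ with A ⊆? G | B ⊆? G
    ... | yes A⊆G | yes B⊆G =
      gap-ok a F c (A ∷ inside G m) (B ∷ inside G m) (Λ N (outside G m)) refl
        (λ (p , q) → p , ok-closure (inside G m) (∪-lub (⊆-trans (p⊆p∪q B) (cl-⊇ _)) A⊆) q)
        (λ (p , q) → p , ok-closure (inside G m) (∪-lub (⊆-trans (p⊆p∪q A) (cl-⊇ _)) B⊆) q)
    ... | no _ | no _ = cong (gap a F c (inside G m)) (Λ-absorb N (outside G m) (⊆-trans A⊆ (up B)) (⊆-trans B⊆ (up A)))
      where
      up : ∀ X → cl (F ∪ X) ⊆ cl (G ∪ X)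
      up X = cl-least (cl-flat _) (⊆-trans (∪-mono F⊆G ⊆-refl) (cl-⊇ _))
    ... | yes A⊆G | no B⊈G = contradiction (λ {x} → ⊆-trans B⊆ (cl-least flatG (∪-lub F⊆G A⊆G)) {x}) B⊈G
    ... | no A⊈G | yes B⊆G = contradiction (λ {x} → ⊆-trans A⊆ (cl-least flatG (∪-lub F⊆G B⊆G)) {x}) A⊈G

    -- Below `G`, the letter alone violates the Hall-Rado condition. Otherwise it is passed on to
    -- the base `G`, where `r A ≤ 1` restores the second hypothesis.
    Λ-atom : ∀ {F c w} (N : Nested F c w) {A} m → r A ≤ 1 → s + r (F ∪ A) ≤ suc c → Λ N (A ∷ m) ≡ 0ℚ
    Λ-atom nil m _ _ = refl
    Λ-atom {F} {c} (step {G} {a} _ _ _ N) {A} m rA≤1 le with A ⊆? G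
    ... | no _ = Eq.trans (cong (gap a F c (inside G m)) (Λ-atom N (outside G m) rA≤1 (atom-bound G rA≤1))) (gap-0 a F c (inside G m))
    ... | yes _ = Eq.trans (cong (λ z → l ⊗ (z ⊗ τ)) (ind-no (ok? c F 0 (A ∷ inside G m)) not-ok))
        (Eq.trans (cong (l ⊗_) (QP.*-zeroˡ τ)) (QP.*-zeroʳ l))
      where
      l = ind (suc (length (inside G m)) ℕ.≟ suc a)
      τ = Λ N (outside G m)
      not-ok : ¬ Ok c F 0 (A ∷ inside G m)
      not-ok (_ , ok) = fails (ok-leaf (inside G m) ok)
        where
        fails : ¬ Leaf c (F ∪ A) 1
        fails (inj₂ l) = ℕP.<⇒≱ (s≤s le) l

    -- If `A` and `B` both lie below `G`, so does the join, and `ok-modular` applies. If just one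
    -- does, the other letter and the join agree over `G`, and the four terms match in pairs by
    -- `Λ-absorb`. If neither does, the relation is passed on to the base `G`.
    Λ-modular : ∀ {F c w} (N : Nested F c w) → c ≤ s + r F → ∀ A B m →
      Λ N (A ∷ B ∷ m) ⊕ Λ N (A ∨ B ∷ A ∨ B ∷ m) ≡ Λ N (A ∷ A ∨ B ∷ m) ⊕ Λ N (A ∨ B ∷ B ∷ m)
    Λ-modular nil c≤ A B m = refl
    Λ-modular {F} {c} (step {G} {a} flatG (F⊆G , _) _ N) c≤ A B m with A ⊆? G | B ⊆? G | A ∨ B ⊆? G
    ... | yes _ | yes _ | yes _ = begin
      l ⊗ (o₁ ⊗ τ) ⊕ l ⊗ (o₂ ⊗ τ)    ≡⟨ factor o₁ o₂ ⟩
      l ⊗ ((o₁ ⊕ o₂) ⊗ τ)            ≡⟨ cong (λ z → l ⊗ (z ⊗ τ)) (ok-modular A B (inside G m) c≤) ⟩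
      l ⊗ ((o₃ ⊕ o₄) ⊗ τ)            ≡⟨ factor o₃ o₄ ⟨
      l ⊗ (o₃ ⊗ τ) ⊕ l ⊗ (o₄ ⊗ τ)    ∎
      where
      open ≡-Reasoning
      l = ind (suc (suc (length (inside G m))) ℕ.≟ suc a)
      τ = Λ N (outside G m)
      o₁ = ind (ok? c F 0 (A ∷ B ∷ inside G m))
      o₂ = ind (ok? c F 0 (A ∨ B ∷ A ∨ B ∷ inside G m))
      o₃ = ind (ok? c F 0 (A ∷ A ∨ B ∷ inside G m))
      o₄ = ind (ok? c F 0 (A ∨ B ∷ B ∷ inside G m))
      factor : ∀ x y → l ⊗ (x ⊗ τ) ⊕ l ⊗ (y ⊗ τ) ≡ l ⊗ ((x ⊕ y) ⊗ τ)
      factor = solve 4 (λ l t x y → l :* (x :* t) :+ l :* (y :* t) := l :* ((x :+ y) :* t)) refl l τ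
    ... | no _ | no _ | no _ = gap-⊕ a F c (inside G m) (Λ-modular N ℕP.≤-refl A B (outside G m))
    ... | yes A⊆G | no _ | no _ = cong₂ _⊕_
      (cong (gap a F c (A ∷ inside G m)) (Λ-absorb N (outside G m) B⊆ J⊆))
      (cong (gap a F c (inside G m)) (Eq.trans (Λ-symmetric N (swap _ _ refl)) (Eq.trans (sym (Λ-absorb N (J ∷ outside G m) B⊆ J⊆)) (Λ-symmetric N (swap _ _ refl)))))
      where
      J = A ∨ B
      B⊆ : B ⊆ cl (G ∪ J)
      B⊆ = ⊆-trans (∨-right A B) (⊆-trans (q⊆p∪q G J) (cl-⊇ _))
      J⊆ : J ⊆ cl (G ∪ B)
      J⊆ = cl-least (cl-flat _) (⊆-trans (∪-mono A⊆G ⊆-refl) (cl-⊇ _))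
    ... | no _ | yes B⊆G | no _ = Eq.trans (QP.+-comm (gap a F c (B ∷ inside G m) (Λ N (A ∷ outside G m))) _) (cong₂ _⊕_
      (cong (gap a F c (inside G m)) (Λ-absorb N (J ∷ outside G m) J⊆ A⊆))
      (cong (gap a F c (B ∷ inside G m)) (Λ-absorb N (outside G m) A⊆ J⊆)))
      where
      J = A ∨ B
      A⊆ : A ⊆ cl (G ∪ J)
      A⊆ = ⊆-trans (∨-left A B) (⊆-trans (q⊆p∪q G J) (cl-⊇ _))
      J⊆ : J ⊆ cl (G ∪ A)
      J⊆ = cl-least (cl-flat _) (⊆-trans (∪-lub (q⊆p∪q G A) (⊆-trans B⊆G (p⊆p∪q A))) (cl-⊇ _))
    ... | no A⊈G | _ | yes J⊆G = contradiction (λ {x} → ⊆-trans (∨-left A B) J⊆G {x}) A⊈G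
    ... | yes _ | no B⊈G | yes J⊆G = contradiction (λ {x} → ⊆-trans (∨-right A B) J⊆G {x}) B⊈G
    ... | yes A⊆G | yes B⊆G | no J⊈G = contradiction (λ {x} → ∨-least {A} {B} flatG A⊆G B⊆G {x}) J⊈G

    -- For `E = cl e` this serves the relation `y_e x_F = 0`, because `y_e = h_E` and
    -- `h_{A ∨ E} − h_A` is the sum of the `x_F` with `F ⊇ A` and `e ∉ F`. When `E` is not below the
    -- first flat `G`, both sides vanish by `Λ-atom`.
    Λ-extend : ∀ {w} (N : Nested ⊥ 0 w) {E A} m → r E ≤ 1 → Λ N (E ∷ A ∷ m) ≡ Λ N (E ∷ A ∨ E ∷ m)
    Λ-extend nil m _ = refl
    Λ-extend (step {G} {a} flatG _ _ N) {E} {A} m rE≤1 with E ⊆? G | A ⊆? G | A ∨ E ⊆? G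
    ... | yes _ | yes _ | yes _ = gap-ok a ⊥ 0 (E ∷ A ∷ S) (E ∷ A ∨ E ∷ S) (Λ N (outside G m)) refl
      (λ ((p , qA) , (qE , rr)) → (p , ok-mono S (λ X → rank-∪-≤ X (∪-mono ⊆-refl (∨-left A E))) qA) ,
        (qE , ok-mono S (λ X → rank-∪-≤ X (∪-mono ⊆-refl (∨-left A E))) rr))
      (λ ((p , _) , (qE , rr)) → (p , ok-transfer S drop rr) , (qE , ok-closure S J⊆ rr))
      where
      S = inside G m
      J = A ∨ E
      J⊆ : (⊥ ∪ E) ∪ J ⊆ cl ((⊥ ∪ E) ∪ A)
      J⊆ = ∪-lub (⊆-trans (p⊆p∪q A) (cl-⊇ _)) (∨-least (cl-flat _) (⊆-trans (q⊆p∪q _ A) (cl-⊇ _))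
        (⊆-trans (⊆-trans (q⊆p∪q ⊥ E) (p⊆p∪q A)) (cl-⊇ _)))
      -- Discarding `E` removes one member from the family and at most one from the rank, so the
      -- inequality survives with 1 in place of 2.
      drop : ∀ X u → Leaf 0 (((⊥ ∪ E) ∪ J) ∪ X) (u + 2) → Leaf 0 ((⊥ ∪ A) ∪ X) (u + 1)
      drop X u (inj₁ e) = contradiction (Eq.trans (sym (ℕP.+-suc u 1)) e) λ ()
      drop X u (inj₂ l) = inj₂ (ℕP.≤-pred (begin
        suc (u + 1 + 1)                     ≡⟨ cong (_+ 1) (ℕP.+-suc u 1) ⟨
        u + 2 + 1                           ≤⟨ l ⟩
        s + r (((⊥ ∪ E) ∪ J) ∪ X)           ≤⟨ ℕP.+-monoʳ-≤ s (rank-within X J⊆) ⟩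
        s + r (((⊥ ∪ E) ∪ A) ∪ X)           ≤⟨ ℕP.+-monoʳ-≤ s (rank-mono M (∪-lub (∪-lub (∪-lub (⊆-min _) (p⊆p∪q _)) (⊆-trans (⊆-trans (q⊆p∪q ⊥ A) (p⊆p∪q X)) (q⊆p∪q E _))) (⊆-trans (q⊆p∪q _ X) (q⊆p∪q E _)))) ⟩
        s + r (E ∪ ((⊥ ∪ A) ∪ X))           ≤⟨ ℕP.+-monoʳ-≤ s (ℕP.≤-trans (rank-∪ E _) (ℕP.+-monoˡ-≤ (r ((⊥ ∪ A) ∪ X)) rE≤1)) ⟩
        s + suc (r ((⊥ ∪ A) ∪ X))           ≡⟨ ℕP.+-suc s _ ⟩
        suc (s + r ((⊥ ∪ A) ∪ X))           ∎))
        where open ℕP.≤-Reasoning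
    ... | yes E⊆G | no _ | no _ = cong (gap a ⊥ 0 (E ∷ inside G m)) (Λ-absorb N (outside G m)
      (⊆-trans (∨-left A E) (⊆-trans (q⊆p∪q G _) (cl-⊇ _)))
      (cl-least (cl-flat _) (⊆-trans (∪-lub (q⊆p∪q G A) (⊆-trans E⊆G (p⊆p∪q A))) (cl-⊇ _))))
    ... | no E⊈G | yes _ | no _ = Eq.trans
      (Eq.trans (cong (gap a ⊥ 0 (A ∷ inside G m)) (Λ-atom N (outside G m) rE≤1 (atom-bound G rE≤1))) (gap-0 a ⊥ 0 (A ∷ inside G m)))
      (sym (Eq.trans (cong (gap a ⊥ 0 (inside G m)) (Λ-atom N (A ∨ E ∷ outside G m) rE≤1 (atom-bound G rE≤1))) (gap-0 a ⊥ 0 (inside G m))))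
    ... | no E⊈G | no _ | no _ = Eq.trans
      (Eq.trans (cong (gap a ⊥ 0 (inside G m)) (Λ-atom N (A ∷ outside G m) rE≤1 (atom-bound G rE≤1))) (gap-0 a ⊥ 0 (inside G m)))
      (sym (Eq.trans (cong (gap a ⊥ 0 (inside G m)) (Λ-atom N (A ∨ E ∷ outside G m) rE≤1 (atom-bound G rE≤1))) (gap-0 a ⊥ 0 (inside G m))))
    ... | no E⊈G | _ | yes J⊆G = contradiction (λ {x} → ⊆-trans (∨-right A E) J⊆G {x}) E⊈G
    ... | yes _ | no A⊈G | yes J⊆G = contradiction (λ {x} → ⊆-trans (∨-left A E) J⊆G {x}) A⊈G
    ... | yes E⊆G | yes A⊆G | no J⊈G = contradiction (λ {x} → ∨-least {A} {E} flatG A⊆G E⊆G {x}) J⊈G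

    nested-above : ∀ {F c w} → Nested F c w → All (Above F) w
    nested-above nil = []
    nested-above {F} (step {G} {a} _ (F⊆G , G⊈F) _ N) = AllP.++⁺ (AllP.replicate⁺ (suc a) (F⊆G , G⊈F))
      (All.map up (nested-above N))
      where
      up : ∀ {A} → Above G A → Above F A
      up (G⊆A , A⊈G) = ⊆-trans F⊆G G⊆A , λ A⊆F → A⊈G (⊆-trans A⊆F F⊆G)

    private
      inside-none : ∀ G w → All (Above G) w → inside G w ≡ [] × outside G w ≡ w
      inside-none G [] [] = refl , refl
      inside-none G (A ∷ w) ((_ , A⊈G) ∷ as) with A ⊆? G
      ... | yes A⊆G = contradiction (λ {x} → A⊆G {x}) A⊈G
      ... | no _ with e , e′ ← inside-none G w as = e , cong (A ∷_) e′

      inside-powers : ∀ G w → All (Above G) w → ∀ k → inside G (replicate k G ++ w) ≡ replicate k G × outside G (replicate k G ++ w) ≡ w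
      inside-powers G w as zero = inside-none G w as
      inside-powers G w as (suc k) with G ⊆? G
      ... | no G⊈G = contradiction (λ {x} → ⊆-refl {x = G} {x}) G⊈G
      ... | yes _ with e , e′ ← inside-powers G w as k = cong (G ∷_) e , e′

      ok-powers : ∀ {c} G k U t → t ≡ 0 ⊎ G ⊆ U → k + t + suc c ≤ ρ G → Ok c U t (replicate k G)
      ok-powers G zero    U t (inj₁ e)   room = inj₁ e
      ok-powers G zero    U t (inj₂ G⊆U) room = inj₂ (ℕP.≤-trans room (ℕP.+-monoʳ-≤ s (rank-mono M G⊆U)))
      ok-powers {c} G (suc k) U t h room = ok-powers G k U t h (ℕP.≤-trans (ℕP.n≤1+n _) room) ,
        ok-powers G k (U ∪ G) (suc t) (inj₂ (q⊆p∪q U G)) (subst (_≤ ρ G) (cong (_+ suc c) (sym (ℕP.+-suc k t))) room)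

    Λ-self : ∀ {F c w} (N : Nested F c w) → Λ N w ≡ 1ℚ
    Λ-self nil = refl
    Λ-self {F} {c} (step {G} {a} {w} _ _ room N) with e , e′ ← inside-powers G w (nested-above N) (suc a) =
      Eq.trans (cong₂ (λ xs ys → gap a F c xs (Λ N ys)) e e′)
        (cong₂ _⊗_ (ind-yes (length (replicate (suc a) G) ℕ.≟ suc a) (ListP.length-replicate (suc a)))
          (cong₂ _⊗_ (ind-yes (ok? c F 0 (replicate (suc a) G)) (ok-powers G (suc a) F 0 (inj₁ refl) (subst (λ z → z + suc c ≤ ρ G) (sym (ℕP.+-identityʳ (suc a))) room))) (Λ-self N)))

    private
      inside-⊆ : ∀ G m → All (_⊆ G) (inside G m)
      inside-⊆ G [] = []
      inside-⊆ G (A ∷ m) with A ⊆? G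
      ... | yes A⊆G = A⊆G ∷ inside-⊆ G m
      ... | no _    = inside-⊆ G m

      rsum-below : ∀ G xs → All (_⊆ G) xs → rsum xs ≤ length xs * r G
      rsum-below G [] [] = z≤n
      rsum-below G (A ∷ xs) (A⊆G ∷ as) = ℕP.+-mono-≤ (rank-mono M A⊆G) (rsum-below G xs as)

      sum-tight : ∀ {x y X Y} → x ≤ X → y ≤ Y → x + y ≡ X + Y → x ≡ X × y ≡ Y
      sum-tight {x} {y} {X} {Y} x≤X y≤Y e = x≡X , ℕP.+-cancelˡ-≡ X y Y (subst (λ z → z + y ≡ X + Y) x≡X e)
        where
        x≡X : x ≡ X
        x≡X = ℕP.≤-antisym x≤X (ℕP.+-cancelʳ-≤ Y X x (ℕP.≤-trans (ℕP.≤-reflexive (sym e)) (ℕP.+-monoʳ-≤ x y≤Y)))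

      rsum-tight : ∀ G xs → All (_⊆ G) xs → All Flat xs → rsum xs ≡ length xs * r G → xs ≡ replicate (length xs) G
      rsum-tight G [] [] [] e = refl
      rsum-tight G (A ∷ xs) (A⊆G ∷ as) (flat ∷ fs) e
        with e₁ , e₂ ← sum-tight (rank-mono M A⊆G) (rsum-below G xs as) e =
        cong₂ _∷_ (flat-rank-≡ flat A⊆G (≡⇒≤ (sym e₁))) (rsum-tight G xs as fs e₂)

      rsum-replicate : ∀ k G → rsum (replicate k G) ≡ k * r G
      rsum-replicate zero    G = refl
      rsum-replicate (suc k) G = cong (r G +_) (rsum-replicate k G)

      ind≢0 : ∀ {P : Set} (d : Dec P) {x} → ind d ⊗ x ≢ 0ℚ → P × x ≢ 0ℚ
      ind≢0 (yes p) {x} ne = p , λ e → ne (Eq.trans (QP.*-identityˡ x) e)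
      ind≢0 (no _)  {x} ne = contradiction (QP.*-zeroˡ x) ne

    -- A nonzero value puts exactly `suc a` letters below `G`, each of rank at most that of `G`. If
    -- the total is attained, each of these letters is a flat below `G` of the same rank, hence `G`
    -- itself.
    Λ-triangular : ∀ {F c w} (N : Nested F c w) m → All Flat m → Λ N m ≢ 0ℚ → rsum m ≤ rsum w × (rsum m ≡ rsum w → m ↭ w)
    Λ-triangular nil [] fs ne = z≤n , λ _ → refl
    Λ-triangular nil (A ∷ m) fs ne = contradiction refl ne
    Λ-triangular {F} {c} (step {G} {a} {w} _ _ _ N) m fs ne
      with len , ne₁ ← ind≢0 (length (inside G m) ℕ.≟ suc a) ne with _ , ne₂ ← ind≢0 (ok? c F 0 (inside G m)) ne₁
      with le , tight ← Λ-triangular N (outside G m) (AllP.++⁻ʳ (inside G m) (Perm.All-resp-↭ (inside-outside G m) fs)) ne₂ =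
      subst₂ _≤_ (sym m-sum) (sym w-sum) (ℕP.+-mono-≤ in-le le) ,
      λ e → let e₁ , e₂ = sum-tight in-le le (Eq.trans (sym m-sum) (Eq.trans e w-sum)) in
        ↭-trans (inside-outside G m) (Perm.++⁺ (↭-reflexive (Eq.trans
          (rsum-tight G (inside G m) (inside-⊆ G m) (AllP.++⁻ˡ (inside G m) (Perm.All-resp-↭ (inside-outside G m) fs)) (Eq.trans e₁ (cong (_* r G) (sym len))))
          (cong (λ k → replicate k G) len))) (tight e₂))
      where
      m-sum : rsum m ≡ rsum (inside G m) + rsum (outside G m)
      m-sum = Eq.trans (rsum-↭ (inside-outside G m)) (rsum-++ (inside G m) (outside G m))
      w-sum : rsum (replicate (suc a) G ++ w) ≡ suc a * r G + rsum w
      w-sum = Eq.trans (rsum-++ (replicate (suc a) G) w) (cong (_+ rsum w) (rsum-replicate (suc a) G))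
      in-le : rsum (inside G m) ≤ suc a * r G
      in-le = subst (λ k → rsum (inside G m) ≤ k * r G) len (rsum-below G (inside G m) (inside-⊆ G m))

    nested-sorted : ∀ {F c w} → Nested F c w → AllPairs _⊆_ w
    nested-sorted nil = []
    nested-sorted (step {G} {a} {w} _ _ _ N) = sorted (suc a)
      where
      ⊇G : ∀ k → All (G ⊆_) (replicate k G ++ w)
      ⊇G k = AllP.++⁺ (AllP.replicate⁺ k (λ {x} → ⊆-refl {x = G} {x})) (All.map proj₁ (nested-above N))
      sorted : ∀ k → AllPairs _⊆_ (replicate k G ++ w)
      sorted zero    = nested-sorted N
      sorted (suc k) = ⊇G k ∷ sorted k

    -- Each head is contained in every letter of its own word, so the two heads contain each other.
    -- For nested words this turns the permutation of the tight case into an equality.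
    sorted-unique : ∀ {u v : Word} → AllPairs _⊆_ u → AllPairs _⊆_ v → u ↭ v → u ≡ v
    sorted-unique {[]} {v} [] _ p = sym (Perm.↭-empty-inv (↭-sym p))
    sorted-unique {A ∷ u} {[]} _ _ p = contradiction p Perm.¬x∷xs↭[]
    sorted-unique {A ∷ u} {B ∷ v} (a ∷ as) (b ∷ bs) p = finish A≡B
      where
      A⊆B : A ⊆ B
      A⊆B with Perm.∈-resp-↭ (↭-sym p) (here refl)
      ... | here refl = ⊆-refl
      ... | there i   = All.lookup a i
      B⊆A : B ⊆ A
      B⊆A with Perm.∈-resp-↭ p (here refl)
      ... | here refl = ⊆-refl
      ... | there i   = All.lookup b i
      A≡B : A ≡ B
      A≡B = ⊆-antisym A⊆B B⊆A
      finish : A ≡ B → A ∷ u ≡ B ∷ v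
      finish refl = cong (A ∷_) (sorted-unique as bs (Perm.drop-∷ p))

-- Möbius inversion on the lattice of flats and Weisner's theorem.

module Moebius where

  open Sums
  open Flats
  open import Data.Nat using (zero; suc)
  open import Data.List.Membership.Propositional using (_∈_)
  open import Relation.Binary.PropositionalEquality using (trans)

  open +-*-Solver

  module MoebiusInversion {n : ℕ} (M : Matroid n) where

    open FlatLattice M

    private
      r = rank M

      above-sound : ∀ {F G} → G ∈ above F → Flat G × Above F G
      above-sound {F} i with j , a ← ∈-filter⁻ (above? F) {xs = flats} i = flats-flat j , a

      mu : ℕ → Subset n → Subset n → ℚ
      mu zero    F G = 0ℚ
      mu (suc f) F G = ⊖ ind (F ≟S G) ⊝ ∑ (above F) (λ H → mu f H G)

      mu-fuel : ∀ f f′ {F} → Flat F → rk M < f + r F → rk M < f′ + r F → ∀ G → mu f F G ≡ mu f′ F G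
      mu-fuel zero    f′ {F} flat lt lt′ G = contradiction (rank-mono M (⊆-max F)) (ℕP.<⇒≱ lt)
      mu-fuel (suc f) zero {F} flat lt lt′ G = contradiction (rank-mono M (⊆-max F)) (ℕP.<⇒≱ lt′)
      mu-fuel (suc f) (suc f′) {F} flat lt lt′ G = cong (⊖ ind (F ≟S G) ⊝_) (∑-cong-∈ (above F) (λ {H} i →
        let flatH , F⊆H , H⊈F = above-sound i
            next = λ f → subst (_≤ f + r H) (ℕP.+-suc f (r F)) (ℕP.+-monoʳ-≤ f (flat-rank-< flat F⊆H H⊈F)) in
        mu-fuel f f′ flatH (ℕP.<-≤-trans lt (next f)) (ℕP.<-≤-trans lt′ (next f′)) G))

      mu-support : ∀ f {F G} → ¬ (F ⊆ G) → mu f F G ≡ 0ℚ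
      mu-support zero    F⊈G = refl
      mu-support (suc f) {F} {G} F⊈G = cong₂ (λ a b → ⊖ a ⊝ b) (ind-no (F ≟S G) (λ { refl → F⊈G ⊆-refl }))
        (∑-zero-∈ (above F) (λ {H} i → mu-support f (λ H⊆G → F⊈G (⊆-trans (proj₁ (proj₂ (above-sound i))) H⊆G))))

    -- Minus the Möbius function of the lattice of flats.
    μ : Subset n → Subset n → ℚ
    μ = mu (suc (rk M))

    μ-support : ∀ {F G} → ¬ (F ⊆ G) → μ F G ≡ 0ℚ
    μ-support = mu-support (suc (rk M))

    μ-eq : ∀ {F} → Flat F → ∀ G → μ F G ≡ ⊖ ind (F ≟S G) ⊝ ∑ (above F) (λ H → μ H G)
    μ-eq {F} flat G = cong (⊖ ind (F ≟S G) ⊝_) (∑-cong-∈ (above F) (λ {H} i →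
      let flatH , F⊆H , H⊈F = above-sound i
          1≤rH = ℕP.≤-trans (s≤s z≤n) (flat-rank-< flat F⊆H H⊈F) in
      mu-fuel (rk M) (suc (rk M)) flatH (ℕP.m<m+n (rk M) 1≤rH) (s≤s (ℕP.m≤m+n (rk M) _)) G))

    -- The value at `x_F` of the functional with value `g G` at `h_G`. The sign built into `μ`
    -- answers the minus sign before the sum over `F ⊇ A` in `h_A`.
    ∂ : (Subset n → ℚ) → Subset n → ℚ
    ∂ g F = ∑ flats (λ G → μ F G ⊗ g G)

    pick-flat : ∀ {F} → Flat F → ∀ (g : Subset n → ℚ) → ∑ flats (λ G → ind (F ≟S G) ⊗ g G) ≡ g F
    pick-flat {F} flat g = trans (∑-pick _ flats-unique (∈-flats flat)
        (λ {G} _ G≢F → trans (cong (_⊗ g G) (ind-no (F ≟S G) (G≢F ∘ sym))) (QP.*-zeroˡ (g G))))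
      (trans (cong (_⊗ g F) (ind-yes (F ≟S F) refl)) (QP.*-identityˡ (g F)))

    ∂-eq : ∀ {F} → Flat F → ∀ g → ∂ g F ≡ ⊖ g F ⊝ ∑ (above F) (∂ g)
    ∂-eq {F} flat g = begin
      ∑ flats (λ G → μ F G ⊗ g G)
        ≡⟨ ∑-cong flats (λ G → trans (cong (_⊗ g G) (μ-eq flat G))
             (solve 3 (λ a b c → (:- a :- b) :* c := (:- (a :* c)) :- b :* c) refl (ind (F ≟S G)) (∑ (above F) (λ H → μ H G)) (g G))) ⟩
      ∑ flats (λ G → ⊖ (ind (F ≟S G) ⊗ g G) ⊝ ∑ (above F) (λ H → μ H G) ⊗ g G)
        ≡⟨ ∑-⊝ flats _ _ ⟩
      ∑ flats (λ G → ⊖ (ind (F ≟S G) ⊗ g G)) ⊝ ∑ flats (λ G → ∑ (above F) (λ H → μ H G) ⊗ g G)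
        ≡⟨ cong₂ _⊝_ (trans (∑-⊖ flats _) (cong ⊖_ (pick-flat flat g)))
             (trans (∑-cong flats (λ G → sym (∑-⊗ʳ (above F) (g G) _))) (∑-swap flats (above F) _)) ⟩
      ⊖ g F ⊝ ∑ (above F) (∂ g) ∎
      where open ≡-Reasoning

    ∂-sum : ∀ {A} → Flat A → ∀ g → ∑ flats (λ H → ind (A ⊆? H) ⊗ ∂ g H) ≡ ⊖ g A
    ∂-sum {A} flat g = begin
      ∑ flats (λ H → ind (A ⊆? H) ⊗ ∂ g H)
        ≡⟨ ∑-cong flats split ⟩
      ∑ flats (λ H → ind (A ≟S H) ⊗ ∂ g H ⊕ ind (above? A H) ⊗ ∂ g H)
        ≡⟨ ∑-⊕ flats _ _ ⟩
      ∑ flats (λ H → ind (A ≟S H) ⊗ ∂ g H) ⊕ ∑ flats (λ H → ind (above? A H) ⊗ ∂ g H)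
        ≡⟨ cong₂ _⊕_ (trans (pick-flat flat (∂ g)) (∂-eq flat g)) (sym (∑-filter (above? A) flats (∂ g))) ⟩
      ⊖ g A ⊝ ∑ (above A) (∂ g) ⊕ ∑ (above A) (∂ g)
        ≡⟨ solve 2 (λ a b → a :- b :+ b := a) refl (⊖ g A) (∑ (above A) (∂ g)) ⟩
      ⊖ g A ∎
      where
      open ≡-Reasoning
      split : ∀ H → ind (A ⊆? H) ⊗ ∂ g H ≡ ind (A ≟S H) ⊗ ∂ g H ⊕ ind (above? A H) ⊗ ∂ g H
      split H = trans (cong (_⊗ ∂ g H) (go (A ≟S H))) (QP.*-distribʳ-+ (∂ g H) (ind (A ≟S H)) (ind (above? A H)))
        where
        go : (d : Dec (A ≡ H)) → ind (A ⊆? H) ≡ ind d ⊕ ind (above? A H)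
        go (yes refl) = trans (ind-yes (A ⊆? A) ⊆-refl) (cong (1ℚ ⊕_) (sym (ind-no (above? A A) (λ (_ , ⊈) → ⊈ ⊆-refl))))
        go (no A≢H) = trans (ind-cong (A ⊆? H) (above? A H) (λ A⊆H → A⊆H , λ H⊆A → A≢H (⊆-antisym A⊆H H⊆A)) proj₁)
          (sym (QP.+-identityˡ _))

    -- Weisner's theorem in dual form. The sums of `∂ g` over the flats above `G` and above `A ∨ G`
    -- agree, as `g G = g (A ∨ G)`. They differ by the flats above `G` that do not contain `A`; by
    -- descending induction on rank only `G` is left of these.
    weisner : ∀ {A} g → (∀ {B} → Flat B → g B ≡ g (A ∨ B)) → ∀ {G} → Flat G → ¬ (A ⊆ G) → ∂ g G ≡ 0ℚ
    weisner {A} g inv = go (rk M) (ℕP.m≤m+n (rk M) _)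
      where
      go : ∀ d {G} → rk M ≤ d + r G → Flat G → ¬ (A ⊆ G) → ∂ g G ≡ 0ℚ
      go d {G} le flat A⊈G = begin
        ∂ g G
          ≡⟨ trans (cong (_⊗ ∂ g G) (cong₂ _⊝_ (ind-yes (G ⊆? G) ⊆-refl)
               (ind-no (A ∨ G ⊆? G) (λ J⊆G → A⊈G (⊆-trans (∨-left A G) J⊆G))))) (QP.*-identityˡ (∂ g G)) ⟨
        (ind (G ⊆? G) ⊝ ind (A ∨ G ⊆? G)) ⊗ ∂ g G
          ≡⟨ ∑-pick _ flats-unique (∈-flats flat) (λ {H} i H≢G → vanish H (flats-flat i) H≢G (G ⊆? H) (A ⊆? H)) ⟨
        ∑ flats (λ H → (ind (G ⊆? H) ⊝ ind (A ∨ G ⊆? H)) ⊗ ∂ g H)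
          ≡⟨ ∑-cong flats (λ H → solve 3 (λ a b c → (a :- b) :* c := a :* c :- b :* c) refl (ind (G ⊆? H)) (ind (A ∨ G ⊆? H)) (∂ g H)) ⟩
        ∑ flats (λ H → ind (G ⊆? H) ⊗ ∂ g H ⊝ ind (A ∨ G ⊆? H) ⊗ ∂ g H)
          ≡⟨ ∑-⊝ flats _ _ ⟩
        ∑ flats (λ H → ind (G ⊆? H) ⊗ ∂ g H) ⊝ ∑ flats (λ H → ind (A ∨ G ⊆? H) ⊗ ∂ g H)
          ≡⟨ cong₂ _⊝_ (trans (∂-sum flat g) (cong ⊖_ (inv flat))) (∂-sum (cl-flat _) g) ⟩
        ⊖ g (A ∨ G) ⊝ ⊖ g (A ∨ G)
          ≡⟨ QP.+-inverseʳ (⊖ g (A ∨ G)) ⟩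
        0ℚ ∎
        where
        open ≡-Reasoning
        zero-coeff : ∀ {a b} x → a ≡ b → (a ⊝ b) ⊗ x ≡ 0ℚ
        zero-coeff {a} x refl = trans (cong (_⊗ x) (QP.+-inverseʳ a)) (QP.*-zeroˡ x)
        larger : ∀ d H → rk M ≤ d + r G → Flat H → r G < r H → ¬ (A ⊆ H) → ∂ g H ≡ 0ℚ
        larger zero    H le flatH lt A⊈H = contradiction (ℕP.≤-trans (rank-mono M (⊆-max H)) le) (ℕP.<⇒≱ lt)
        larger (suc d) H le flatH lt A⊈H = go d (ℕP.≤-trans le (subst (_≤ d + r H) (ℕP.+-suc d (r G)) (ℕP.+-monoʳ-≤ d lt))) flatH A⊈H
        vanish : ∀ H → Flat H → H ≢ G → Dec (G ⊆ H) → Dec (A ⊆ H) → (ind (G ⊆? H) ⊝ ind (A ∨ G ⊆? H)) ⊗ ∂ g H ≡ 0ℚ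
        vanish H flatH H≢G (no G⊈H) _ = zero-coeff (∂ g H) (ind-cong (G ⊆? H) (A ∨ G ⊆? H)
          (λ G⊆H → contradiction (λ {x} → G⊆H {x}) G⊈H) (λ J⊆H → ⊆-trans (∨-right A G) J⊆H))
        vanish H flatH H≢G (yes G⊆H) (yes A⊆H) = zero-coeff (∂ g H) (ind-cong (G ⊆? H) (A ∨ G ⊆? H)
          (λ _ → ∨-least flatH A⊆H G⊆H) (λ _ → G⊆H))
        vanish H flatH H≢G (yes G⊆H) (no A⊈H) = trans (cong ((ind (G ⊆? H) ⊝ ind (A ∨ G ⊆? H)) ⊗_)
          (larger d H le flatH (flat-rank-< flat G⊆H (λ H⊆G → H≢G (⊆-antisym H⊆G G⊆H))) A⊈H)) (QP.*-zeroʳ (ind (G ⊆? H) ⊝ ind (A ∨ G ⊆? H)))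

    ∨-comm : ∀ A B → A ∨ B ≡ B ∨ A
    ∨-comm A B = cong cl (∪-comm A B)

    ∨-absorb : ∀ A B → A ∨ (A ∨ B) ≡ A ∨ B
    ∨-absorb A B = ⊆-antisym (∨-least (cl-flat _) (∨-left A B) ⊆-refl) (∨-right A (A ∨ B))

    -- In terms of h_A = −Σ_{F ⊇ A} x_F, this says that x_F x_G = 0 follows from (h_A − h_{A∨B})(h_B − h_{A∨B}) = 0.
    ∂∂-incomparable : ∀ (Φ : Subset n → Subset n → ℚ) → (∀ A B → Φ A B ⊕ Φ (A ∨ B) (A ∨ B) ≡ Φ A (A ∨ B) ⊕ Φ (A ∨ B) B) →
      ∀ {F G} → Flat F → Flat G → Incomparable F G → ∂ (λ A → ∂ (Φ A) G) F ≡ 0ℚ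
    ∂∂-incomparable Φ modular {F} {G} flatF flatG (F⊈G , G⊈F) = begin
      ∑ flats (λ A → μ F A ⊗ ∂ (Φ A) G)
        ≡⟨ ∑-cong-∈ flats (λ {A} i → term A (F ⊆? A)) ⟩
      ∑ flats (λ A → μ F A ⊗ ∂ (λ B → Φ (A ∨ B) B) G)
        ≡⟨ ∑-cong flats (λ A → sym (∑-⊗ˡ flats (μ F A) _)) ⟩
      ∑ flats (λ A → ∑ flats (λ B → μ F A ⊗ (μ G B ⊗ Φ (A ∨ B) B)))
        ≡⟨ ∑-swap flats flats _ ⟩
      ∑ flats (λ B → ∑ flats (λ A → μ F A ⊗ (μ G B ⊗ Φ (A ∨ B) B)))
        ≡⟨ ∑-cong flats (λ B → trans (∑-cong flats (λ A →
             solve 3 (λ a b c → a :* (b :* c) := b :* (a :* c)) refl (μ F A) (μ G B) (Φ (A ∨ B) B))) (∑-⊗ˡ flats (μ G B) _)) ⟩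
      ∑ flats (λ B → μ G B ⊗ ∂ (λ A → Φ (A ∨ B) B) F)
        ≡⟨ ∑-zero flats (λ B → other B (G ⊆? B)) ⟩
      0ℚ ∎
      where
      open ≡-Reasoning
      other : ∀ B → Dec (G ⊆ B) → μ G B ⊗ ∂ (λ A → Φ (A ∨ B) B) F ≡ 0ℚ
      other B (no G⊈B) = trans (cong (_⊗ ∂ (λ A → Φ (A ∨ B) B) F) (μ-support G⊈B)) (QP.*-zeroˡ (∂ (λ A → Φ (A ∨ B) B) F))
      other B (yes G⊆B) = trans (cong (μ G B ⊗_) (weisner {B} (λ A → Φ (A ∨ B) B)
        (λ {A} _ → cong (λ J → Φ J B) (trans (∨-comm A B) (trans (sym (∨-absorb B A)) (∨-comm B (B ∨ A)))))
        flatF (λ B⊆F → G⊈F (⊆-trans G⊆B B⊆F)))) (QP.*-zeroʳ (μ G B))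
      term : ∀ A → Dec (F ⊆ A) → μ F A ⊗ ∂ (Φ A) G ≡ μ F A ⊗ ∂ (λ B → Φ (A ∨ B) B) G
      term A (no F⊈A) = trans (cong (_⊗ ∂ (Φ A) G) (μ-support F⊈A)) (trans (QP.*-zeroˡ (∂ (Φ A) G))
        (sym (trans (cong (_⊗ ∂ (λ B → Φ (A ∨ B) B) G) (μ-support F⊈A)) (QP.*-zeroˡ (∂ (λ B → Φ (A ∨ B) B) G)))))
      -- Two terms of the modular relation depend on `B` only through `A ∨ B`. As `A ⊇ F` is not
      -- below `G`, Weisner's theorem removes them and leaves `Φ (A ∨ B) B`.
      term A (yes F⊆A) = cong (μ F A ⊗_) (begin
        ∂ (Φ A) G
          ≡⟨ ∑-cong flats (λ B → trans (cong (μ G B ⊗_) (expand B))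
               (solve 4 (λ m a b c → m :* (a :+ b :- c) := m :* a :+ m :* b :- m :* c) refl (μ G B) (Φ A (A ∨ B)) (Φ (A ∨ B) B) (Φ (A ∨ B) (A ∨ B)))) ⟩
        ∑ flats (λ B → μ G B ⊗ Φ A (A ∨ B) ⊕ μ G B ⊗ Φ (A ∨ B) B ⊝ μ G B ⊗ Φ (A ∨ B) (A ∨ B))
          ≡⟨ trans (∑-⊝ flats _ _) (cong (_⊝ ∂ (λ B → Φ (A ∨ B) (A ∨ B)) G) (∑-⊕ flats _ _)) ⟩
        ∂ (λ B → Φ A (A ∨ B)) G ⊕ ∂ (λ B → Φ (A ∨ B) B) G ⊝ ∂ (λ B → Φ (A ∨ B) (A ∨ B)) G
          ≡⟨ cong₂ (λ a b → a ⊕ ∂ (λ B → Φ (A ∨ B) B) G ⊝ b)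
               (weisner {A} (λ B → Φ A (A ∨ B)) (λ {B} _ → cong (Φ A) (sym (∨-absorb A B))) flatG A⊈G)
               (weisner {A} (λ B → Φ (A ∨ B) (A ∨ B)) (λ {B} _ → cong (λ J → Φ J J) (sym (∨-absorb A B))) flatG A⊈G) ⟩
        0ℚ ⊕ ∂ (λ B → Φ (A ∨ B) B) G ⊝ 0ℚ
          ≡⟨ solve 1 (λ a → con 0ℚ :+ a :- con 0ℚ := a) refl (∂ (λ B → Φ (A ∨ B) B) G) ⟩
        ∂ (λ B → Φ (A ∨ B) B) G ∎)
        where
        A⊈G : ¬ (A ⊆ G)
        A⊈G A⊆G = F⊈G (⊆-trans F⊆A A⊆G)
        expand : ∀ B → Φ A B ≡ Φ A (A ∨ B) ⊕ Φ (A ∨ B) B ⊝ Φ (A ∨ B) (A ∨ B)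
        expand B = trans (solve 2 (λ a b → a := a :+ b :- b) refl (Φ A B) (Φ (A ∨ B) (A ∨ B)))
          (cong (_⊝ Φ (A ∨ B) (A ∨ B)) (modular A B))

-- The linear forms `h_A` and the relations between them.

module Forms where

  open Sums
  open Flats
  open NestedWords
  open Multilinear
  open Spanning
  open HallRado
  open Moebius
  open import Data.Nat using (zero; suc)
  open import Data.Fin using (zero; suc)
  open import Data.Fin.Subset using (⊤; _∈_)
  open import Data.List.Membership.Propositional.Properties using (∈-lookup)
  open import Data.List.Relation.Unary.All using ([]; _∷_)
  open import Data.List.Relation.Binary.Permutation.Propositional using (refl)
  open import Relation.Binary.Definitions using (DecidableEquality)
  open import Relation.Binary.PropositionalEquality using (trans)

  open +-*-Solver

  ∑-restrict : ∀ {A : Set} (_≟_ : DecidableEquality A) {L L′ : List A} → Unique L → Unique L′ → (∀ {x} → x ∈ˡ L → x ∈ˡ L′) →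
    ∀ φ → (∀ {x} → x ∈ˡ L′ → ¬ (x ∈ˡ L) → φ x ≡ 0ℚ) → ∑ L φ ≡ ∑ L′ φ
  ∑-restrict _≟_ {L} {L′} u u′ sub φ z = begin
    ∑ L φ                                          ≡⟨ ∑-cong-∈ L (λ {y} i → sym (column y i)) ⟩
    ∑ L (λ y → ∑ L′ (λ x → ind (x ≟ y) ⊗ φ y))     ≡⟨ ∑-swap L L′ _ ⟩
    ∑ L′ (λ x → ∑ L (λ y → ind (x ≟ y) ⊗ φ y))     ≡⟨ ∑-cong-∈ L′ (λ {x} i → row x i (DecMem._∈?_ _≟_ x L)) ⟩
    ∑ L′ φ ∎
    where
    open ≡-Reasoning
    refl-ind : ∀ {y} → ind (y ≟ y) ≡ 1ℚ
    refl-ind {y} = ind-yes (y ≟ y) refl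
    column : ∀ y → y ∈ˡ L → ∑ L′ (λ x → ind (x ≟ y) ⊗ φ y) ≡ φ y
    column y i = trans (∑-pick _ u′ (sub i) (λ {x} _ x≢y → trans (cong (_⊗ φ y) (ind-no (x ≟ y) x≢y)) (QP.*-zeroˡ (φ y))))
      (trans (cong (_⊗ φ y) refl-ind) (QP.*-identityˡ (φ y)))
    row : ∀ x → x ∈ˡ L′ → Dec (x ∈ˡ L) → ∑ L (λ y → ind (x ≟ y) ⊗ φ y) ≡ φ x
    row x i (yes j) = trans (∑-pick _ u j (λ {y} _ y≢x → trans (cong (_⊗ φ y) (ind-no (x ≟ y) (y≢x ∘ sym))) (QP.*-zeroˡ (φ y))))
      (trans (cong (_⊗ φ x) refl-ind) (QP.*-identityˡ (φ x)))
    row x i (no ¬j) = trans (∑-zero-∈ L (λ {y} k → trans (cong (_⊗ φ y) (ind-no (x ≟ y) (λ { refl → ¬j k }))) (QP.*-zeroˡ (φ y)))) (sym (z i ¬j))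

  ind-diff : ∀ {P R : Set} (d : Dec P) (e : Dec R) → (R → P) → ind e ⊝ ind d ≡ 0ℚ ⊎ (P × ¬ R)
  ind-diff (yes p) (no ¬r) f = inj₂ (p , ¬r)
  ind-diff (yes _) (yes _) f = inj₁ refl
  ind-diff (no _)  (no _)  f = inj₁ refl
  ind-diff (no ¬p) (yes r) f = contradiction (f r) ¬p

  lookup-injective : ∀ {A : Set} {xs : List A} → Unique xs → ∀ {i j} → lookup xs i ≡ lookup xs j → i ≡ j
  lookup-injective {xs = x ∷ xs} (u ∷ᵘ us) {zero}  {zero}  e = refl
  lookup-injective {xs = x ∷ xs} (u ∷ᵘ us) {zero}  {suc j} e = contradiction e (All.lookup u (∈-lookup j))
  lookup-injective {xs = x ∷ xs} (u ∷ᵘ us) {suc i} {zero}  e = contradiction (sym e) (All.lookup u (∈-lookup i))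
  lookup-injective {xs = x ∷ xs} (u ∷ᵘ us) {suc i} {suc j} e = cong suc (lookup-injective us e)

  -- A common frame for both rings: `s = 0` with `b` an atom, or `s = 1` with `b = ⊥`. In both cases
  -- the variables `x_F` belong to the proper flats with `ρ F ≥ 1`.
  module HForms {n : ℕ} (M : Matroid n) (s : ℕ) (L : List (Subset n)) (L-unique : Unique L)
    (L-sound : ∀ {F} → F ∈ˡ L → Nesting.Elem M s F × F ≢ ⊤)
    (L-complete : ∀ {F} → Nesting.Elem M s F → F ≢ ⊤ → F ∈ˡ L)
    (b : Subset n) (b-flat : IsFlat M b) (ρb≡1 : Nesting.ρ M s b ≡ 1) where

    open FlatLattice M
    open Nesting M s
    open MoebiusInversion M
    open Straightening M s

    private
      r = rank M
      m = length L

    flat : Fin m → Subset n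
    flat = lookup L

    flat-elem : ∀ i → Elem (flat i)
    flat-elem i = proj₁ (L-sound (∈-lookup i))

    flat-flat : ∀ i → Flat (flat i)
    flat-flat i = proj₁ (flat-elem i)

    -- h_A = Σ_{F ⊇ b} x_F − Σ_{F ⊇ A} x_F, the sums being over proper flats.
    h : Subset n → Fin m → ℚ
    h A i = ind (b ⊆? flat i) ⊝ ind (A ⊆? flat i)

    b-elem : Elem b
    b-elem = b-flat , ℕP.≤-reflexive (sym ρb≡1)

    private
      elem-⊈ : ∀ {A F} → Elem A → Flat F → ¬ (Elem F) → ¬ (A ⊆ F)
      elem-⊈ (_ , 1≤) flatF ¬el A⊆F = ¬el (flatF , ℕP.≤-trans 1≤ (ℕP.+-monoʳ-≤ s (rank-mono M A⊆F)))

    ⊤-elem : Elem ⊤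
    ⊤-elem = flat-⊤ , ℕP.≤-trans (proj₂ b-elem) (ℕP.+-monoʳ-≤ s (rank-mono M (⊆-max b)))

    -- By Möbius inversion the flats above `b` sum to `⊖ g b = 0` and those above `A` to `⊖ g A`.
    -- Flats without a variable have coefficient zero: `⊤` contains both `b` and `A`, and a flat
    -- with `ρ = 0` contains neither.
    h-inverse : ∀ {A} → Elem A → ∀ g → g b ≡ 0ℚ → ∑ (allFin m) (λ i → h A i ⊗ ∂ g (flat i)) ≡ g A
    h-inverse {A} el g gb≡0 = begin
      ∑ (allFin m) (λ i → h A i ⊗ ∂ g (flat i))
        ≡⟨ ∑-lookup L φ ⟩
      ∑ L φ
        ≡⟨ ∑-restrict _≟S_ L-unique flats-unique (λ i → ∈-flats (proj₁ (proj₁ (L-sound i)))) φ outside ⟩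
      ∑ flats φ
        ≡⟨ ∑-cong flats (λ F → solve 3 (λ a b c → (a :- b) :* c := a :* c :- b :* c) refl (ind (b ⊆? F)) (ind (A ⊆? F)) (∂ g F)) ⟩
      ∑ flats (λ F → ind (b ⊆? F) ⊗ ∂ g F ⊝ ind (A ⊆? F) ⊗ ∂ g F)
        ≡⟨ ∑-⊝ flats _ _ ⟩
      ∑ flats (λ F → ind (b ⊆? F) ⊗ ∂ g F) ⊝ ∑ flats (λ F → ind (A ⊆? F) ⊗ ∂ g F)
        ≡⟨ cong₂ _⊝_ (trans (∂-sum b-flat g) (cong ⊖_ gb≡0)) (∂-sum (proj₁ el) g) ⟩
      ⊖ 0ℚ ⊝ ⊖ g A
        ≡⟨ solve 1 (λ a → :- con 0ℚ :- (:- a) := a) refl (g A) ⟩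
      g A ∎
      where
      open ≡-Reasoning
      φ : Subset n → ℚ
      φ F = (ind (b ⊆? F) ⊝ ind (A ⊆? F)) ⊗ ∂ g F
      zero-coeff : ∀ F → ind (b ⊆? F) ≡ ind (A ⊆? F) → φ F ≡ 0ℚ
      zero-coeff F e = trans (cong (λ z → (z ⊝ ind (A ⊆? F)) ⊗ ∂ g F) e) (trans (cong (_⊗ ∂ g F) (QP.+-inverseʳ (ind (A ⊆? F)))) (QP.*-zeroˡ (∂ g F)))
      outside : ∀ {F} → F ∈ˡ flats → ¬ (F ∈ˡ L) → φ F ≡ 0ℚ
      outside {F} i ¬i = go (F ≟S ⊤)
        where
        go : Dec (F ≡ ⊤) → φ F ≡ 0ℚ
        go (yes refl) = zero-coeff ⊤ (trans (ind-yes (b ⊆? ⊤) (⊆-max b)) (sym (ind-yes (A ⊆? ⊤) (⊆-max A))))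
        go (no F≢⊤) = zero-coeff F (trans (ind-no (b ⊆? F) (elem-⊈ b-elem (flats-flat i) ¬el)) (sym (ind-no (A ⊆? F) (elem-⊈ el (flats-flat i) ¬el))))
          where
          ¬el : ¬ Elem F
          ¬el elF = ¬i (L-complete elF F≢⊤)

    -- The form `h_⊤ − h_F` is the sum of the variables of the flats above `F`, which is a
    -- unitriangular system in descending rank.
    h-separates : ∀ (φ : Fin m → ℚ) → (∀ {A} → Elem A → ∑ (allFin m) (λ i → h A i ⊗ φ i) ≡ 0ℚ) → ∀ i → φ i ≡ 0ℚ
    h-separates φ z i = go (rk M) i (ℕP.m≤m+n (rk M) _)
      where
      go : ∀ d i → rk M ≤ d + r (flat i) → φ i ≡ 0ℚ
      go d i le = begin
        φ i
          ≡⟨ trans (cong (_⊗ φ i) (ind-yes (flat i ⊆? flat i) ⊆-refl)) (QP.*-identityˡ (φ i)) ⟨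
        ind (flat i ⊆? flat i) ⊗ φ i
          ≡⟨ ∑-pick _ (Unique.allFin⁺ m) (∈-allFin i) (λ {j} _ j≢i → vanish j j≢i (flat i ⊆? flat j)) ⟨
        ∑ (allFin m) (λ j → ind (flat i ⊆? flat j) ⊗ φ j)
          ≡⟨ ∑-cong (allFin m) (λ j → trans (cong (_⊗ φ j) (coeff-eq j))
               (solve 3 (λ a b c → (a :- b) :* c := a :* c :- b :* c) refl (h ⊤ j) (h (flat i) j) (φ j))) ⟩
        ∑ (allFin m) (λ j → h ⊤ j ⊗ φ j ⊝ h (flat i) j ⊗ φ j)
          ≡⟨ ∑-⊝ (allFin m) _ _ ⟩
        ∑ (allFin m) (λ j → h ⊤ j ⊗ φ j) ⊝ ∑ (allFin m) (λ j → h (flat i) j ⊗ φ j)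
          ≡⟨ cong₂ _⊝_ (z ⊤-elem) (z (flat-elem i)) ⟩
        0ℚ ∎
        where
        open ≡-Reasoning
        coeff-eq : ∀ j → ind (flat i ⊆? flat j) ≡ h ⊤ j ⊝ h (flat i) j
        coeff-eq j = trans (solve 2 (λ b a → a := (b :- con 0ℚ) :- (b :- a)) refl (ind (b ⊆? flat j)) (ind (flat i ⊆? flat j)))
          (cong (λ t → (ind (b ⊆? flat j) ⊝ t) ⊝ h (flat i) j)
            (sym (ind-no (⊤ ⊆? flat j) (λ ⊤⊆ → proj₂ (L-sound (∈-lookup j)) (⊆-antisym (⊆-max _) ⊤⊆)))))
        larger : ∀ d j → rk M ≤ d + r (flat i) → r (flat i) < r (flat j) → φ j ≡ 0ℚ
        larger zero    j le lt = contradiction (ℕP.≤-trans (rank-mono M (⊆-max (flat j))) le) (ℕP.<⇒≱ lt)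
        larger (suc d) j le lt = go d j (ℕP.≤-trans le (subst (_≤ d + r (flat j)) (ℕP.+-suc d (r (flat i))) (ℕP.+-monoʳ-≤ d lt)))
        vanish : ∀ j → j ≢ i → Dec (flat i ⊆ flat j) → ind (flat i ⊆? flat j) ⊗ φ j ≡ 0ℚ
        vanish j j≢i (no i⊈j)  = trans (cong (_⊗ φ j) (ind-no (flat i ⊆? flat j) i⊈j)) (QP.*-zeroˡ (φ j))
        vanish j j≢i (yes i⊆j) = trans (cong (ind (flat i ⊆? flat j) ⊗_) (larger d j le
          (flat-rank-< (flat-flat i) i⊆j (λ j⊆i → j≢i (lookup-injective L-unique (⊆-antisym j⊆i i⊆j)))))) (QP.*-zeroʳ (ind (flat i ⊆? flat j)))

    ev-separates : ∀ k (ξ : List (Fin m) → ℚ) → (∀ as → All Elem as → length as ≡ k → ev (allFin m) h as ξ ≡ 0ℚ) →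
                   ∀ w → length w ≡ k → ξ w ≡ 0ℚ
    ev-separates zero    ξ z []      l = z [] [] refl
    ev-separates (suc k) ξ z (i ∷ w) l = ev-separates k (λ w → ξ (i ∷ w))
      (λ as el e → h-separates (λ i → ev (allFin m) h as (λ w → ξ (i ∷ w))) (λ {A} elA → z (A ∷ as) (elA ∷ el) (cong suc e)) i)
      w (ℕP.suc-injective l)

    -- The field `outside-0` says `x_F h_{cl e} = 0` for `e ∉ F`. In the Chow ring `h_{cl e}` itself
    -- vanishes; in the augmented ring it equals `y_e`.
    record XRelations (ξ : List (Fin m) → ℚ) : Set where
      field
        symmetric      : Symmetric ξ
        incomparable-0 : ∀ i j → Incomparable (flat i) (flat j) → ∀ w → ξ (i ∷ j ∷ w) ≡ 0ℚ
        outside-0      : ∀ i {e} → e ∉ flat i → ∀ w → ∑ (allFin m) (λ j → h (cl ⁅ e ⁆) j ⊗ ξ (i ∷ j ∷ w)) ≡ 0ℚ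
        atom-0         : ∀ {A} → Flat A → ρ A ≡ 1 → ∀ w → ∑ (allFin m) (λ j → h A j ⊗ ξ (j ∷ w)) ≡ 0ℚ

    module _ {ξ : List (Fin m) → ℚ} (rel : XRelations ξ) where

      open XRelations rel

      private
        η : Word → ℚ
        η as = ev (allFin m) h as ξ

        module _ (w : Word) where

          Φ : Fin m → Fin m → ℚ
          Φ i j = ev (allFin m) h w (λ v → ξ (i ∷ j ∷ v))

          Φ-0 : ∀ i j → Incomparable (flat i) (flat j) → Φ i j ≡ 0ℚ
          Φ-0 i j inc = ev-0 (allFin m) h w (λ v _ → incomparable-0 i j inc v)

          bilinear : (Fin m → ℚ) → (Fin m → ℚ) → ℚ
          bilinear p q = ∑ (allFin m) (λ i → p i ⊗ ∑ (allFin m) (λ j → q j ⊗ Φ i j))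

          bilinear-0 : ∀ p q → (∀ i → p i ≡ 0ℚ ⊎ (∀ j → q j ≡ 0ℚ ⊎ Incomparable (flat i) (flat j))) → bilinear p q ≡ 0ℚ
          bilinear-0 p q e = ∑-zero (allFin m) (λ i → row i (e i))
            where
            row : ∀ i → p i ≡ 0ℚ ⊎ (∀ j → q j ≡ 0ℚ ⊎ Incomparable (flat i) (flat j)) → p i ⊗ ∑ (allFin m) (λ j → q j ⊗ Φ i j) ≡ 0ℚ
            row i (inj₁ z) = trans (cong (_⊗ ∑ (allFin m) (λ j → q j ⊗ Φ i j)) z) (QP.*-zeroˡ (∑ (allFin m) (λ j → q j ⊗ Φ i j)))
            row i (inj₂ f) = trans (cong (p i ⊗_) (∑-zero (allFin m) (λ j → cell j (f j)))) (QP.*-zeroʳ (p i))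
              where
              cell : ∀ j → q j ≡ 0ℚ ⊎ Incomparable (flat i) (flat j) → q j ⊗ Φ i j ≡ 0ℚ
              cell j (inj₁ z)   = trans (cong (_⊗ Φ i j) z) (QP.*-zeroˡ (Φ i j))
              cell j (inj₂ inc) = trans (cong (q j ⊗_) (Φ-0 i j inc)) (QP.*-zeroʳ (q j))

          bilinear-⊝ˡ : ∀ p p′ q → bilinear (λ i → p i ⊝ p′ i) q ≡ bilinear p q ⊝ bilinear p′ q
          bilinear-⊝ˡ p p′ q = trans (∑-cong (allFin m) (λ i → solve 3 (λ a b c → (a :- b) :* c := a :* c :- b :* c) refl (p i) (p′ i) (∑ (allFin m) (λ j → q j ⊗ Φ i j))))
            (∑-⊝ (allFin m) _ _)

          bilinear-⊝ʳ : ∀ p q q′ → bilinear p (λ j → q j ⊝ q′ j) ≡ bilinear p q ⊝ bilinear p q′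
          bilinear-⊝ʳ p q q′ = trans (∑-cong (allFin m) (λ i → trans (cong (p i ⊗_)
              (trans (∑-cong (allFin m) (λ j → solve 3 (λ a b c → (a :- b) :* c := a :* c :- b :* c) refl (q j) (q′ j) (Φ i j))) (∑-⊝ (allFin m) _ _)))
              (solve 3 (λ a b c → a :* (b :- c) := a :* b :- a :* c) refl (p i) (∑ (allFin m) (λ j → q j ⊗ Φ i j)) (∑ (allFin m) (λ j → q′ j ⊗ Φ i j)))))
            (∑-⊝ (allFin m) _ _)

        h-diff : ∀ A B i → h A i ⊝ h B i ≡ ind (B ⊆? flat i) ⊝ ind (A ⊆? flat i)
        h-diff A B i = solve 3 (λ b x y → (b :- x) :- (b :- y) := y :- x) refl (ind (b ⊆? flat i)) (ind (A ⊆? flat i)) (ind (B ⊆? flat i))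

        h-diff-0 : ∀ {A B} i → A ⊆ B → h A i ⊝ h B i ≡ 0ℚ ⊎ (A ⊆ flat i × ¬ (B ⊆ flat i))
        h-diff-0 {A} {B} i A⊆B with ind-diff (A ⊆? flat i) (B ⊆? flat i) (λ B⊆i → ⊆-trans A⊆B B⊆i)
        ... | inj₁ z = inj₁ (trans (h-diff A B i) z)
        ... | inj₂ p = inj₂ p

      -- With `J = A ∨ B`, a flat above `A` but not `J` is incomparable with one above `B` but not
      -- `J`, which gives `modular`. For `cover` with `G = A ∨ e`, the form `h_A − h_G` involves
      -- only flats `F ⊇ A` with `e ∉ F`. Flats containing `e` but not `G` are incomparable with
      -- such an `F`, so `x_F h_G = x_F h_{cl e}`, which is zero.
      relations : Relations η
      relations = record
        { symmetric = λ p → ev-perm (allFin m) h symmetric p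
        ; atom-0    = λ {A} flatA ρA≡1 w → trans (sym (ev-∑ (allFin m) h w (allFin m) (h A) (λ i v → ξ (i ∷ v))))
                        (ev-0 (allFin m) h w (λ v _ → atom-0 flatA ρA≡1 v))
        ; modular   = λ {A} {B} elA elB w → modular A B w
        ; cover     = λ {A} {e} elA e∉A w → cover A e w
        }
        where
        difference : ∀ {a b c d} → (a ⊝ b) ⊝ (c ⊝ d) ≡ 0ℚ → a ⊕ d ≡ b ⊕ c
        difference {a} {b} {c} {d} e = trans (solve 4 (λ a b c d → a :+ d := ((a :- b) :- (c :- d)) :+ (b :+ c)) refl a b c d)
          (trans (cong (_⊕ (b ⊕ c)) e) (QP.+-identityˡ (b ⊕ c)))
        modular : ∀ A B w → η (A ∷ B ∷ w) ⊕ η (A ∨ B ∷ A ∨ B ∷ w) ≡ η (A ∷ A ∨ B ∷ w) ⊕ η (A ∨ B ∷ B ∷ w)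
        modular A B w = difference {η (A ∷ B ∷ w)} {η (A ∷ A ∨ B ∷ w)} {η (A ∨ B ∷ B ∷ w)} {η (A ∨ B ∷ A ∨ B ∷ w)} (begin
          (bilinear w (h A) (h B) ⊝ bilinear w (h A) (h J)) ⊝ (bilinear w (h J) (h B) ⊝ bilinear w (h J) (h J))
            ≡⟨ cong₂ _⊝_ (bilinear-⊝ʳ w (h A) (h B) (h J)) (bilinear-⊝ʳ w (h J) (h B) (h J)) ⟨
          bilinear w (h A) (λ j → h B j ⊝ h J j) ⊝ bilinear w (h J) (λ j → h B j ⊝ h J j)
            ≡⟨ bilinear-⊝ˡ w (h A) (h J) (λ j → h B j ⊝ h J j) ⟨
          bilinear w (λ i → h A i ⊝ h J i) (λ j → h B j ⊝ h J j)
            ≡⟨ bilinear-0 w _ _ (λ i → row i (h-diff-0 i (∨-left A B))) ⟩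
          0ℚ ∎)
          where
          open ≡-Reasoning
          J = A ∨ B
          row : ∀ i → h A i ⊝ h J i ≡ 0ℚ ⊎ (A ⊆ flat i × ¬ (J ⊆ flat i)) →
                h A i ⊝ h J i ≡ 0ℚ ⊎ (∀ j → h B j ⊝ h J j ≡ 0ℚ ⊎ Incomparable (flat i) (flat j))
          row i (inj₁ z) = inj₁ z
          row i (inj₂ (A⊆i , J⊈i)) = inj₂ (λ j → cell j (h-diff-0 j (∨-right A B)))
            where
            cell : ∀ j → h B j ⊝ h J j ≡ 0ℚ ⊎ (B ⊆ flat j × ¬ (J ⊆ flat j)) → h B j ⊝ h J j ≡ 0ℚ ⊎ Incomparable (flat i) (flat j)
            cell j (inj₁ z) = inj₁ z
            cell j (inj₂ (B⊆j , J⊈j)) = inj₂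
              ((λ i⊆j → J⊈j (∨-least (flat-flat j) (⊆-trans A⊆i i⊆j) B⊆j)) , (λ j⊆i → J⊈i (∨-least (flat-flat i) A⊆i (⊆-trans B⊆j j⊆i))))
        cover : ∀ A e w → η (A ∷ A ∨ ⁅ e ⁆ ∷ w) ≡ η (A ∨ ⁅ e ⁆ ∷ A ∨ ⁅ e ⁆ ∷ w)
        cover A e w = equal {η (A ∷ G ∷ w)} (trans (sym (bilinear-⊝ˡ w (h A) (h G) (h G)))
          (∑-zero (allFin m) (λ i → row i (h-diff-0 i (∨-left A ⁅ e ⁆)))))
          where
          open ≡-Reasoning
          equal : ∀ {a b} → a ⊝ b ≡ 0ℚ → a ≡ b
          equal {a} {b} z = trans (solve 2 (λ a b → a := (a :- b) :+ b) refl a b) (trans (cong (_⊕ b) z) (QP.+-identityˡ b))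
          G = A ∨ ⁅ e ⁆
          E = cl ⁅ e ⁆
          E⊆G : E ⊆ G
          E⊆G = cl-least (cl-flat _) (∨-right A ⁅ e ⁆)
          row : ∀ i → h A i ⊝ h G i ≡ 0ℚ ⊎ (A ⊆ flat i × ¬ (G ⊆ flat i)) → (h A i ⊝ h G i) ⊗ ∑ (allFin m) (λ j → h G j ⊗ Φ w i j) ≡ 0ℚ
          row i (inj₁ z) = trans (cong (_⊗ ∑ (allFin m) (λ j → h G j ⊗ Φ w i j)) z) (QP.*-zeroˡ (∑ (allFin m) (λ j → h G j ⊗ Φ w i j)))
          row i (inj₂ (A⊆i , G⊈i)) = trans (cong ((h A i ⊝ h G i) ⊗_) (begin
            ∑ (allFin m) (λ j → h G j ⊗ Φ w i j)
              ≡⟨ ∑-cong (allFin m) (λ j → same j (h-diff-0 j E⊆G)) ⟩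
            ∑ (allFin m) (λ j → h E j ⊗ Φ w i j)
              ≡⟨ ev-∑ (allFin m) h w (allFin m) (h E) (λ j v → ξ (i ∷ j ∷ v)) ⟨
            ev (allFin m) h w (λ v → ∑ (allFin m) (λ j → h E j ⊗ ξ (i ∷ j ∷ v)))
              ≡⟨ ev-0 (allFin m) h w (λ v _ → outside-0 i e∉i v) ⟩
            0ℚ ∎)) (QP.*-zeroʳ (h A i ⊝ h G i))
            where
            e∉i : e ∉ flat i
            e∉i e∈i = G⊈i (∨-least (flat-flat i) A⊆i (⁅⁆-⊆ e∈i))
            same : ∀ j → h E j ⊝ h G j ≡ 0ℚ ⊎ (E ⊆ flat j × ¬ (G ⊆ flat j)) → h G j ⊗ Φ w i j ≡ h E j ⊗ Φ w i j
            same j (inj₁ z) = cong (_⊗ Φ w i j) (sym (equal {h E j} {h G j} z))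
            same j (inj₂ (E⊆j , G⊈j)) = trans (trans (cong (h G j ⊗_) Φ≡0) (QP.*-zeroʳ (h G j))) (sym (trans (cong (h E j ⊗_) Φ≡0) (QP.*-zeroʳ (h E j))))
              where
              e∈j : e ∈ flat j
              e∈j = E⊆j (cl-⊇ ⁅ e ⁆ (x∈⁅x⁆ e))
              Φ≡0 : Φ w i j ≡ 0ℚ
              Φ≡0 = Φ-0 w i j ((λ i⊆j → G⊈j (∨-least (flat-flat j) (⊆-trans A⊆i i⊆j) (⁅⁆-⊆ e∈j))) , (λ j⊆i → e∉i (j⊆i e∈j)))

      x-spanning : (∀ {G} → Elem G → ∃ λ A → Flat A × ρ A ≡ 1 × A ⊆ G) → ∀ k →
        (∀ v → Nested ⊥ 0 v → length v ≡ k → ev (allFin m) h v ξ ≡ 0ℚ) → ∀ w → length w ≡ k → ξ w ≡ 0ℚ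
      x-spanning atoms k z = ev-separates k ξ (spanning relations atoms k z)

-- The Hilbert function from spanning and triangularity.

module Hilbert where

  open Sums
  open Pairing
  open Dimension
  open Flats
  open NestedWords
  open Multilinear
  open Spanning
  open HallRado
  open Moebius
  open Forms
  open import Data.Nat using (suc)
  open import Data.Nat.Induction using (<-rec)
  open import Data.Fin using (suc)
  open import Data.List.Membership.Propositional.Properties using (∈-lookup)
  open import Data.List.Relation.Unary.All using ([]; _∷_)
  open import Data.List.Relation.Binary.Permutation.Propositional using (refl; prep; swap)
  open import Relation.Binary.PropositionalEquality using (trans)

  lookup-∈ : ∀ {A : Set} {P : A → Set} {xs : List A} → (∀ i → P (lookup xs i)) → ∀ {x} → x ∈ˡ xs → P x
  lookup-∈ {P = P} all i = subst P (sym (AnyP.lookup-index i)) (all (Any.index i))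

  module Functionals {n : ℕ} (M : Matroid n) (s : ℕ) where

    open FlatLattice M
    open Nesting M s
    open RankSum M
    open Dragon M s

    -- A class of functionals that contains every `Λ` and is closed under fixing a first letter, as
    -- the letterwise substitution in `ev-inverse` demands.
    record Good (η : Word → ℚ) : Set where
      field
        symmetric : Symmetric η
        atom-0    : ∀ {A} → ρ A ≡ 1 → ∀ w → η (A ∷ w) ≡ 0ℚ
        modular   : ∀ A B w → η (A ∷ B ∷ w) ⊕ η (A ∨ B ∷ A ∨ B ∷ w) ≡ η (A ∷ A ∨ B ∷ w) ⊕ η (A ∨ B ∷ B ∷ w)
        extend    : ∀ {E} A w → rank M E ≤ 1 → η (E ∷ A ∷ w) ≡ η (E ∷ A ∨ E ∷ w)

    good-tail : ∀ η C → Good η → Good (λ w → η (C ∷ w))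
    good-tail η C g = record
      { symmetric = λ p → symmetric (prep C p)
      ; atom-0    = λ {A} ρA≡1 w → trans (symmetric (swap C A refl)) (atom-0 ρA≡1 (C ∷ w))
      ; modular   = λ A B w → trans (cong₂ _⊕_ (move A B) (move _ _)) (trans (modular A B (C ∷ w)) (sym (cong₂ _⊕_ (move _ _) (move _ _))))
      ; extend    = λ {E} A w rE≤1 → trans (move E A) (trans (extend A (C ∷ w) rE≤1) (sym (move E _)))
      }
      where
      open Good g
      move : ∀ A B {w} → η (C ∷ A ∷ B ∷ w) ≡ η (A ∷ B ∷ C ∷ w)
      move A B = symmetric (↭-trans (swap C A refl) (prep A (swap C B refl)))

    Λ-good : ∀ {w} (N : Nested ⊥ 0 w) → Good (Λ N)
    Λ-good N = record
      { symmetric = Λ-symmetric N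
      ; atom-0    = λ {A} ρA≡1 w → Λ-atom N w (ℕP.≤-trans (ℕP.m≤n+m (rank M A) s) (ℕP.≤-reflexive ρA≡1))
                      (ℕP.≤-reflexive (trans (cong (λ B → s + rank M B) (∪-identityˡ A)) ρA≡1))
      ; modular   = Λ-modular N z≤n
      ; extend    = λ A w rE≤1 → Λ-extend N w rE≤1
      }

    nested-elem : ∀ {F c w} → Nested F c w → All Elem w
    nested-elem nil = []
    nested-elem (step {G} {a} flatG _ room N) = AllP.++⁺
      (AllP.replicate⁺ (suc a) (flatG , ℕP.≤-trans (s≤s z≤n) room)) (nested-elem N)

    -- `H` expresses the forms `h_A` in the variables of the ring, and `X` the variables in the
    -- letters. By `inverse`, good functionals do not notice the composite.
    module _ (P : Presentation) (H : Subset n → Fin (nvars P) → ℚ) (X : Fin (nvars P) → Subset n → ℚ)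
      (flat-⊥ : Flat ⊥)
      (gens-deg : ∀ {g} → g ∈ˡ gens P → ∃ λ d → AllDeg d g)
      (vanishing : ∀ k f → Annihilates f (gens P) →
        (∀ v → Nested ⊥ 0 v → length v ≡ k → ev (allFin (nvars P)) H v (f ∘ expo) ≡ 0ℚ) → ∀ w → length w ≡ k → f (expo w) ≡ 0ℚ)
      (annihilation : ∀ η → Good η → Annihilates (λ μ → ev flats X (word μ) η) (gens P))
      (inverse : ∀ η A → Elem A → Good η → ∀ as →
        ∑ (allFin (nvars P)) (λ i → H A i ⊗ ∑ flats (λ B → X i B ⊗ η (B ∷ as))) ≡ η (A ∷ as)) where

      private
        m = nvars P

        pair-dual : ∀ {η} → Good η → ∀ as → All Elem as → ⟪ monomial H as , (λ μ → ev flats X (word μ) η) ⟫ ≡ η as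
        pair-dual {η} g as el = trans (pair-monomial H as _)
          (trans (ev-cong (allFin m) H as (λ w _ → ev-perm flats X (Good.symmetric g) (word-expo w)))
            (ev-inverse (allFin m) flats H X Elem Good good-tail inverse as el η g))

      hilbert-function : ∀ {k h} → GradedDim P k h → h ≡ length (enum (suc (rk M)) ⊥ 0 k)
      hilbert-function {k} {h} gd = Coordinates.dimension-unique P gd (λ i → gens-deg (∈-lookup i)) N b b-deg spanning independent
        where
        E = enum (suc (rk M)) ⊥ 0 k
        N = length E
        nested : ∀ l → Nested ⊥ 0 (lookup E l)
        nested l = proj₁ (enum-sound (suc (rk M)) ⊥ 0 k (∈-lookup l))
        b : Fin N → Poly m
        b l = monomial H (lookup E l)
        b-deg : ∀ l → AllDeg k (b l)
        b-deg l = subst (λ d → AllDeg d (b l)) (proj₂ (enum-sound (suc (rk M)) ⊥ 0 k (∈-lookup l))) (monomial-deg H (lookup E l))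
        spanning : ∀ f → Annihilates f (gens P) → (∀ l → ⟪ b l , f ⟫ ≡ 0ℚ) → ∀ μ → deg μ ≡ k → f μ ≡ 0ℚ
        spanning f ann z μ degμ = trans (cong f (sym (expo-word μ)))
          (vanishing k f ann on-nested (word μ) (trans (length-word μ) degμ))
          where
          on-nested : ∀ v → Nested ⊥ 0 v → length v ≡ k → ev (allFin m) H v (f ∘ expo) ≡ 0ℚ
          on-nested v Nv l = trans (sym (pair-monomial H v f)) (lookup-∈ {P = λ v → ⟪ monomial H v , f ⟫ ≡ 0ℚ} z
            (subst (λ k → v ∈ˡ enum (suc (rk M)) ⊥ 0 k) l (enum-complete (suc (rk M)) (ℕP.≤-trans (ℕP.n≤1+n _) (ℕP.m≤m+n _ _)) flat-⊥ Nv)))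
        independent : ∀ u → (∀ f → Annihilates f (gens P) → ∑ (allFin N) (λ l → u l ⊗ ⟪ b l , f ⟫) ≡ 0ℚ) → ∀ l → u l ≡ 0ℚ
        -- Induction on total rank: in the equation from the functional dual to word `l`, each other
        -- word with a nonzero entry has smaller total rank, so its coefficient is already known to
        -- be zero.
        independent u z l = <-rec (λ R → ∀ l → rsum (lookup E l) ≡ R → u l ≡ 0ℚ) rec (rsum (lookup E l)) l refl
          where
          triangle : ∀ l → ∑ (allFin N) (λ j → u j ⊗ Λ (nested l) (lookup E j)) ≡ 0ℚ
          triangle l = trans (∑-cong (allFin N) (λ j → cong (u j ⊗_) (sym (pair-dual (Λ-good (nested l)) (lookup E j) (nested-elem (nested j))))))
            (z _ (annihilation (Λ (nested l)) (Λ-good (nested l))))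
          rec : ∀ R → (∀ {R′} → R′ < R → ∀ l → rsum (lookup E l) ≡ R′ → u l ≡ 0ℚ) → ∀ l → rsum (lookup E l) ≡ R → u l ≡ 0ℚ
          rec R ih l refl = trans (sym (trans (cong (u l ⊗_) (Λ-self (nested l))) (QP.*-identityʳ (u l))))
            (trans (sym (∑-pick _ (Unique.allFin⁺ N) (∈-allFin l) (λ {j} _ j≢l → off j j≢l (Λ (nested l) (lookup E j) QP.≟ 0ℚ)))) (triangle l))
            where
            off : ∀ j → j ≢ l → Dec (Λ (nested l) (lookup E j) ≡ 0ℚ) → u j ⊗ Λ (nested l) (lookup E j) ≡ 0ℚ
            off j j≢l (yes e) = trans (cong (u j ⊗_) e) (QP.*-zeroʳ (u j))
            off j j≢l (no ne) with le , tight ← Λ-triangular (nested l) (lookup E j) (All.map proj₁ (nested-elem (nested j))) ne =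
              trans (cong (_⊗ Λ (nested l) (lookup E j)) (ih (ℕP.≤∧≢⇒< le (λ e → j≢l (lookup-injective (enum-unique (suc (rk M)) ⊥ 0 k)
                (sorted-unique (nested-sorted (nested j)) (nested-sorted (nested l)) (tight e))))) j refl)) (QP.*-zeroˡ (Λ (nested l) (lookup E j)))

-- The Chow ring and the augmented Chow ring.

module Rings where

  open Sums
  open Pairing
  open Flats
  open NestedWords
  open Multilinear
  open Spanning
  open Moebius
  open Forms
  open Hilbert
  open GammaClosure
  open Counting
  open import Data.Nat using (zero; suc)
  open import Data.Fin using (zero; suc; _↑ˡ_; _↑ʳ_; splitAt)
  open import Data.Fin.Subset using (⊤; _∈_)
  open import Data.List using (cartesianProduct)
  open import Data.List.Membership.Propositional.Properties using (∈-lookup; ∈-cartesianProduct⁺)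
  open import Data.List.Relation.Binary.Permutation.Propositional using (refl; swap)
  open import Data.Sum using ([_,_]′)
  open import Relation.Binary.PropositionalEquality using (trans)

  open +-*-Solver

  equal-⊝ : ∀ {a b : ℚ} → a ⊝ b ≡ 0ℚ → a ≡ b
  equal-⊝ {a} {b} z = trans (solve 2 (λ a b → a := (a :- b) :+ b) refl a b) (trans (cong (_⊕ b) z) (QP.+-identityˡ b))

  ⊝-equal : ∀ {a b : ℚ} → a ≡ b → a ⊝ b ≡ 0ℚ
  ⊝-equal {a} refl = QP.+-inverseʳ a

  ∈-map-elim : ∀ {A B : Set} (P : B → Set) (f : A → B) {xs} → (∀ {a} → a ∈ˡ xs → P (f a)) → ∀ {b} → b ∈ˡ map f xs → P b
  ∈-map-elim P f e i with a , a∈ , refl ← ∈-map⁻ f i = e a∈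

  ∈-++-elim : ∀ {A : Set} (P : A → Set) xs {ys} → (∀ {a} → a ∈ˡ xs → P a) → (∀ {a} → a ∈ˡ ys → P a) → ∀ {a} → a ∈ˡ xs ++ ys → P a
  ∈-++-elim P xs e e′ i with ∈-++⁻ xs i
  ... | inj₁ j = e j
  ... | inj₂ j = e′ j

  module _ {m : ℕ} (f : Mon m → ℚ) (w : Mon m) where

    pair-var-shift : ∀ i → ⟪ varP i , (λ ν → f (w +M ν)) ⟫ ≡ f (expo (i ∷ word w))
    pair-var-shift i = trans (pair-var i (λ ν → f (w +M ν))) (cong f (trans (+M-comm w (unit i)) (cong (unit i +M_) (sym (expo-word w)))))

    pair-quadric : ∀ i j → ⟪ varP i *P varP j , (λ ν → f (w +M ν)) ⟫ ≡ f (expo (i ∷ j ∷ word w))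
    pair-quadric i j = trans (pair-mul (varP i) (varP j) (λ ν → f (w +M ν))) (trans (QP.+-identityʳ _) (trans (QP.*-identityˡ ⟪ varP j , (λ ν → f (w +M (unit i +M ν))) ⟫)
      (trans (pair-var j (λ ν → f (w +M (unit i +M ν)))) (cong f (trans (+M-comm w (unit i +M unit j)) (trans (+M-assoc (unit i) (unit j) w)
        (cong (λ ν → unit i +M (unit j +M ν)) (sym (expo-word w)))))))))

    pair-sum-vars : ∀ {A : Set} (v : A → Fin m) xs → ⟪ sumP (map (varP ∘ v) xs) , (λ ν → f (w +M ν)) ⟫ ≡ ∑ xs (λ a → f (expo (v a ∷ word w)))
    pair-sum-vars v xs = trans (pair-sum (map (varP ∘ v) xs) (λ ν → f (w +M ν))) (trans (∑-map (varP ∘ v) xs (λ p → ⟪ p , (λ ν → f (w +M ν)) ⟫)) (∑-cong xs (λ a → pair-var-shift (v a))))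

  module _ {m : ℕ} (f : Mon m → ℚ) (v : List (Fin m)) where

    private
      at-expo : ∀ u → f (expo (u ++ word (expo v))) ≡ f (expo (u ++ v))
      at-expo u = cong f (expo-perm (Perm.++⁺ˡ u (word-expo v)))

    pair-quadric-expo : ∀ i j → ⟪ varP i *P varP j , (λ ν → f (expo v +M ν)) ⟫ ≡ f (expo (i ∷ j ∷ v))
    pair-quadric-expo i j = trans (pair-quadric f (expo v) i j) (at-expo (i ∷ j ∷ []))

    pair-var-expo : ∀ i → ⟪ varP i , (λ ν → f (expo v +M ν)) ⟫ ≡ f (expo (i ∷ v))
    pair-var-expo i = trans (pair-var-shift f (expo v) i) (at-expo (i ∷ []))

    pair-sum-vars-expo : ∀ {A : Set} (y : A → Fin m) xs → ⟪ sumP (map (varP ∘ y) xs) , (λ ν → f (expo v +M ν)) ⟫ ≡ ∑ xs (λ a → f (expo (y a ∷ v)))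
    pair-sum-vars-expo y xs = trans (pair-sum-vars f (expo v) y xs) (∑-cong xs (λ a → at-expo (y a ∷ [])))

  annihilates-∈ : ∀ {m} (f : Mon m → ℚ) {gs} → Annihilates f gs → ∀ {g} → g ∈ˡ gs → ∀ w → ⟪ g , (λ ν → f (w +M ν)) ⟫ ≡ 0ℚ
  annihilates-∈ f ann g∈ w = lookup-∈ {P = λ g → ⟪ g , (λ ν → f (w +M ν)) ⟫ ≡ 0ℚ} (ann w) g∈

  module LooplessMatroid {n : ℕ} (M : Matroid n) (loopless : Loopless M) where

    open FlatLattice M

    flat-⊥ : Flat ⊥
    flat-⊥ e _ = subst₂ _<_ (sym rank-⊥) (sym (trans (cong (rank M) (∪-identityˡ ⁅ e ⁆)) (loopless e))) (s≤s z≤n)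

    rank-cl-⁅⁆ : ∀ e → rank M (cl ⁅ e ⁆) ≡ 1
    rank-cl-⁅⁆ e = trans (rank-cl ⁅ e ⁆) (loopless e)

    cl-⁅⁆-⊆ : ∀ {e F} → Flat F → e ∈ F → cl ⁅ e ⁆ ⊆ F
    cl-⁅⁆-⊆ flat e∈F = cl-least flat (⁅⁆-⊆ e∈F)

    cl-⁅⁆-∈ : ∀ {e F} → cl ⁅ e ⁆ ⊆ F → e ∈ F
    cl-⁅⁆-∈ {e} ⊆F = ⊆F (cl-⊇ ⁅ e ⁆ (x∈⁅x⁆ e))

    ind-cl-⁅⁆ : ∀ e {F} → Flat F → ind (cl ⁅ e ⁆ ⊆? F) ≡ ind (e ∈? F)
    ind-cl-⁅⁆ e {F} flat = ind-cong (cl ⁅ e ⁆ ⊆? F) (e ∈? F) cl-⁅⁆-∈ (cl-⁅⁆-⊆ flat)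

    positive-rank-witness : ∀ {A} → 1 ≤ rank M A → ∃ λ e → e ∈ A
    positive-rank-witness {A} 1≤r with A ⊆? ⊥
    ... | yes A⊆⊥ = contradiction (ℕP.≤-trans 1≤r (subst (rank M A ≤_) rank-⊥ (rank-mono M A⊆⊥))) λ ()
    ... | no A⊈⊥ with e , e∈A , _ ← ⊈-witness A⊈⊥ = e , e∈A

  module Chow {n : ℕ} (M : Matroid n) (loopless : Loopless M) (i₀ : Fin n) where

    open FlatLattice M
    open LooplessMatroid M loopless
    open Nesting M 0
    open Functionals M 0
    open MoebiusInversion M

    private
      L = chowFlats M
      m = length L
      b = cl ⁅ i₀ ⁆
      P? = λ F → isFlat? M F ×-dec ¬? (F ≟S ⊥) ×-dec ¬? (F ≟S ⊤)

      L-sound : ∀ {F} → F ∈ˡ L → Elem F × F ≢ ⊤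
      L-sound {F} i with _ , flat , F≢⊥ , F≢⊤ ← ∈-filter⁻ P? {xs = allSubsets n} i = (flat , 1≤r) , F≢⊤
        where
        1≤r : 1 ≤ rank M F
        1≤r with F ⊆? ⊥
        ... | yes F⊆⊥ = contradiction (⊆-antisym F⊆⊥ (⊆-min F)) F≢⊥
        ... | no F⊈⊥ with e , e∈F , _ ← ⊈-witness F⊈⊥ = subst (_≤ rank M F) (loopless e) (rank-mono M (⁅⁆-⊆ e∈F))

      L-complete : ∀ {F} → Elem F → F ≢ ⊤ → F ∈ˡ L
      L-complete {F} (flat , 1≤r) F≢⊤ = ∈-filter⁺ P? (allSubsets-complete F) (flat , F≢⊥ , F≢⊤)
        where
        F≢⊥ : F ≢ ⊥
        F≢⊥ refl = contradiction (subst (1 ≤_) rank-⊥ 1≤r) λ ()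

    open HForms M 0 L (Unique.filter⁺ P? (allSubsets-unique n)) L-sound L-complete b (cl-flat _) (rank-cl-⁅⁆ i₀)

    private
      lin : Fin n → Poly m
      lin a = sumP (map varP (filter (λ i → a ∈? flat i) (allFin m)))
      pairs : List (Fin m × Fin m)
      pairs = filter (λ ij → incomparable? (flat (proj₁ ij)) (flat (proj₂ ij))) (cartesianProduct (allFin m) (allFin m))
      quadric : Fin m × Fin m → Poly m
      quadric ij = varP (proj₁ ij) *P varP (proj₂ ij)
      difference : Fin n × Fin n → Poly m
      difference ab = lin (proj₁ ab) -P lin (proj₂ ab)
      I J : List (Poly m)
      I = map quadric pairs
      J = map difference (cartesianProduct (allFin n) (allFin n))

      lin-deg : ∀ a → AllDeg 1 (lin a)
      lin-deg a = allDeg-sumP varP (filter (λ i → a ∈? flat i) (allFin m)) allDeg-var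

      gens-deg : ∀ {g} → g ∈ˡ I ++ J → ∃ λ d → AllDeg d g
      gens-deg = ∈-++-elim (λ g → ∃ λ d → AllDeg d g) I
        (∈-map-elim (λ g → ∃ λ d → AllDeg d g) quadric (λ {xy} _ → 2 , allDeg-mul {p = varP (proj₁ xy)} {q = varP (proj₂ xy)} (allDeg-var _) (allDeg-var _)))
        (∈-map-elim (λ g → ∃ λ d → AllDeg d g) difference (λ {ac} _ → 1 , allDeg-sub {p = lin (proj₁ ac)} {q = lin (proj₂ ac)} (lin-deg _) (lin-deg _)))

      ∑-lin : ∀ a (φ : Fin m → ℚ) → ∑ (filter (λ i → a ∈? flat i) (allFin m)) φ ≡ ∑ (allFin m) (λ i → ind (cl ⁅ a ⁆ ⊆? flat i) ⊗ φ i)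
      ∑-lin a φ = trans (∑-filter (λ i → a ∈? flat i) (allFin m) φ) (∑-cong (allFin m) (λ i → cong (_⊗ φ i) (sym (ind-cl-⁅⁆ a (flat-flat i)))))

      ∑-h : ∀ A (φ : Fin m → ℚ) → ∑ (allFin m) (λ i → h A i ⊗ φ i) ≡
            ∑ (allFin m) (λ i → ind (b ⊆? flat i) ⊗ φ i) ⊝ ∑ (allFin m) (λ i → ind (A ⊆? flat i) ⊗ φ i)
      ∑-h A φ = trans (∑-cong (allFin m) (λ i → solve 3 (λ a b c → (a :- b) :* c := a :* c :- b :* c) refl (ind (b ⊆? flat i)) (ind (A ⊆? flat i)) (φ i)))
        (∑-⊝ (allFin m) _ _)

      atom-cl : ∀ {A} → Flat A → rank M A ≡ 1 → ∃ λ a → A ≡ cl ⁅ a ⁆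
      atom-cl {A} flatA rA≡1 with a , a∈A ← positive-rank-witness {A} (ℕP.≤-reflexive (sym rA≡1)) =
        a , sym (flat-rank-≡ (cl-flat _) (cl-⁅⁆-⊆ flatA a∈A) (ℕP.≤-reflexive (trans rA≡1 (sym (rank-cl-⁅⁆ a)))))

      module _ (f : Mon m → ℚ) (ann : Annihilates f (I ++ J)) where

        ξ : List (Fin m) → ℚ
        ξ = f ∘ expo

        -- An atom is `cl a` for some element `a`, and `h_{cl a}` is the generator of `J` for the
        -- pair of `i₀` and `a`.
        atom-0 : ∀ {A} → Flat A → ρ A ≡ 1 → ∀ w → ∑ (allFin m) (λ j → h A j ⊗ ξ (j ∷ w)) ≡ 0ℚ
        atom-0 flatA ρA≡1 w with a , refl ← atom-cl flatA ρA≡1 = trans (∑-h (cl ⁅ a ⁆) (λ j → ξ (j ∷ w)))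
          (trans (sym (cong₂ _⊝_ (lin-sum i₀) (lin-sum a)))
            (trans (sym (pair-sub (lin i₀) (lin a) (λ ν → f (expo w +M ν))))
              (annihilates-∈ f ann (∈-++⁺ʳ I (∈-map⁺ difference (∈-cartesianProduct⁺ (∈-allFin i₀) (∈-allFin a)))) (expo w))))
          where
          lin-sum : ∀ a → ⟪ lin a , (λ ν → f (expo w +M ν)) ⟫ ≡ ∑ (allFin m) (λ i → ind (cl ⁅ a ⁆ ⊆? flat i) ⊗ ξ (i ∷ w))
          lin-sum a = trans (pair-sum-vars-expo f w (λ i → i) (filter (λ i → a ∈? flat i) (allFin m))) (∑-lin a (λ i → ξ (i ∷ w)))

        x-relations : XRelations ξ
        x-relations = record
          { symmetric      = λ p → cong f (expo-perm p)
          ; incomparable-0 = λ i j inc w → trans (sym (pair-quadric-expo f w i j))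
              (annihilates-∈ f ann (∈-++⁺ˡ (∈-map⁺ quadric (∈-filter⁺ (λ ij → incomparable? (flat (proj₁ ij)) (flat (proj₂ ij)))
                (∈-cartesianProduct⁺ (∈-allFin i) (∈-allFin j)) inc))) (expo w))
          ; outside-0      = λ i {e} _ w → trans (∑-cong (allFin m) (λ j → cong (λ μ → h (cl ⁅ e ⁆) j ⊗ f μ) (expo-perm {w = i ∷ j ∷ w} (swap i j refl))))
              (atom-0 (cl-flat _) (rank-cl-⁅⁆ e) (i ∷ w))
          ; atom-0         = atom-0
          }

      atoms : ∀ {G} → Elem G → ∃ λ A → Flat A × ρ A ≡ 1 × A ⊆ G
      atoms {G} (flatG , 1≤r) with e , e∈G ← positive-rank-witness {G} 1≤r = cl ⁅ e ⁆ , cl-flat _ , rank-cl-⁅⁆ e , cl-⁅⁆-⊆ flatG e∈G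

      X : Fin m → Subset n → ℚ
      X i = μ (flat i)

      annihilation : ∀ η → Good η → Annihilates (λ μ → ev flats X (word μ) η) (I ++ J)
      annihilation η g w i = member (∈-lookup i)
        where
        open Good g using (symmetric; modular)
        ζ : List (Fin m) → ℚ
        ζ v = ev flats X v η
        f : Mon m → ℚ
        f μ = ζ (word μ)
        f-expo : ∀ v → f (expo v) ≡ ζ v
        f-expo v = ev-perm flats X symmetric (word-expo v)
        -- The sum over the flats containing `a` differs from the one over `F ⊇ b` by `h_{cl a}`, to
        -- which `h-inverse` assigns the value of `slot` at an atom, hence zero. The result does not
        -- depend on `a`, which makes the generators in `J` vanish.
        lin-sum : ∀ a → ⟪ lin a , (λ ν → f (w +M ν)) ⟫ ≡ ∑ (allFin m) (λ i → ind (b ⊆? flat i) ⊗ ζ (i ∷ word w))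
        lin-sum a = trans (pair-sum-vars f w (λ i → i) (filter (λ i → a ∈? flat i) (allFin m)))
          (trans (∑-cong (filter (λ i → a ∈? flat i) (allFin m)) (λ i → f-expo (i ∷ word w)))
            (trans (∑-lin a (λ i → ζ (i ∷ word w)))
              (sym (equal-⊝ (trans (sym (∑-h (cl ⁅ a ⁆) (λ i → ζ (i ∷ word w))))
                (trans (h-inverse (cl-flat _ , ℕP.≤-reflexive (sym (rank-cl-⁅⁆ a))) slot (slot-0 (rank-cl-⁅⁆ i₀))) (slot-0 (rank-cl-⁅⁆ a))))))))
          where
          slot : Subset n → ℚ
          slot B = ev flats X (word w) (λ v → η (B ∷ v))
          slot-0 : ∀ {A} → rank M A ≡ 1 → slot A ≡ 0ℚ
          slot-0 rA≡1 = ev-0 flats X (word w) (λ v _ → Good.atom-0 g rA≡1 v)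
        Φ : Subset n → Subset n → ℚ
        Φ A B = ev flats X (word w) (λ v → η (A ∷ B ∷ v))
        Φ-modular : ∀ A B → Φ A B ⊕ Φ (A ∨ B) (A ∨ B) ≡ Φ A (A ∨ B) ⊕ Φ (A ∨ B) B
        Φ-modular A B = trans (sym (ev-⊕ flats X (word w) _ _)) (trans (ev-cong flats X (word w) (λ v _ → modular A B v)) (ev-⊕ flats X (word w) _ _))
        on-quadric : ∀ x y → Incomparable (flat x) (flat y) → ⟪ varP x *P varP y , (λ ν → f (w +M ν)) ⟫ ≡ 0ℚ
        on-quadric x y inc = trans (pair-quadric f w x y) (trans (f-expo (x ∷ y ∷ word w)) (∂∂-incomparable Φ Φ-modular (flat-flat x) (flat-flat y) inc))
        on-difference : ∀ a c → ⟪ lin a -P lin c , (λ ν → f (w +M ν)) ⟫ ≡ 0ℚ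
        on-difference a c = trans (pair-sub (lin a) (lin c) (λ ν → f (w +M ν))) (⊝-equal (trans (lin-sum a) (sym (lin-sum c))))
        member : ∀ {g} → g ∈ˡ I ++ J → ⟪ g , (λ ν → f (w +M ν)) ⟫ ≡ 0ℚ
        member = ∈-++-elim (λ g → ⟪ g , (λ ν → f (w +M ν)) ⟫ ≡ 0ℚ) I
          (∈-map-elim (λ g → ⟪ g , (λ ν → f (w +M ν)) ⟫ ≡ 0ℚ) quadric (λ {xy} xy∈ → on-quadric (proj₁ xy) (proj₂ xy)
            (proj₂ (∈-filter⁻ (λ ij → incomparable? (flat (proj₁ ij)) (flat (proj₂ ij))) {xs = cartesianProduct (allFin m) (allFin m)} xy∈))))
          (∈-map-elim (λ g → ⟪ g , (λ ν → f (w +M ν)) ⟫ ≡ 0ℚ) difference (λ {ac} _ → on-difference (proj₁ ac) (proj₂ ac)))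

    chow-hilbert : ∀ {k h} → GradedDim (chowPresentation M) k h → h ≡ length (enum (suc (rk M)) ⊥ 0 k)
    chow-hilbert = hilbert-function (chowPresentation M) h X flat-⊥ gens-deg
      (λ k f ann z → x-spanning (x-relations f ann) atoms k z)
      annihilation
      (λ η A el g as → h-inverse el (λ B → η (B ∷ as)) (Good.atom-0 g (rank-cl-⁅⁆ i₀) as))

  ∑-allFin-+ : ∀ m n (f : Fin (m + n) → ℚ) → ∑ (allFin (m + n)) f ≡ ∑ (allFin m) (λ i → f (i ↑ˡ n)) ⊕ ∑ (allFin n) (λ e → f (m ↑ʳ e))
  ∑-allFin-+ zero    n f = sym (QP.+-identityˡ _)
  ∑-allFin-+ (suc m) n f = trans (∑-allFin-suc f) (trans (cong (f zero ⊕_) (∑-allFin-+ m n (f ∘ suc)))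
    (trans (sym (QP.+-assoc (f zero) (∑ (allFin m) (λ i → f (suc i ↑ˡ n))) (∑ (allFin n) (λ e → f (suc m ↑ʳ e)))))
      (cong (_⊕ ∑ (allFin n) (λ e → f (suc m ↑ʳ e))) (sym (∑-allFin-suc (λ i → f (i ↑ˡ n)))))))

  module Augmented {n : ℕ} (M : Matroid n) (loopless : Loopless M) where

    open FlatLattice M
    open LooplessMatroid M loopless
    open Nesting M 1
    open Functionals M 1
    open MoebiusInversion M

    private
      L = augFlats M
      m = length L
      P? = λ F → isFlat? M F ×-dec ¬? (F ≟S ⊤)

      L-sound : ∀ {F} → F ∈ˡ L → Elem F × F ≢ ⊤
      L-sound {F} i = let _ , flat , F≢⊤ = ∈-filter⁻ P? {xs = allSubsets n} i in (flat , s≤s z≤n) , F≢⊤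

      L-complete : ∀ {F} → Elem F → F ≢ ⊤ → F ∈ˡ L
      L-complete {F} (flat , _) F≢⊤ = ∈-filter⁺ P? (allSubsets-complete F) (flat , F≢⊤)

      ρ⊥≡1 : ρ ⊥ ≡ 1
      ρ⊥≡1 = cong suc rank-⊥

    open HForms M 1 L (Unique.filter⁺ P? (allSubsets-unique n)) L-sound L-complete ⊥ flat-⊥ ρ⊥≡1

    private
      inl : Fin m → Fin (m + n)
      inl i = i ↑ˡ n
      inr : Fin n → Fin (m + n)
      inr e = m ↑ʳ e

      missing : Fin n → List (Fin m)
      missing e = filter (λ i → ¬? (e ∈? flat i)) (allFin m)
      lin : Fin n → Poly (m + n)
      lin e = sumP (map (varP ∘ inl) (missing e))
      linear : Fin n → Poly (m + n)
      linear e = varP (inr e) -P lin e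
      xx : Fin m × Fin m → Poly (m + n)
      xx ij = varP (inl (proj₁ ij)) *P varP (inl (proj₂ ij))
      yx : Fin n × Fin m → Poly (m + n)
      yx ei = varP (inr (proj₁ ei)) *P varP (inl (proj₂ ei))
      inc? = λ (ij : Fin m × Fin m) → incomparable? (flat (proj₁ ij)) (flat (proj₂ ij))
      out? = λ (ei : Fin n × Fin m) → ¬? (proj₁ ei ∈? flat (proj₂ ei))
      I J₁ J₂ : List (Poly (m + n))
      I  = map linear (allFin n)
      J₁ = map xx (filter inc? (cartesianProduct (allFin m) (allFin m)))
      J₂ = map yx (filter out? (cartesianProduct (allFin n) (allFin m)))

      generators-elim : (P : Poly (m + n) → Set) → (∀ e → P (linear e)) → (∀ i j → Incomparable (flat i) (flat j) → P (xx (i , j))) →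
        (∀ e i → e ∉ flat i → P (yx (e , i))) → ∀ {g} → g ∈ˡ I ++ J₁ ++ J₂ → P g
      generators-elim P on-linear on-xx on-yx = ∈-++-elim P I
        (∈-map-elim P linear (λ {e} _ → on-linear e))
        (∈-++-elim P J₁
          (∈-map-elim P xx (λ {ij} ij∈ → on-xx (proj₁ ij) (proj₂ ij) (proj₂ (∈-filter⁻ inc? {xs = cartesianProduct (allFin m) (allFin m)} ij∈))))
          (∈-map-elim P yx (λ {ei} ei∈ → on-yx (proj₁ ei) (proj₂ ei) (proj₂ (∈-filter⁻ out? {xs = cartesianProduct (allFin n) (allFin m)} ei∈)))))

      gens-deg : ∀ {g} → g ∈ˡ I ++ J₁ ++ J₂ → ∃ λ d → AllDeg d g
      gens-deg = generators-elim (λ g → ∃ λ d → AllDeg d g)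
        (λ e → 1 , allDeg-sub {p = varP (inr e)} {q = lin e} (allDeg-var (inr e)) (allDeg-sumP (varP ∘ inl) (missing e) (λ i → allDeg-var (inl i))))
        (λ i j _ → 2 , allDeg-mul {p = varP (inl i)} {q = varP (inl j)} (allDeg-var (inl i)) (allDeg-var (inl j)))
        (λ e i _ → 2 , allDeg-mul {p = varP (inr e)} {q = varP (inl i)} (allDeg-var (inr e)) (allDeg-var (inl i)))

      h-cl-⁅⁆ : ∀ e i → h (cl ⁅ e ⁆) i ≡ ind (¬? (e ∈? flat i))
      h-cl-⁅⁆ e i = trans (cong₂ _⊝_ (ind-yes (⊥ ⊆? flat i) (⊆-min (flat i))) (ind-cl-⁅⁆ e (flat-flat i))) (complement (e ∈? flat i))
        where
        complement : ∀ {P : Set} (d : Dec P) → 1ℚ ⊝ ind d ≡ ind (¬? d)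
        complement (yes _) = refl
        complement (no _)  = refl

      ∑-missing : ∀ e (φ : Fin m → ℚ) → ∑ (missing e) φ ≡ ∑ (allFin m) (λ i → h (cl ⁅ e ⁆) i ⊗ φ i)
      ∑-missing e φ = trans (∑-filter (λ i → ¬? (e ∈? flat i)) (allFin m) φ) (∑-cong (allFin m) (λ i → cong (_⊗ φ i) (sym (h-cl-⁅⁆ e i))))

      H : Subset n → Fin (m + n) → ℚ
      H A z = [ h A , (λ _ → 0ℚ) ]′ (splitAt m z)

      ∑-H : ∀ A (φ : Fin (m + n) → ℚ) → ∑ (allFin (m + n)) (λ z → H A z ⊗ φ z) ≡ ∑ (allFin m) (λ i → h A i ⊗ φ (inl i))
      ∑-H A φ = trans (∑-allFin-+ m n (λ z → H A z ⊗ φ z)) (trans (cong₂ _⊕_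
        (∑-cong (allFin m) (λ i → cong (λ z → [ h A , (λ _ → 0ℚ) ]′ z ⊗ φ (inl i)) (FinP.splitAt-↑ˡ m i n)))
        (∑-zero (allFin n) (λ e → trans (cong (λ z → [ h A , (λ _ → 0ℚ) ]′ z ⊗ φ (inr e)) (FinP.splitAt-↑ʳ m n e)) (QP.*-zeroˡ (φ (inr e))))))
        (QP.+-identityʳ (∑ (allFin m) (λ i → h A i ⊗ φ (inl i)))))

      ev-H : ∀ v (ζ : List (Fin (m + n)) → ℚ) → ev (allFin (m + n)) H v ζ ≡ ev (allFin m) h v (ζ ∘ map inl)
      ev-H []      ζ = refl
      ev-H (A ∷ v) ζ = trans (∑-H A (λ z → ev (allFin (m + n)) H v (λ w → ζ (z ∷ w))))
        (∑-cong (allFin m) (λ i → cong (h A i ⊗_) (ev-H v (λ w → ζ (inl i ∷ w)))))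

      module _ (f : Mon (m + n) → ℚ) (ann : Annihilates f (I ++ J₁ ++ J₂)) where

        ξ : List (Fin m) → ℚ
        ξ w = f (expo (map inl w))

        f-↭ : ∀ {v v′} → v ↭ v′ → f (expo v) ≡ f (expo v′)
        f-↭ p = cong f (expo-perm p)

        y-linear : ∀ e v → f (expo (inr e ∷ v)) ≡ ∑ (allFin m) (λ i → h (cl ⁅ e ⁆) i ⊗ f (expo (inl i ∷ v)))
        y-linear e v = trans (equal-⊝ (trans (sym (trans (pair-sub (varP (inr e)) (lin e) (λ ν → f (expo v +M ν)))
            (cong₂ _⊝_ (pair-var-expo f v (inr e)) (pair-sum-vars-expo f v inl (missing e)))))
            (annihilates-∈ f ann (∈-++⁺ˡ (∈-map⁺ linear (∈-allFin e))) (expo v))))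
          (∑-missing e (λ i → f (expo (inl i ∷ v))))

        x-relations : XRelations ξ
        x-relations = record
          { symmetric      = λ p → f-↭ (Perm.map⁺ inl p)
          ; incomparable-0 = λ i j inc w → trans (sym (pair-quadric-expo f (map inl w) (inl i) (inl j)))
              (annihilates-∈ f ann (∈-++⁺ʳ I (∈-++⁺ˡ (∈-map⁺ xx (∈-filter⁺ inc? (∈-cartesianProduct⁺ (∈-allFin i) (∈-allFin j)) inc)))) (expo (map inl w)))
          ; outside-0      = λ i {e} e∉i w → trans (∑-cong (allFin m) (λ j → cong (h (cl ⁅ e ⁆) j ⊗_) (f-↭ {inl i ∷ inl j ∷ map inl w} (swap (inl i) (inl j) refl))))
              (trans (sym (y-linear e (inl i ∷ map inl w))) (trans (sym (pair-quadric-expo f (map inl w) (inr e) (inl i)))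
                (annihilates-∈ f ann (∈-++⁺ʳ I (∈-++⁺ʳ J₁ (∈-map⁺ yx (∈-filter⁺ out? (∈-cartesianProduct⁺ (∈-allFin e) (∈-allFin i)) e∉i)))) (expo (map inl w)))))
          ; atom-0         = λ {A} flatA ρA≡1 w → ∑-zero (allFin m) (λ j → trans (cong (_⊗ ξ (j ∷ w))
              (⊝-equal (cong (λ B → ind (B ⊆? flat j)) (flat-rank-≡ flat-⊥ (⊆-min A) (ℕP.≤-reflexive (trans (ℕP.suc-injective ρA≡1) (sym rank-⊥))))))) (QP.*-zeroˡ (ξ (j ∷ w))))
          }

        -- Letters pass one at a time from `v` to the pure `x`-word `u`. A letter `y_e` is first
        -- replaced by `h_{cl e}`, a combination of single letters `x_F`, so the total length stays
        -- `k`.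
        eliminate-y : ∀ {k} → (∀ w → length w ≡ k → ξ w ≡ 0ℚ) → ∀ v u → length v + length u ≡ k → f (expo (v ++ map inl u)) ≡ 0ℚ
        eliminate-y z []      u l = z u l
        eliminate-y {k} z (c ∷ v) u l = letter c (splitAt m c) refl
          where
          rest : List (Fin (m + n))
          rest = v ++ map inl u
          x-case : ∀ i → f (expo (inl i ∷ rest)) ≡ 0ℚ
          x-case i = trans (f-↭ (↭-sym (Perm.shift (inl i) v (map inl u)))) (eliminate-y z v (i ∷ u) (trans (ℕP.+-suc (length v) (length u)) l))
          letter : ∀ c d → splitAt m c ≡ d → f (expo (c ∷ rest)) ≡ 0ℚ
          letter c (inj₁ i) e = trans (cong (λ z → f (expo (z ∷ rest))) (sym (FinP.splitAt⁻¹-↑ˡ e))) (x-case i)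
          letter c (inj₂ y) e = trans (cong (λ z → f (expo (z ∷ rest))) (sym (FinP.splitAt⁻¹-↑ʳ e)))
            (trans (y-linear y rest) (∑-zero (allFin m) (λ i → trans (cong (h (cl ⁅ y ⁆) i ⊗_) (x-case i)) (QP.*-zeroʳ (h (cl ⁅ y ⁆) i)))))

      atoms : ∀ {G} → Elem G → ∃ λ A → Flat A × ρ A ≡ 1 × A ⊆ G
      atoms {G} _ = ⊥ , flat-⊥ , ρ⊥≡1 , ⊆-min G

      -- The letters `x_F` are expanded by Möbius inversion, while `y_e` becomes the single letter
      -- `cl e` because `y_e = h_{cl e}`.
      X : Fin (m + n) → Subset n → ℚ
      X z = [ (λ i → μ (flat i)) , (λ e G → ind (cl ⁅ e ⁆ ≟S G)) ]′ (splitAt m z)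

      X-inl : ∀ i → X (inl i) ≡ μ (flat i)
      X-inl i = cong [ (λ i → μ (flat i)) , (λ e G → ind (cl ⁅ e ⁆ ≟S G)) ]′ (FinP.splitAt-↑ˡ m i n)

      X-inr : ∀ e → X (inr e) ≡ λ G → ind (cl ⁅ e ⁆ ≟S G)
      X-inr e = cong [ (λ i → μ (flat i)) , (λ e G → ind (cl ⁅ e ⁆ ≟S G)) ]′ (FinP.splitAt-↑ʳ m n e)

      slot-x : ∀ i (g : Subset n → ℚ) → ∑ flats (λ B → X (inl i) B ⊗ g B) ≡ ∂ g (flat i)
      slot-x i g = cong (λ φ → ∑ flats (λ B → φ B ⊗ g B)) (X-inl i)

      slot-y : ∀ e (g : Subset n → ℚ) → ∑ flats (λ B → X (inr e) B ⊗ g B) ≡ g (cl ⁅ e ⁆)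
      slot-y e g = trans (cong (λ φ → ∑ flats (λ B → φ B ⊗ g B)) (X-inr e)) (pick-flat (cl-flat _) g)

      annihilation : ∀ η → Good η → Annihilates (λ μ → ev flats X (word μ) η) (I ++ J₁ ++ J₂)
      annihilation η good w i = generators-elim (λ g → ⟪ g , (λ ν → f (w +M ν)) ⟫ ≡ 0ℚ) on-linear on-xx on-yx (∈-lookup i)
        where
        open Good good using (symmetric; modular; extend)
        ζ : List (Fin (m + n)) → ℚ
        ζ v = ev flats X v η
        f : Mon (m + n) → ℚ
        f μ = ζ (word μ)
        f-expo : ∀ v → f (expo v) ≡ ζ v
        f-expo v = ev-perm flats X symmetric (word-expo v)
        slot : Subset n → ℚ
        slot B = ev flats X (word w) (λ v → η (B ∷ v))
        Φ : Subset n → Subset n → ℚ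
        Φ A B = ev flats X (word w) (λ v → η (A ∷ B ∷ v))
        Φ-modular : ∀ A B → Φ A B ⊕ Φ (A ∨ B) (A ∨ B) ≡ Φ A (A ∨ B) ⊕ Φ (A ∨ B) B
        Φ-modular A B = trans (sym (ev-⊕ flats X (word w) _ _)) (trans (ev-cong flats X (word w) (λ v _ → modular A B v)) (ev-⊕ flats X (word w) _ _))
        Φ-extend : ∀ e B → Φ (cl ⁅ e ⁆) B ≡ Φ (cl ⁅ e ⁆) (cl ⁅ e ⁆ ∨ B)
        Φ-extend e B = trans (ev-cong flats X (word w) (λ v _ → extend B v (ℕP.≤-reflexive (rank-cl-⁅⁆ e)))) (cong (Φ (cl ⁅ e ⁆)) (∨-comm B (cl ⁅ e ⁆)))
        on-linear : ∀ e → ⟪ linear e , (λ ν → f (w +M ν)) ⟫ ≡ 0ℚ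
        on-linear e = trans (pair-sub (varP (inr e)) (lin e) (λ ν → f (w +M ν))) (⊝-equal (begin
          ⟪ varP (inr e) , (λ ν → f (w +M ν)) ⟫                    ≡⟨ trans (pair-var-shift f w (inr e)) (f-expo (inr e ∷ word w)) ⟩
          ζ (inr e ∷ word w)                                       ≡⟨ slot-y e slot ⟩
          slot (cl ⁅ e ⁆)                                          ≡⟨ h-inverse (cl-flat _ , s≤s z≤n) slot (ev-0 flats X (word w) (λ v _ → Good.atom-0 good ρ⊥≡1 v)) ⟨
          ∑ (allFin m) (λ i → h (cl ⁅ e ⁆) i ⊗ ∂ slot (flat i))    ≡⟨ ∑-missing e (λ i → ∂ slot (flat i)) ⟨
          ∑ (missing e) (λ i → ∂ slot (flat i))                    ≡⟨ ∑-cong (missing e) (λ i → trans (f-expo (inl i ∷ word w)) (slot-x i slot)) ⟨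
          ∑ (missing e) (λ i → f (expo (inl i ∷ word w)))          ≡⟨ pair-sum-vars f w inl (missing e) ⟨
          ⟪ lin e , (λ ν → f (w +M ν)) ⟫                           ∎))
          where open ≡-Reasoning
        on-xx : ∀ i j → Incomparable (flat i) (flat j) → ⟪ xx (i , j) , (λ ν → f (w +M ν)) ⟫ ≡ 0ℚ
        on-xx i j inc = trans (pair-quadric f w (inl i) (inl j)) (trans (f-expo (inl i ∷ inl j ∷ word w))
          (trans (slot-x i (λ A → ∑ flats (λ B → X (inl j) B ⊗ Φ A B)))
            (trans (∑-cong flats (λ A → cong (μ (flat i) A ⊗_) (slot-x j (Φ A)))) (∂∂-incomparable Φ Φ-modular (flat-flat i) (flat-flat j) inc))))
        -- Once `y_e` is read as `cl e`, the property `extend` makes the remaining slot invariant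
        -- under joining `cl e`. Weisner's theorem then applies at a flat not containing `e`.
        on-yx : ∀ e i → e ∉ flat i → ⟪ yx (e , i) , (λ ν → f (w +M ν)) ⟫ ≡ 0ℚ
        on-yx e i e∉i = trans (pair-quadric f w (inr e) (inl i)) (trans (f-expo (inr e ∷ inl i ∷ word w))
          (trans (slot-y e (λ A → ∑ flats (λ B → X (inl i) B ⊗ Φ A B)))
            (trans (slot-x i (Φ (cl ⁅ e ⁆))) (weisner {cl ⁅ e ⁆} (Φ (cl ⁅ e ⁆)) (λ {B} _ → Φ-extend e B) (flat-flat i) (λ E⊆ → e∉i (cl-⁅⁆-∈ E⊆))))))

      inverse : ∀ η A → Elem A → Good η → ∀ as →
        ∑ (allFin (m + n)) (λ z → H A z ⊗ ∑ flats (λ B → X z B ⊗ η (B ∷ as))) ≡ η (A ∷ as)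
      inverse η A el good as = trans (∑-H A (λ z → ∑ flats (λ B → X z B ⊗ η (B ∷ as))))
        (trans (∑-cong (allFin m) (λ i → cong (h A i ⊗_) (slot-x i (λ B → η (B ∷ as)))))
          (h-inverse el (λ B → η (B ∷ as)) (Good.atom-0 good ρ⊥≡1 as)))

      vanishing : ∀ k f → Annihilates f (I ++ J₁ ++ J₂) →
        (∀ v → Nested ⊥ 0 v → length v ≡ k → ev (allFin (m + n)) H v (f ∘ expo) ≡ 0ℚ) → ∀ w → length w ≡ k → f (expo w) ≡ 0ℚ
      vanishing k f ann z w l = trans (cong (f ∘ expo) (sym (ListP.++-identityʳ w)))
        (eliminate-y f ann (x-spanning (x-relations f ann) atoms k (λ v N e → trans (sym (ev-H v (f ∘ expo))) (z v N e)))
          w [] (trans (ℕP.+-identityʳ (length w)) l))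

    augmented-hilbert : ∀ {k h} → GradedDim (augChowPresentation M) k h → h ≡ length (enum (suc (rk M)) ⊥ 0 k)
    augmented-hilbert = hilbert-function (augChowPresentation M) H X flat-⊥ gens-deg vanishing annihilation inverse

open import Data.Fin.Subset using (⊤)
open GammaClosure using (γ-ext)
open Counting using (enum-γ-chow; enum-γ-augmented)
open Rings using (module LooplessMatroid; module Chow; module Augmented)

theorem3p25 : (n : ℕ) (M : Matroid n) → Loopless M →
    ((h : ℕ → ℕ) → IsHilbertFunction (chowPresentation M) h → 1 ≤ rk M →
    GammaPositive (rk M ∸ 1) h)
    × ((h : ℕ → ℕ) → IsHilbertFunction (augChowPresentation M) h →
    GammaPositive (rk M) h)
theorem3p25 n M loopless = chow , augmented
  where
  open LooplessMatroid M loopless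
  chow : (h : ℕ → ℕ) → IsHilbertFunction (chowPresentation M) h → 1 ≤ rk M → GammaPositive (rk M ∸ 1) h
  -- Positive rank supplies an element `i₀`, whose closure is the reference atom `b` of the Chow
  -- ring.
  chow h hilbert 1≤rk with i₀ , _ ← positive-rank-witness {⊤} 1≤rk =
    γ-ext (rk M ∸ 1) (λ k → sym (Chow.chow-hilbert M loopless i₀ (hilbert k))) (enum-γ-chow M flat-⊥ 1≤rk)
  augmented : (h : ℕ → ℕ) → IsHilbertFunction (augChowPresentation M) h → GammaPositive (rk M) h
  augmented h hilbert = γ-ext (rk M) (λ k → sym (Augmented.augmented-hilbert M loopless (hilbert k))) (enum-γ-augmented M flat-⊥)
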